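{- Let $p$ be an odd prime, let $m$ be any positive integer, and let $a\in\mathbb{F}_{p^m}^\times$. Then $\zeta_{x^{p^m}+ax}(\overline{\mathbb{F}}_p;t)$ is transcendental over $\mathbb{Q}(t)$.
   Context: Let $\overline{\mathbb{F}}_p$ be an algebraic closure of $\mathbb{F}_p$ and $\mathbb{F}_{p^m}\subset\overline{\mathbb{F}}_p$ its subfield with $p^m$ elements. For a polynomial $f\in\overline{\mathbb{F}}_p[x]$ of degree $d\geq 2$, regard $f$ as a self-map of $\mathbb{A}^1(\overline{\mathbb{F}}_p)=\overline{\mathbb{F}}_p$. Write $f^n$ for $f$ composed with itself $n$ times, and let $a_n=\#\{x\in\overline{\mathbb{F}}_p : f^n(x)=x\}$, the number of fixed points of $f^n$, counted without multiplicity (this is finite, with $a_n\leq d^n$). The Artin-Mazur zeta function of $f$ is the formal power series $$\zeta_f(\overline{\mathbb{F}}_p;t)=\exp\left(\sum_{n=1}^\infty a_n\frac{t^n}{n}\right)\in\mathbb{Q}[[t]].$$ Here $\zeta_{x^{p^m}+ax}$ denotes the zeta function of the map $x\mapsto x^{p^m}+ax$. Transcendence over $\mathbb{Q}(t)$ is understood inside the field of formal Laurent series $\mathbb{Q}((t))$, which contains both $\mathbb{Q}(t)$ and $\mathbb{Q}[[t]]$. -}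

module Defs where

open import Level using (Level; 0ℓ; _⊔_) renaming (suc to lsuc)
open import Algebra.Bundles using (CommutativeRing)
open import Algebra.Bundles.Raw using (RawRing)
import Algebra.Definitions.RawSemiring as RawSemiringDefinitions
open import Data.Fin.Base using (toℕ)
open import Data.Integer.Base using (+_)
open import Data.List.Base as List using (List; []; _∷_; _++_; [_]; length)
open import Data.List.Relation.Unary.All as All using (All; []; _∷_)
open import Data.List.Relation.Unary.All.Properties using (¬Any⇒All¬)
open import Data.List.Relation.Unary.AllPairs.Core using ([]; _∷_)
open import Data.List.Relation.Unary.Any as Any using (Any; here; there; any?)
import Data.List.Membership.Setoid as SetoidMembership
import Data.List.Relation.Unary.Unique.Setoid as SetoidUnique
open import Data.Nat.Base as ℕ using (ℕ; zero; suc; _∸_; _!; z≤n; s≤s)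
import Data.Nat.Properties as ℕ
open import Data.Nat.Primality using (Prime; prime⇒nonTrivial)
open import Data.Product.Base using (Σ-syntax; ∃-syntax; _×_; _,_; proj₁; proj₂)
open import Data.Rational.Base as ℚ using (ℚ; 0ℚ; 1ℚ)
import Data.Rational.Properties as ℚ
open import Data.Vec.Base as Vec using (Vec; []; _∷_; toList)
open import Function.Base using (_∘_)
import Function.Endo.Propositional as Endo
open import Relation.Binary.Bundles using (Setoid)
open import Relation.Binary.Definitions using (Decidable)
open import Relation.Binary.PropositionalEquality.Core as ≡ using (_≡_; _≗_)
open import Relation.Nullary using (¬_; yes; no; contradiction)
open import Relation.Unary using (Pred; _∈_)
import Relation.Binary.Reasoning.Setoid as SetoidReasoning
open import Algebra.Properties.Monoid.Sum
  (CommutativeRing.+-monoid ℚ.+-*-commutativeRing) using (sum⁺-syntax)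

private
  variable
    c ℓ s : Level

-- A polynomial is the list of its coefficients, constant term first;
-- trailing zeros are allowed, so it is nonzero when some entry is.

module _ (R : RawRing c ℓ) where
  open RawRing R

  evaluate : List Carrier → Carrier → Carrier
  evaluate []       x = 0#
  evaluate (k ∷ ks) x = k + x * evaluate ks x

  NonzeroPolynomial : Pred (List Carrier) (c ⊔ ℓ)
  NonzeroPolynomial = Any (_≉ 0#)

  -- S is meant to be a subfield of R.
  Algebraic : Pred Carrier s → Pred Carrier (c ⊔ ℓ ⊔ s)
  Algebraic S x =
    ∃[ ks ] All S ks × NonzeroPolynomial ks × evaluate ks x ≈ 0#

  Transcendental : Pred Carrier s → Pred Carrier (c ⊔ ℓ ⊔ s)
  Transcendental S x = ¬ Algebraic S x

record HasCardinality (A : Setoid c ℓ) (P : Pred (Setoid.Carrier A) s) (n : ℕ)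
                      : Set (c ⊔ ℓ ⊔ s) where
  open SetoidMembership A using () renaming (_∈_ to _∈ₗ_)
  open SetoidUnique A using (Unique)
  field
    elements : List (Setoid.Carrier A)
    unique   : Unique elements
    sound    : All P elements
    complete : ∀ {x} → P x → x ∈ₗ elements
    size     : length elements ≡ n

Finite : (A : Setoid c ℓ) → Pred (Setoid.Carrier A) s → Set (c ⊔ ℓ ⊔ s)
Finite A P = ∃[ n ] HasCardinality A P n

-- Decidable equality costs no generality here: an algebraic extension of 𝔽ₚ
-- is a union of finite fields.
record DiscreteField c ℓ : Set (lsuc (c ⊔ ℓ)) where
  field
    commutativeRing : CommutativeRing c ℓ

  open CommutativeRing commutativeRing public

  field
    0≉1     : 0# ≉ 1#
    inverse : ∀ {x} → x ≉ 0# → ∃[ y ] x * y ≈ 1#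
    _≟_     : Decidable _≈_

  open RawSemiringDefinitions (RawRing.rawSemiring rawRing) public
    using (_^_) renaming (_×_ to _·_)

module _ (K : DiscreteField c ℓ) where
  open DiscreteField K

  record IsSubfield (F : Pred Carrier s) : Set (c ⊔ ℓ ⊔ s) where
    field
      respects         : ∀ {x y} → x ≈ y → x ∈ F → y ∈ F
      0#-closed        : 0# ∈ F
      1#-closed        : 1# ∈ F
      +-closed         : ∀ {x y} → x ∈ F → y ∈ F → x + y ∈ F
      *-closed         : ∀ {x y} → x ∈ F → y ∈ F → x * y ∈ F
      neg-closed       : ∀ {x} → x ∈ F → - x ∈ F
      inverse-closed   : ∀ {x y} → x ∈ F → x * y ≈ 1# → y ∈ F

  AlgebraicallyClosed : Set (c ⊔ ℓ)
  AlgebraicallyClosed = ∀ k ks → NonzeroPolynomial rawRing ks →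
    ∃[ x ] evaluate rawRing (k ∷ ks) x ≈ 0#

  -- In positive characteristic this is the copy of 𝔽ₚ inside K.
  PrimeField : Pred Carrier ℓ
  PrimeField x = ∃[ n ] x ≈ n · 1#

  record IsAlgebraicClosureOf𝔽 (p : ℕ) : Set (c ⊔ ℓ) where
    field
      characteristic      : p · 1# ≈ 0#
      algebraic           : ∀ x → Algebraic rawRing PrimeField x
      algebraicallyClosed : AlgebraicallyClosed

  -- The vector lists the coefficients below the leading one, k.
  HasDegree : ℕ → (Carrier → Carrier) → Set (c ⊔ ℓ)
  HasDegree d g = Σ[ ks ∈ Vec Carrier d ] ∃[ k ]
    k ≉ 0# × (∀ x → g x ≈ evaluate rawRing (toList ks ++ [ k ]) x)

  FixedPoint : (Carrier → Carrier) → Pred Carrier ℓ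
  FixedPoint g x = g x ≈ x

module _ (K : DiscreteField c ℓ) where
  open DiscreteField K
  open Endo Carrier using () renaming (_^_ to _^∘_)

  private
    open import Algebra.Solver.Ring.NaturalCoefficients.Default
      commutativeSemiring using (solve; _:+_; _:*_; _:=_)
    open import Algebra.Properties.Ring ring
      using (-1*x≈-x)
    open import Algebra.Properties.Group +-group
      using (x∙y⁻¹≈ε⇒x≈y; x≈y⇒x∙y⁻¹≈ε)
    open SetoidReasoning setoid
    open SetoidMembership setoid using () renaming (_∈_ to _∈ₗ_)

    ev : List Carrier → Carrier → Carrier
    ev = evaluate rawRing

    HasDegreeBelow : ℕ → (Carrier → Carrier) → Set (c ⊔ ℓ)
    HasDegreeBelow d g =
      Σ[ ks ∈ Vec Carrier d ] (∀ x → g x ≈ ev (toList ks) x)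

    *-nonzero : ∀ {x y} → x * y ≈ 0# → x ≉ 0# → y ≈ 0#
    *-nonzero {x} {y} xy≈0 x≉0 with z , xz≈1 ← inverse x≉0 = begin
      y              ≈⟨ *-identityˡ y ⟨
      1# * y         ≈⟨ *-congʳ xz≈1 ⟨
      (x * z) * y    ≈⟨ solve 3 (λ x y z → x :* z :* y := z :* (x :* y)) refl x y z ⟩
      z * (x * y)    ≈⟨ *-congˡ xy≈0 ⟩
      z * 0#         ≈⟨ zeroʳ z ⟩
      0#             ∎

    zeros : ∀ d → Vec Carrier d
    zeros d = Vec.replicate d 0#

    ev-zeros : ∀ d x → ev (toList (zeros d)) x ≈ 0#
    ev-zeros zero    x = refl
    ev-zeros (suc d) x = begin
      0# + x * ev (toList (zeros d)) x ≈⟨ +-identityˡ _ ⟩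
      x * ev (toList (zeros d)) x      ≈⟨ *-congˡ (ev-zeros d x) ⟩
      x * 0#                           ≈⟨ zeroʳ x ⟩
      0#                               ∎

    constant-below : ∀ d k → HasDegreeBelow (suc d) (λ _ → k)
    constant-below d k = k ∷ zeros d , λ x → sym (begin
      k + x * ev (toList (zeros d)) x ≈⟨ +-congˡ (*-congˡ (ev-zeros d x)) ⟩
      k + x * 0#                      ≈⟨ +-congˡ (zeroʳ x) ⟩
      k + 0#                          ≈⟨ +-identityʳ k ⟩
      k                               ∎)

    linear-below : ∀ {d} → 2 ℕ.≤ d → ∀ k → HasDegreeBelow d (λ x → k * x)
    linear-below {suc (suc d)} _ k with ks , ks≈ ← constant-below d k =
      0# ∷ ks , λ x → begin
        k * x                      ≈⟨ *-comm k x ⟩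
        x * k                      ≈⟨ *-congˡ (ks≈ x) ⟩
        x * ev (toList ks) x       ≈⟨ +-identityˡ _ ⟨
        0# + x * ev (toList ks) x  ∎
    linear-below {suc zero} (s≤s ()) k

    +-below : ∀ {d g h} → HasDegree K d g → HasDegreeBelow d h →
              HasDegree K d (λ x → g x + h x)
    +-below {g = g} {h} (ks , k , k≉0 , g≈) (ls , h≈) =
      Vec.zipWith _+_ ks ls , k , k≉0 ,
      λ x → trans (+-cong (g≈ x) (h≈ x)) (lemma ks ls x)
      where
      lemma : ∀ {d} (ks ls : Vec Carrier d) x →
              ev (toList ks ++ [ k ]) x + ev (toList ls) x ≈
              ev (toList (Vec.zipWith _+_ ks ls) ++ [ k ]) x
      lemma []        []        x = +-identityʳ _
      lemma (k₁ ∷ ks) (l₁ ∷ ls) x = trans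
        (solve 5 (λ k l x e f → (k :+ x :* e) :+ (l :+ x :* f) := (k :+ l) :+ x :* (e :+ f))
               refl k₁ l₁ x _ _)
        (+-congˡ (*-congˡ (lemma ks ls x)))

    degree⇒below : ∀ {d g} → HasDegree K d g → HasDegreeBelow (suc d) g
    degree⇒below (ks , k , _ , g≈) =
      ks Vec.∷ʳ k , λ x → trans (g≈ x) (reflexive (≡.cong (λ l → ev l x) (lemma ks)))
      where
      lemma : ∀ {d} (ks : Vec Carrier d) → toList ks ++ [ k ] ≡ toList (ks Vec.∷ʳ k)
      lemma []       = ≡.refl
      lemma (l ∷ ks) = ≡.cong (l ∷_) (lemma ks)

    pad : ∀ {d g} e → HasDegreeBelow d g → HasDegreeBelow (e ℕ.+ d) g
    pad zero    g-below = g-below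
    pad {g = g} (suc e) g-below with ks , g≈ ← pad e g-below =
      ks Vec.∷ʳ 0# , λ x → trans (g≈ x) (lemma ks x)
      where
      lemma : ∀ {d} (ks : Vec Carrier d) x → ev (toList ks) x ≈ ev (toList (ks Vec.∷ʳ 0#)) x
      lemma []       x = sym (trans (+-identityˡ _) (zeroʳ x))
      lemma (k ∷ ks) x = +-congˡ (*-congˡ (lemma ks x))

    scale-below : ∀ {d g} k → HasDegreeBelow d g → HasDegreeBelow d (λ x → k * g x)
    scale-below k (ks , g≈) =
      Vec.map (k *_) ks , λ x → trans (*-congˡ (g≈ x)) (lemma ks x)
      where
      lemma : ∀ {d} (ks : Vec Carrier d) x →
              k * ev (toList ks) x ≈ ev (toList (Vec.map (k *_) ks)) x
      lemma []       x = zeroʳ k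
      lemma (l ∷ ks) x = trans
        (solve 4 (λ k l x e → k :* (l :+ x :* e) := k :* l :+ x :* (k :* e)) refl k l x _)
        (+-congˡ (*-congˡ (lemma ks x)))

    scale : ∀ {d g} k → k ≉ 0# → HasDegree K d g → HasDegree K d (λ x → k * g x)
    scale k k≉0 (ks , m , m≉0 , g≈) =
      Vec.map (k *_) ks , k * m , (λ km≈0 → m≉0 (*-nonzero km≈0 k≉0)) ,
      λ x → trans (*-congˡ (g≈ x)) (lemma ks x)
      where
      lemma : ∀ {d} (ks : Vec Carrier d) x →
              k * ev (toList ks ++ [ m ]) x ≈ ev (toList (Vec.map (k *_) ks) ++ [ k * m ]) x
      lemma []       x = begin
        k * (m + x * 0#)    ≈⟨ *-congˡ (+-congˡ (zeroʳ x)) ⟩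
        k * (m + 0#)        ≈⟨ *-congˡ (+-identityʳ m) ⟩
        k * m               ≈⟨ +-identityʳ _ ⟨
        k * m + 0#          ≈⟨ +-congˡ (zeroʳ x) ⟨
        k * m + x * 0#      ∎
      lemma (l ∷ ks) x = trans
        (solve 4 (λ k l x e → k :* (l :+ x :* e) := k :* l :+ x :* (k :* e)) refl k l x _)
        (+-congˡ (*-congˡ (lemma ks x)))

    degree-cong : ∀ {d g h} → (∀ x → h x ≈ g x) → HasDegree K d g → HasDegree K d h
    degree-cong h≈g (ks , k , k≉0 , g≈) =
      ks , k , k≉0 , λ x → trans (h≈g x) (g≈ x)

    shift : ∀ {d g} → HasDegree K d g → HasDegree K (suc d) (λ x → x * g x)
    shift (ks , k , k≉0 , g≈) = 0# ∷ ks , k , k≉0 ,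
      λ x → trans (*-congˡ (g≈ x)) (sym (+-identityˡ _))

    *-degree : ∀ {d e g h} → HasDegree K d g → HasDegree K e h →
               HasDegree K (d ℕ.+ e) (λ x → g x * h x)
    *-degree {e = e} {h = h} (ks , k , k≉0 , g≈) h-deg =
      degree-cong (λ x → *-congʳ (g≈ x)) (go ks)
      where
      go : ∀ {d} (ks : Vec Carrier d) →
           HasDegree K (d ℕ.+ e) (λ x → ev (toList ks ++ [ k ]) x * h x)
      go [] = degree-cong
        (λ x → *-congʳ (trans (+-congˡ (zeroʳ x)) (+-identityʳ k)))
        (scale k k≉0 h-deg)
      go {suc d} (l ∷ ks) = degree-cong
        (λ x → solve 4 (λ l x g h → (l :+ x :* g) :* h := x :* (g :* h) :+ l :* h)
                     refl l x _ (h x))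
        (+-below (shift (go ks))
          (≡.subst (λ n → HasDegreeBelow n (λ x → l * h x)) (ℕ.+-suc d e)
            (pad d (scale-below l (degree⇒below h-deg)))))

    one-degree : HasDegree K 0 (λ _ → 1#)
    one-degree = [] , 1# , (0≉1 ∘ sym) , λ x →
      sym (trans (+-congˡ (zeroʳ x)) (+-identityʳ 1#))

  ^-degree : ∀ n → HasDegree K n (_^ n)
  ^-degree zero    = one-degree
  ^-degree (suc n) = shift (^-degree n)

  ^+linear-degree : ∀ {n} → 2 ℕ.≤ n → ∀ a → HasDegree K n (λ x → x ^ n + a * x)
  ^+linear-degree {n} 2≤n a = +-below (^-degree n) (linear-below 2≤n a)

  private
    ∘-degree : ∀ {d e f g} → 1 ℕ.≤ e → HasDegree K d f → HasDegree K e g →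
               HasDegree K (d ℕ.* e) (λ x → f (g x))
    ∘-degree {e = suc e} {g = g} _ (ks , k , k≉0 , f≈) g-deg =
      degree-cong (λ x → f≈ (g x)) (go ks)
      where
      go : ∀ {d} (ks : Vec Carrier d) →
           HasDegree K (d ℕ.* suc e) (λ x → ev (toList ks ++ [ k ]) (g x))
      go [] = [] , k , k≉0 , λ x → +-congˡ (trans (zeroʳ _) (sym (zeroʳ x)))
      go (l ∷ ks) = degree-cong (λ x → +-comm l _)
        (+-below (*-degree g-deg (go ks)) (constant-below _ l))

    iterate-degree : ∀ {d f} → 1 ℕ.≤ d → HasDegree K d f →
                     ∀ n → HasDegree K (d ℕ.^ n) (f ^∘ n)
    iterate-degree 1≤d f-deg zero = (0# ∷ []) , 1# , (0≉1 ∘ sym) , λ x → sym (begin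
      0# + x * (1# + x * 0#)  ≈⟨ +-identityˡ _ ⟩
      x * (1# + x * 0#)       ≈⟨ *-congˡ (+-congˡ (zeroʳ x)) ⟩
      x * (1# + 0#)           ≈⟨ *-congˡ (+-identityʳ 1#) ⟩
      x * 1#                  ≈⟨ *-identityʳ x ⟩
      x                       ∎)
    iterate-degree {d} 1≤d f-deg (suc n) =
      ∘-degree (ℕ.m^n>0 d {{ℕ.>-nonZero 1≤d}} n) f-deg (iterate-degree 1≤d f-deg n)

    quotient : ∀ {d g} → HasDegree K (suc d) g → ∀ r →
               Σ[ h ∈ (Carrier → Carrier) ]
               HasDegree K d h × (∀ x → g x ≈ g r + (x - r) * h x)
    quotient (ks , k , k≉0 , g≈) r =
      let h , h-deg , eq = go ks
      in  h , h-deg , λ x → trans (g≈ x) (trans (eq x) (+-congʳ (sym (g≈ r))))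
      where
      P : ∀ {d} → Vec Carrier d → Carrier → Carrier
      P ks = ev (toList ks ++ [ k ])

      -- From P x = P r + (x - r) h one gets
      -- l + x (P x) = l + r (P r) + (x - r) (P x + r h).
      step : ∀ l x e f h → e ≈ f + (x - r) * h →
             l + x * e ≈ (l + r * f) + (x - r) * (e + r * h)
      step l x e f h e≈ = sym (begin
        (l + r * f) + (x - r) * (e + r * h)
          ≈⟨ solve 7 (λ l x e f h r s →
               (l :+ r :* f) :+ (x :+ s) :* (e :+ r :* h) :=
               (l :+ x :* e) :+ (s :* e :+ r :* (f :+ (x :+ s) :* h)))
               refl l x e f h r (- r) ⟩
        (l + x * e) + (- r * e + r * (f + (x - r) * h))
          ≈⟨ +-congˡ (+-congˡ (*-congˡ e≈)) ⟨
        (l + x * e) + (- r * e + r * e)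
          ≈⟨ +-congˡ (distribʳ e (- r) r) ⟨
        (l + x * e) + (- r + r) * e
          ≈⟨ +-congˡ (*-congʳ (-‿inverseˡ r)) ⟩
        (l + x * e) + 0# * e
          ≈⟨ +-congˡ (zeroˡ e) ⟩
        (l + x * e) + 0#
          ≈⟨ +-identityʳ _ ⟩
        l + x * e ∎)

      go : ∀ {d} (ks : Vec Carrier (suc d)) →
           Σ[ h ∈ (Carrier → Carrier) ]
           HasDegree K d h × (∀ x → P ks x ≈ P ks r + (x - r) * h x)
      go (l ∷ []) =
        (λ x → P [] x + r * 0#) ,
        ([] , k , k≉0 , λ x → trans (+-congˡ (zeroʳ r)) (+-identityʳ _)) ,
        λ x → step l x (P [] x) (P [] r) 0# (begin
          k + x * 0#                     ≈⟨ +-congˡ (trans (zeroʳ x) (sym (zeroʳ r))) ⟩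
          k + r * 0#                     ≈⟨ +-identityʳ _ ⟨
          (k + r * 0#) + 0#              ≈⟨ +-congˡ (zeroʳ (x - r)) ⟨
          (k + r * 0#) + (x - r) * 0#    ∎)
      go (l ∷ ks@(_ ∷ _)) =
        let h , h-deg , eq = go ks in
        (λ x → P ks x + r * h x) ,
        +-below (ks , k , k≉0 , λ _ → refl) (scale-below r (degree⇒below h-deg)) ,
        λ x → step l x (P ks x) (P ks r) (h x) (eq x)

    module Roots (closed : AlgebraicallyClosed K) where

      leading-nonzero : ∀ {d} (ks : Vec Carrier d) {k} → k ≉ 0# →
                        NonzeroPolynomial rawRing (toList ks ++ [ k ])
      leading-nonzero []       k≉0 = here k≉0
      leading-nonzero (_ ∷ ks) k≉0 = there (leading-nonzero ks k≉0)

      root : ∀ {d g} → HasDegree K (suc d) g → ∃[ r ] g r ≈ 0#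
      root (l ∷ ks , k , k≉0 , g≈)
        with r , r-root ← closed l (toList ks ++ [ k ]) (leading-nonzero ks k≉0) =
        r , trans (g≈ r) r-root

      insert : ∀ {g h : Carrier → Carrier} r → g r ≈ 0# →
               (∀ x → g x ≈ (x - r) * h x) →
               Finite setoid (λ x → h x ≈ 0#) → Finite setoid (λ x → g x ≈ 0#)
      insert {g} {h} r r-root eq (n , fin) = result
        where
        open HasCardinality fin

        h⇒g : ∀ {x} → h x ≈ 0# → g x ≈ 0#
        h⇒g {x} hx≈0 = trans (eq x) (trans (*-congˡ hx≈0) (zeroʳ _))

        g⇒h : ∀ {x} → g x ≈ 0# → x ≉ r → h x ≈ 0#
        g⇒h {x} gx≈0 x≉r =
          *-nonzero (trans (sym (eq x)) gx≈0) (λ x-r≈0 → x≉r (x∙y⁻¹≈ε⇒x≈y _ _ x-r≈0))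

        result : Finite setoid (λ x → g x ≈ 0#)
        result with any? (r ≟_) elements
        ... | yes r∈ = n , record
          { elements = elements
          ; unique   = unique
          ; sound    = All.map h⇒g sound
          ; complete = covered
          ; size     = size
          }
          where
          covered : ∀ {x} → g x ≈ 0# → x ∈ₗ elements
          covered {x} gx≈0 with x ≟ r
          ... | yes x≈r = Any.map (trans x≈r) r∈
          ... | no  x≉r = complete (g⇒h gx≈0 x≉r)
        ... | no r∉ = suc n , record
          { elements = r ∷ elements
          ; unique   = ¬Any⇒All¬ elements r∉ ∷ unique
          ; sound    = r-root ∷ All.map h⇒g sound
          ; complete = covered
          ; size     = ≡.cong suc size
          }
          where
          covered : ∀ {x} → g x ≈ 0# → x ∈ₗ (r ∷ elements)
          covered {x} gx≈0 with x ≟ r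
          ... | yes x≈r = here x≈r
          ... | no  x≉r = there (complete (g⇒h gx≈0 x≉r))

      roots-finite : ∀ {d g} → HasDegree K d g → Finite setoid (λ x → g x ≈ 0#)
      roots-finite {zero} ([] , k , k≉0 , g≈) = 0 , record
        { elements = []
        ; unique   = []
        ; sound    = []
        ; complete = λ {x} gx≈0 → contradiction
            (trans (sym (trans (g≈ x) (trans (+-congˡ (zeroʳ x)) (+-identityʳ k)))) gx≈0) k≉0
        ; size     = ≡.refl
        }
      roots-finite {suc d} {g} g-deg
        with r , r-root ← root g-deg
        with h , h-deg , eq ← quotient g-deg r =
        insert r r-root
               (λ x → trans (eq x) (trans (+-congʳ r-root) (+-identityˡ _)))
               (roots-finite h-deg)

  fixedPoints-finite : AlgebraicallyClosed K → ∀ {d f} → 2 ℕ.≤ d → HasDegree K d f →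
                       ∀ n → Finite setoid (FixedPoint K (f ^∘ suc n))
  fixedPoints-finite closed {d} {f} 2≤d f-deg n = proj₁ roots , record
    { elements = elements
    ; unique   = unique
    ; sound    = All.map root⇒fixed sound
    ; complete = λ fixed → complete (fixed⇒root fixed)
    ; size     = size
    }
    where
    1≤d : 1 ℕ.≤ d
    1≤d = ℕ.≤-trans (s≤s z≤n) 2≤d

    2≤dⁿ : 2 ℕ.≤ d ℕ.^ suc n
    2≤dⁿ = ℕ.*-mono-≤ 2≤d (ℕ.m^n>0 d {{ℕ.>-nonZero 1≤d}} n)

    roots : Finite setoid (λ x → (f ^∘ suc n) x + - 1# * x ≈ 0#)
    roots = Roots.roots-finite closed
      (+-below (iterate-degree 1≤d f-deg (suc n)) (linear-below 2≤dⁿ (- 1#)))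

    open HasCardinality (proj₂ roots)

    root⇒fixed : ∀ {x y} → y + - 1# * x ≈ 0# → y ≈ x
    root⇒fixed eq = x∙y⁻¹≈ε⇒x≈y _ _ (trans (+-congˡ (sym (-1*x≈-x _))) eq)

    fixed⇒root : ∀ {x y} → y ≈ x → y + - 1# * x ≈ 0#
    fixed⇒root y≈x = trans (+-congˡ (-1*x≈-x _)) (x≈y⇒x∙y⁻¹≈ε y≈x)

2≤p^m : ∀ {p m} → Prime p → 1 ℕ.≤ m → 2 ℕ.≤ p ℕ.^ m
2≤p^m {p} {suc m} p-prime _ = ℕ.*-mono-≤ 2≤p
  (ℕ.m^n>0 p {{ℕ.>-nonZero (ℕ.≤-trans (s≤s z≤n) 2≤p)}} m)
  where
  2≤p : 2 ℕ.≤ p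
  2≤p = ℕ.nonTrivial⇒n>1 p {{prime⇒nonTrivial p-prime}}

PowerSeries : Set
PowerSeries = ℕ → ℚ

ℚ⟦t⟧ : RawRing 0ℓ 0ℓ
ℚ⟦t⟧ = record
  { Carrier = PowerSeries
  ; _≈_     = _≗_
  ; _+_     = λ f g n → f n ℚ.+ g n
  ; _*_     = λ f g n → ∑[ i ≤ n ] (f (toℕ i) ℚ.* g (n ∸ toℕ i))
  ; -_      = λ f n → ℚ.- f n
  ; 0#      = λ _ → 0ℚ
  ; 1#      = λ { zero → 1ℚ ; (suc _) → 0ℚ }
  }

t^_∙_ : ℕ → PowerSeries → PowerSeries
(t^ zero  ∙ f) n       = f n
(t^ suc k ∙ f) zero    = 0ℚ
(t^ suc k ∙ f) (suc n) = (t^ k ∙ f) n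

-- t^- k ∙ f stands for t⁻ᵏ f; the exponent k need not be minimal.
record LaurentSeries : Set where
  constructor t^-_∙_
  field
    pole   : ℕ
    series : PowerSeries

ℚ⦅t⦆ : RawRing 0ℓ 0ℓ
ℚ⦅t⦆ = record
  { Carrier = LaurentSeries
  ; _≈_     = λ (t^- k ∙ f) (t^- l ∙ g) → (t^ l ∙ f) ≈ (t^ k ∙ g)
  ; _+_     = λ (t^- k ∙ f) (t^- l ∙ g) → t^- (k ℕ.+ l) ∙ ((t^ l ∙ f) + (t^ k ∙ g))
  ; _*_     = λ (t^- k ∙ f) (t^- l ∙ g) → t^- (k ℕ.+ l) ∙ (f * g)
  ; -_      = λ (t^- k ∙ f) → t^- k ∙ (- f)
  ; 0#      = t^- 0 ∙ 0#
  ; 1#      = t^- 0 ∙ 1#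
  }
  where open RawRing ℚ⟦t⟧

fromPowerSeries : PowerSeries → LaurentSeries
fromPowerSeries f = t^- 0 ∙ f

fromPolynomial : List ℚ → LaurentSeries
fromPolynomial = fromPowerSeries ∘ coefficient
  where
  coefficient : List ℚ → PowerSeries
  coefficient []       _       = 0ℚ
  coefficient (k ∷ ks) zero    = k
  coefficient (k ∷ ks) (suc n) = coefficient ks n

ℚ⟨t⟩ : Pred LaurentSeries 0ℓ
ℚ⟨t⟩ f = ∃[ num ] ∃[ den ] NonzeroPolynomial ℚ.+-*-rawRing den ×
  fromPolynomial den * f ≈ fromPolynomial num
  where open RawRing ℚ⦅t⦆

-- Only meaningful when f has zero constant term: then fᵏ has no terms of
-- degree below k, so the sum ∑ₖ fᵏ / k! stops at k = n in degree n.
exp : PowerSeries → PowerSeries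
exp f n = ∑[ k ≤ n ] (inverseFactorial (toℕ k) ℚ.* (f ^ toℕ k) n)
  where
  open RawSemiringDefinitions (RawRing.rawSemiring ℚ⟦t⟧) using (_^_)
  inverseFactorial : ℕ → ℚ
  inverseFactorial k = ((+ 1) ℚ./ (k !)) {{k ℕ.!≢0}}

module _ (K : DiscreteField c ℓ) (closed : AlgebraicallyClosed K) where
  open DiscreteField K

  module _ {d} (f : Carrier → Carrier) (2≤d : 2 ℕ.≤ d) (f-deg : HasDegree K d f) where

    -- The argument n stands for the iterate n + 1, since the zeroth iterate
    -- fixes every point.
    fixedPointCount : ℕ → ℕ
    fixedPointCount n = proj₁ (fixedPoints-finite K closed 2≤d f-deg n)

    logζ : PowerSeries
    logζ zero    = 0ℚ
    logζ (suc n) = (+ fixedPointCount n) ℚ./ suc n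

    ζ : PowerSeries
    ζ = exp logζ

{-# OPTIONS --safe #-}

-- Let q = pᵐ and f = x^q + a x. Since a^q = a, the additive polynomial fⁿ - x is
-- obtained from (T + a)ⁿ - 1 by reading T as x ↦ x^q, so it has qⁿ⁻ᵛ distinct roots, where
-- v is the order of vanishing of (T + a)ⁿ - 1 at T = 0: v = 0 if aⁿ ≠ 1, and otherwise
-- v = pᵏ is the largest power of p dividing n. With e = q - 1 it follows that aₙ / qⁿ has
-- period e pᵏ away from the multiples of pᵏ, but is not eventually periodic.
--
-- If ζ is algebraic over ℚ(t), then so is A = Σ aₙ tⁿ = t ζ′/ζ. Let r A^d + r′ A^(d-1) + ... = 0
-- be a relation of least degree over ℚ[t], and N a large power of p. Then A = R + D with
-- R rational and D a series in tᴺ. A relation of D can be split according to the exponents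
-- of t modulo N, so by minimality it has, up to a common factor, coefficients in ℚ(tᴺ);
-- comparing its two leading ones shows that d r A + r′ is r times a series in tᴺ. Hence
-- r A vanishes in a long range of degrees, against the aperiodicity of aₙ / qⁿ.
module Submission where

open import Defs
open import Data.Nat using (ℕ; _≤_) renaming (_^_ to _^ℕ_)
open import Data.Nat.Divisibility using (_∣_)
open import Data.Nat.Primality using (Prime)
open import Relation.Nullary using (¬_)
open import Relation.Unary using (Pred; _∈_)

open import Algebra.Bundles using (CommutativeRing; Semiring)
open import Algebra.Bundles.Raw using (RawRing)
import Algebra.Properties.CommutativeMonoid.Mult as CommutativeMult
import Algebra.Properties.CommutativeSemiring.Binomial as Binomial
import Algebra.Properties.CommutativeSemiring.Exp as CommutativeExp
import Algebra.Properties.Ring as RingProperties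
import Algebra.Properties.Semiring.Exp as SemiringExp
import Algebra.Properties.Semiring.Mult as SemiringMult
import Algebra.Properties.Semiring.Sum as SemiringSum
import Algebra.Solver.Ring
import Algebra.Solver.Ring.AlmostCommutativeRing as ACR
import Algebra.Solver.Ring.NaturalCoefficients.Default as NaturalCoefficients
open import Data.Fin.Base as Fin using (Fin; zero; suc; toℕ; punchIn)
import Data.Fin.Properties as Fin
open import Data.Integer.Base as ℤ using (ℤ; +_; -[1+_]; _⊖_)
import Data.Integer.Properties as ℤ
open import Data.List.Base as List using (List; []; _∷_; _++_; [_]; length)
import Data.List.Membership.Setoid as SetoidMembership
import Data.List.Membership.Setoid.Properties as Membership
import Data.List.Properties as List
import Data.List.Relation.Binary.Permutation.Setoid as SetoidPermutation
import Data.List.Relation.Binary.Permutation.Setoid.Properties as Permutation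
open import Data.List.Relation.Unary.All as All using (All; []; _∷_)
import Data.List.Relation.Unary.All.Properties as All
import Data.List.Relation.Unary.AllPairs as AllPairs
open import Data.List.Relation.Unary.AllPairs.Core using ([]; _∷_)
open import Data.List.Relation.Unary.Any as Any using (Any; here; there)
import Data.List.Relation.Unary.Any.Properties as Any
import Data.List.Relation.Unary.Unique.Setoid as SetoidUnique
import Data.List.Relation.Unary.Unique.Setoid.Properties as Unique
open import Data.Maybe.Base using (Maybe; just; nothing)
open import Data.Nat.Base as ℕ using (zero; suc; _∸_; _!; z≤n; s≤s)
open import Data.Nat.Combinatorics as ℕ using (_C_; nCk≡n!/k![n-k]!; k![n∸k]!∣n!)
open import Data.Nat.Coprimality using (Coprime; coprime-Bézout)
open import Data.Nat.DivMod as ℕ using (_%_)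
open import Data.Nat.Divisibility as ℕ using (_∣?_; divides)
import Data.Nat.GCD as GCD
open import Data.Nat.Induction using (<-wellFounded)
open import Data.Nat.Primality using (euclidsLemma; prime⇒nonTrivial; prime⇒irreducible; prime⇒nonZero)
import Data.Nat.Properties as ℕ
open import Data.Nat.Solver using (module +-*-Solver)
open import Data.Product.Base using (Σ-syntax; ∃-syntax; _×_; _,_; proj₁; proj₂)
open import Data.Rational.Base as ℚ using (ℚ; 0ℚ; 1ℚ)
import Data.Rational.Properties as ℚ
import Data.Rational.Unnormalised.Base as ℚᵘ
import Data.Rational.Unnormalised.Properties as ℚᵘ
open import Data.Sum.Base using (_⊎_; inj₁; inj₂)
open import Data.Vec.Functional as Vector using (insertAt)
import Data.Vec.Functional.Properties as Vector
open import Function.Base using (_∘_; id)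
import Function.Endo.Propositional as Endo
open import Induction.WellFounded using (Acc; acc)
open import Level using (Level; _⊔_; 0ℓ) renaming (suc to lsuc)
open import Relation.Binary.Bundles using (Setoid)
open import Relation.Binary.Definitions using (Decidable)
open import Relation.Binary.PropositionalEquality as ≡ using (_≡_; module ≡-Reasoning)
import Relation.Binary.Reasoning.Setoid as SetoidReasoning
open import Relation.Nullary using (Dec; yes; no; contradiction)
open import Relation.Nullary.Decidable using (¬?; decidable-stable)

-- No fraction field is built: everything happens in the domain of power series, over its subring of
-- polynomials. Denominators are multiplied out, and passing between A and Y = wA - U costs powers
-- of w.
--
-- The splitting modulo N is used in one residue class only, that of j = deg r, and only on the two
-- leading coefficients. Since N > j, the projection of r to this class is the single term rⱼ tʲ, so
-- that the proportionality of the leading coefficients can be read off degree by degree. Below N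
-- the rational part R has the coefficients of A itself; this is how a statement on R and r′ forces
-- coefficients of r A to vanish.
--
-- N is chosen last, after two windows of length j + 1 that start at e pᴷ and e pᴷ⁺¹ beyond the
-- degrees of r and r′. Periodicity makes the windows of A proportional except at their first
-- entries, where the orders of vanishing pᴷ and pᴷ⁺¹ differ. A coefficient of r A at the end of a
-- window meets its first entry with the factor rⱼ ≠ 0, so r A cannot vanish at both ends.

private
  variable
    c ℓ s s′ : Level

-- Solver coefficients and formal power series

-- With coefficients in ℤ the ring solver sees that x and - x cancel.
module IntegerCoefficients (R : CommutativeRing c ℓ) where
  open CommutativeRing R
  open SemiringMult semiring using (×-homo-+; ×1-homo-*) renaming (_×_ to _·_)
  open RingProperties ring
  open SetoidReasoning setoid
  open NaturalCoefficients commutativeSemiring using () renaming (solve to solveℕ; _:+_ to _⊞_; _:=_ to _≐_)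

  private
    ⟦_⟧ : ℤ → Carrier
    ⟦ + n ⟧      = n · 1#
    ⟦ -[1+ n ] ⟧ = - (suc n · 1#)

    ⊖-homo : ∀ m n → ⟦ m ⊖ n ⟧ ≈ m · 1# - n · 1#
    ⊖-homo m zero          = sym (trans (+-congˡ -0#≈0#) (+-identityʳ _))
    ⊖-homo zero (suc n)    = sym (+-identityˡ _)
    ⊖-homo (suc m) (suc n) = begin
      ⟦ suc m ⊖ suc n ⟧                          ≡⟨ ≡.cong ⟦_⟧ (ℤ.[1+m]⊖[1+n]≡m⊖n m n) ⟩
      ⟦ m ⊖ n ⟧                                  ≈⟨ ⊖-homo m n ⟩
      m · 1# - n · 1#                            ≈⟨ +-identityˡ _ ⟨
      0# + (m · 1# - n · 1#)                     ≈⟨ +-congʳ (-‿inverseʳ 1#) ⟨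
      (1# - 1#) + (m · 1# - n · 1#)
        ≈⟨ solveℕ 4 (λ a b c d → (a ⊞ b) ⊞ (c ⊞ d) ≐ (a ⊞ c) ⊞ (b ⊞ d)) refl 1# (- 1#) _ _ ⟩
      (1# + m · 1#) + (- 1# - n · 1#)            ≈⟨ +-congˡ (-‿+-comm _ _) ⟩
      suc m · 1# - suc n · 1#                    ∎

    neg-homo : ∀ i → ⟦ ℤ.- i ⟧ ≈ - ⟦ i ⟧
    neg-homo (+ zero)  = sym -0#≈0#
    neg-homo (+ suc n) = refl
    neg-homo -[1+ n ]  = sym (-‿involutive _)

    +-homo : ∀ i j → ⟦ i ℤ.+ j ⟧ ≈ ⟦ i ⟧ + ⟦ j ⟧
    +-homo (+ m)    (+ n)    = ×-homo-+ 1# m n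
    +-homo (+ m)    -[1+ n ] = ⊖-homo m (suc n)
    +-homo -[1+ m ] (+ n)    = trans (⊖-homo n (suc m)) (+-comm _ _)
    +-homo -[1+ m ] -[1+ n ] = begin
      - (suc (suc (m ℕ.+ n)) · 1#)      ≡⟨ ≡.cong (λ k → - (suc k · 1#)) (ℕ.+-suc m n) ⟨
      - ((suc m ℕ.+ suc n) · 1#)        ≈⟨ -‿cong (×-homo-+ 1# (suc m) (suc n)) ⟩
      - (suc m · 1# + suc n · 1#)       ≈⟨ -‿+-comm _ _ ⟨
      - (suc m · 1#) - suc n · 1#       ∎

    pos-*-homo : ∀ m j → ⟦ + m ℤ.* j ⟧ ≈ m · 1# * ⟦ j ⟧
    pos-*-homo m (+ n)    = trans (reflexive (≡.cong ⟦_⟧ (≡.sym (ℤ.pos-* m n)))) (×1-homo-* m n)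
    pos-*-homo m -[1+ n ] = begin
      ⟦ + m ℤ.* -[1+ n ] ⟧             ≡⟨ ≡.cong ⟦_⟧ (ℤ.neg-distribʳ-* (+ m) (+ suc n)) ⟨
      ⟦ ℤ.- (+ m ℤ.* + suc n) ⟧        ≈⟨ neg-homo (+ m ℤ.* + suc n) ⟩
      - ⟦ + m ℤ.* + suc n ⟧            ≈⟨ -‿cong (pos-*-homo m (+ suc n)) ⟩
      - (m · 1# * (suc n · 1#))        ≈⟨ -‿distribʳ-* _ _ ⟩
      m · 1# * - (suc n · 1#)          ∎

    *-homo : ∀ i j → ⟦ i ℤ.* j ⟧ ≈ ⟦ i ⟧ * ⟦ j ⟧
    *-homo (+ m)    j = pos-*-homo m j
    *-homo -[1+ m ] j = begin
      ⟦ -[1+ m ] ℤ.* j ⟧               ≡⟨ ≡.cong ⟦_⟧ (ℤ.neg-distribˡ-* (+ suc m) j) ⟨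
      ⟦ ℤ.- (+ suc m ℤ.* j) ⟧          ≈⟨ neg-homo (+ suc m ℤ.* j) ⟩
      - ⟦ + suc m ℤ.* j ⟧              ≈⟨ -‿cong (pos-*-homo (suc m) j) ⟩
      - (suc m · 1# * ⟦ j ⟧)           ≈⟨ -‿distribˡ-* _ _ ⟩
      - (suc m · 1#) * ⟦ j ⟧           ∎

    morphism : ℤ.+-*-rawRing ACR.-Raw-AlmostCommutative⟶ ACR.fromCommutativeRing R
    morphism = record
      { ⟦_⟧    = ⟦_⟧
      ; +-homo = +-homo
      ; *-homo = *-homo
      ; -‿homo = neg-homo
      ; 0-homo = refl
      ; 1-homo = +-identityʳ 1#
      }

    weaklyDecidable : ∀ i j → Maybe (⟦ i ⟧ ≈ ⟦ j ⟧)
    weaklyDecidable i j with i ℤ.≟ j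
    ... | yes ≡.refl = just refl
    ... | no  _      = nothing

  open Algebra.Solver.Ring ℤ.+-*-rawRing (ACR.fromCommutativeRing R) morphism weaklyDecidable public
    using (solve; _:+_; _:*_; _:-_; :-_; _:=_; con)

module TrivialPowers (S : Semiring c ℓ) where
  open Semiring S hiding (zero)
  open SemiringExp S using (_^_)
  open SemiringMult S renaming (_×_ to _·_)

  1^ : ∀ n → 1# ^ n ≈ 1#
  1^ zero    = refl
  1^ (suc n) = trans (*-identityˡ _) (1^ n)

  0^ : ∀ n → .{{ℕ.NonZero n}} → 0# ^ n ≈ 0#
  0^ (suc n) = zeroˡ _

  ·-zeroʳ : ∀ n → n · 0# ≈ 0#
  ·-zeroʳ zero    = refl
  ·-zeroʳ (suc n) = trans (+-identityˡ _) (·-zeroʳ n)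

-- The unit is a parameter because the one of ℚ⟦t⟧ is an anonymous function, equal
-- to any other unit only pointwise.
module PowerSeriesRing (R : CommutativeRing c ℓ)
  (1ˢ : ℕ → CommutativeRing.Carrier R)
  (1ˢ-zero : CommutativeRing._≈_ R (1ˢ 0) (CommutativeRing.1# R))
  (1ˢ-suc : ∀ n → CommutativeRing._≈_ R (1ˢ (suc n)) (CommutativeRing.0# R)) where

  open CommutativeRing R
  open SemiringSum semiring using (sum⁺-syntax)
    renaming (sum-cong-≋ to sum-cong)
  open SetoidReasoning setoid
  open NaturalCoefficients commutativeSemiring using (solve; _:+_; _:*_; _:=_; con)

  Series : Set c
  Series = ℕ → Carrier

  infix  4 _≈ˢ_
  infixl 6 _⊕_
  infixl 7 _⊛_ _•_
  infix  8 ⊖_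

  _≈ˢ_ : Series → Series → Set ℓ
  f ≈ˢ g = ∀ n → f n ≈ g n

  -- The formulas are those of `ℚ⟦t⟧`, so over ℚ the two sets of operations agree by computation.
  _⊕_ _⊛_ : Series → Series → Series
  (f ⊕ g) n = f n + g n
  (f ⊛ g) n = ∑[ i ≤ n ] (f (toℕ i) * g (n ∸ toℕ i))

  ⊖_ : Series → Series
  (⊖ f) n = - f n

  0ˢ : Series
  0ˢ _ = 0#

  _•_ : Carrier → Series → Series
  (k • f) n = k * f n

  tail : Series → Series
  tail f = f ∘ suc

  ⊛-cong : ∀ {f f′ g g′} → f ≈ˢ f′ → g ≈ˢ g′ → f ⊛ g ≈ˢ f′ ⊛ g′
  ⊛-cong f≈ g≈ n = sum-cong {suc n} λ i → *-cong (f≈ (toℕ i)) (g≈ (n ∸ toℕ i))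

  ⊛-congʳ : ∀ {f f′} g → f ≈ˢ f′ → f ⊛ g ≈ˢ f′ ⊛ g
  ⊛-congʳ g f≈ = ⊛-cong f≈ λ _ → refl {_}

  ⊛-distribʳ : ∀ h f g → (f ⊕ g) ⊛ h ≈ˢ f ⊛ h ⊕ g ⊛ h
  ⊛-distribʳ h f g zero    =
    solve 3 (λ f g h → (f :+ g) :* h :+ o := (f :* h :+ o) :+ (g :* h :+ o)) refl (f 0) (g 0) (h 0)
    where o = con 0
  ⊛-distribʳ h f g (suc n) = begin
    (f 0 + g 0) * h (suc n) + ((tail f ⊕ tail g) ⊛ h) n
      ≈⟨ +-congˡ (⊛-distribʳ h (tail f) (tail g) n) ⟩
    (f 0 + g 0) * h (suc n) + ((tail f ⊛ h) n + (tail g ⊛ h) n)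
      ≈⟨ solve 5 (λ f g h x y → (f :+ g) :* h :+ (x :+ y) := (f :* h :+ x) :+ (g :* h :+ y))
           refl (f 0) (g 0) (h (suc n)) _ _ ⟩
    (f 0 * h (suc n) + (tail f ⊛ h) n) + (g 0 * h (suc n) + (tail g ⊛ h) n) ∎

  •-⊛ : ∀ k f g → (k • f) ⊛ g ≈ˢ k • (f ⊛ g)
  •-⊛ k f g zero    = solve 3 (λ k f g → k :* f :* g :+ con 0 := k :* (f :* g :+ con 0)) refl k (f 0) (g 0)
  •-⊛ k f g (suc n) = begin
    k * f 0 * g (suc n) + ((k • tail f) ⊛ g) n  ≈⟨ +-congˡ (•-⊛ k (tail f) g n) ⟩
    k * f 0 * g (suc n) + k * (tail f ⊛ g) n
      ≈⟨ solve 4 (λ k f g x → k :* f :* g :+ k :* x := k :* (f :* g :+ x)) refl k (f 0) (g (suc n)) _ ⟩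
    k * (f ⊛ g) (suc n)                         ∎

  ⊛-zeroˡ : ∀ f → 0ˢ ⊛ f ≈ˢ 0ˢ
  ⊛-zeroˡ f zero    = trans (+-identityʳ _) (zeroˡ _)
  ⊛-zeroˡ f (suc n) = trans (+-cong (zeroˡ _) (⊛-zeroˡ f n)) (+-identityʳ _)

  -- Unfolding the sum splits off its first term and so peels `f`. Splitting off the last term peels
  -- `g` instead, which commutativity and the removal of factors t from `g` require.
  ⊛-sucʳ : ∀ f g n → (f ⊛ g) (suc n) ≈ (f ⊛ tail g) n + f (suc n) * g 0
  ⊛-sucʳ f g zero = solve 4 (λ f g f′ g′ → f :* g′ :+ (f′ :* g :+ con 0) := (f :* g′ :+ con 0) :+ f′ :* g)
    refl (f 0) (g 0) (f 1) (g 1)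
  ⊛-sucʳ f g (suc n) = begin
    f 0 * g (suc (suc n)) + (tail f ⊛ g) (suc n)
      ≈⟨ +-congˡ (⊛-sucʳ (tail f) g n) ⟩
    f 0 * g (suc (suc n)) + ((tail f ⊛ tail g) n + f (suc (suc n)) * g 0)
      ≈⟨ +-assoc _ _ _ ⟨
    (f ⊛ tail g) (suc n) + f (suc (suc n)) * g 0 ∎

  ⊛-comm : ∀ f g → f ⊛ g ≈ˢ g ⊛ f
  ⊛-comm f g zero    = +-congʳ (*-comm _ _)
  ⊛-comm f g (suc n) = begin
    f 0 * g (suc n) + (tail f ⊛ g) n   ≈⟨ +-cong (*-comm _ _) (⊛-comm (tail f) g n) ⟩
    g (suc n) * f 0 + (g ⊛ tail f) n   ≈⟨ +-comm _ _ ⟩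
    (g ⊛ tail f) n + g (suc n) * f 0   ≈⟨ ⊛-sucʳ g f n ⟨
    (g ⊛ f) (suc n)                    ∎

  ⊛-assoc : ∀ f g h → (f ⊛ g) ⊛ h ≈ˢ f ⊛ (g ⊛ h)
  ⊛-assoc f g h zero = solve 3 (λ f g h → (f :* g :+ con 0) :* h :+ con 0 := f :* (g :* h :+ con 0) :+ con 0)
    refl (f 0) (g 0) (h 0)
  ⊛-assoc f g h (suc n) = begin
    (f ⊛ g) 0 * h (suc n) + (tail (f ⊛ g) ⊛ h) n
      -- By computation `tail (f ⊛ g)` is `(f 0 • tail g) ⊕ (tail f ⊛ g)`.
      ≈⟨ +-cong (*-congʳ (+-identityʳ _)) (⊛-distribʳ h (f 0 • tail g) (tail f ⊛ g) n) ⟩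
    f 0 * g 0 * h (suc n) + (((f 0 • tail g) ⊛ h) n + ((tail f ⊛ g) ⊛ h) n)
      ≈⟨ +-congˡ (+-cong (•-⊛ (f 0) (tail g) h n) (⊛-assoc (tail f) g h n)) ⟩
    f 0 * g 0 * h (suc n) + (f 0 * (tail g ⊛ h) n + (tail f ⊛ (g ⊛ h)) n)
      ≈⟨ solve 5 (λ f g h x y → f :* g :* h :+ (f :* x :+ y) := f :* (g :* h :+ x) :+ y)
           refl (f 0) (g 0) (h (suc n)) _ _ ⟩
    f 0 * (g ⊛ h) (suc n) + (tail f ⊛ (g ⊛ h)) n ∎

  ⊛-identityˡ : ∀ f → 1ˢ ⊛ f ≈ˢ f
  ⊛-identityˡ f zero    = trans (+-identityʳ _) (trans (*-congʳ 1ˢ-zero) (*-identityˡ _))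
  ⊛-identityˡ f (suc n) = begin
    1ˢ 0 * f (suc n) + (tail 1ˢ ⊛ f) n ≈⟨ +-cong (*-congʳ 1ˢ-zero) (⊛-congʳ f 1ˢ-suc n) ⟩
    1# * f (suc n) + (0ˢ ⊛ f) n        ≈⟨ +-cong (*-identityˡ _) (⊛-zeroˡ f n) ⟩
    f (suc n) + 0#                     ≈⟨ +-identityʳ _ ⟩
    f (suc n)                          ∎

  seriesRing : CommutativeRing c ℓ
  seriesRing = record
    { Carrier = Series
    ; _≈_ = _≈ˢ_
    ; _+_ = _⊕_
    ; _*_ = _⊛_
    ; -_  = ⊖_
    ; 0#  = 0ˢ
    ; 1#  = 1ˢ
    ; isCommutativeRing = record
      { isRing = record
        { +-isAbelianGroup = record
          { isGroup = record
            { isMonoid = record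
              { isSemigroup = record
                { isMagma = record
                  { isEquivalence = record
                    { refl  = λ _ → refl
                    ; sym   = λ f≈g n → sym (f≈g n)
                    ; trans = λ f≈g g≈h n → trans (f≈g n) (g≈h n)
                    }
                  ; ∙-cong = λ f≈ g≈ n → +-cong (f≈ n) (g≈ n)
                  }
                ; assoc = λ f g h n → +-assoc _ _ _
                }
              ; identity = (λ f n → +-identityˡ _) , (λ f n → +-identityʳ _)
              }
            ; inverse = (λ f n → -‿inverseˡ _) , (λ f n → -‿inverseʳ _)
            ; ⁻¹-cong = λ f≈g n → -‿cong (f≈g n)
            }
          ; comm = λ f g n → +-comm _ _
          }
        ; *-cong     = ⊛-cong
        ; *-assoc    = ⊛-assoc
        ; *-identity = ⊛-identityˡ ,
            λ f n → trans (⊛-comm f 1ˢ n) (⊛-identityˡ f n)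
        ; distrib    = ⊛-distribˡ , ⊛-distribʳ
        }
      ; *-comm = ⊛-comm
      }
    }
    where
    ⊛-distribˡ : ∀ h f g → h ⊛ (f ⊕ g) ≈ˢ h ⊛ f ⊕ h ⊛ g
    ⊛-distribˡ h f g n = trans (⊛-comm h (f ⊕ g) n)
      (trans (⊛-distribʳ h f g n) (+-cong (⊛-comm f h n) (⊛-comm g h n)))

  open SemiringMult semiring using () renaming (_×_ to _·_)
  open SemiringMult (CommutativeRing.semiring seriesRing) using () renaming (_×_ to _·ˢ_)

  ·ˢ-coefficient : ∀ m f n → (m ·ˢ f) n ≈ m · f n
  ·ˢ-coefficient zero    f n = refl
  ·ˢ-coefficient (suc m) f n = +-congˡ (·ˢ-coefficient m f n)

-- Polynomial expressions over a subring and the comparison of relations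

record IsSubring (S : CommutativeRing c ℓ) (P : Pred (CommutativeRing.Carrier S) s) : Set (c ⊔ ℓ ⊔ s) where
  open CommutativeRing S
  field
    respects   : ∀ {x y} → x ≈ y → x ∈ P → y ∈ P
    0#-closed  : 0# ∈ P
    1#-closed  : 1# ∈ P
    +-closed   : ∀ {x y} → x ∈ P → y ∈ P → x + y ∈ P
    *-closed   : ∀ {x y} → x ∈ P → y ∈ P → x * y ∈ P
    neg-closed : ∀ {x} → x ∈ P → - x ∈ P

module Spans (S : CommutativeRing c ℓ) (P : Pred (CommutativeRing.Carrier S) s)
             (P-subring : IsSubring S P) where
  open CommutativeRing S
  open IsSubring P-subring
  open TrivialPowers semiring using (1^)
  open SemiringExp semiring using (_^_; ^-congˡ)
  open CommutativeExp commutativeSemiring using (^-distrib-*)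
  open SemiringMult semiring renaming (_×_ to _·_)
  open RingProperties ring
  open SetoidReasoning setoid
  open IntegerCoefficients S

  ^-closed : ∀ {x} n → x ∈ P → x ^ n ∈ P
  ^-closed zero    x∈P = 1#-closed
  ^-closed (suc n) x∈P = *-closed x∈P (^-closed n x∈P)

  ·-closed : ∀ {x} n → x ∈ P → n · x ∈ P
  ·-closed zero    x∈P = 0#-closed
  ·-closed (suc n) x∈P = +-closed x∈P (·-closed n x∈P)

  -- Polynomial expressions in X of degree below k with coefficients in P. Only their values count,
  -- because X may satisfy equations; the equality in each constructor keeps membership invariant
  -- under ≈.
  data Span (X : Carrier) : ℕ → Pred Carrier (c ⊔ ℓ ⊔ s) where
    nil  : ∀ {g} → g ≈ 0# → g ∈ Span X 0
    snoc : ∀ {k g r g′} → r ∈ P → g′ ∈ Span X k → g ≈ g′ + r * X ^ k → g ∈ Span X (suc k)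

  span-resp : ∀ {X} k {g h} → g ≈ h → g ∈ Span X k → h ∈ Span X k
  span-resp zero    g≈h (nil g≈0)              = nil (trans (sym g≈h) g≈0)
  span-resp (suc k) g≈h (snoc {r = r} {g′} r∈P g′∈ eq) = snoc r∈P g′∈ (trans (sym g≈h) eq)

  span-base : ∀ {X Y} k {g} → X ≈ Y → g ∈ Span X k → g ∈ Span Y k
  span-base zero    X≈Y (nil g≈0) = nil g≈0
  span-base (suc k) X≈Y (snoc {r = r} {g′} r∈P g′∈ eq) =
    snoc r∈P (span-base k X≈Y g′∈) (trans eq (+-congˡ (*-congˡ (^-congˡ k X≈Y))))

  span-0 : ∀ {X} k → 0# ∈ Span X k
  span-0 zero    = nil refl
  span-0 (suc k) = snoc 0#-closed (span-0 k) (sym (trans (+-identityˡ _) (zeroˡ _)))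

  span-suc : ∀ {X} k {g} → g ∈ Span X k → g ∈ Span X (suc k)
  span-suc k g∈ = snoc 0#-closed g∈ (sym (trans (+-congˡ (zeroˡ _)) (+-identityʳ _)))

  span-+ : ∀ {X} k {g h} → g ∈ Span X k → h ∈ Span X k → g + h ∈ Span X k
  span-+ zero    (nil g≈0) (nil h≈0) = nil (trans (+-cong g≈0 h≈0) (+-identityˡ 0#))
  span-+ (suc k) (snoc {r = r} {g′} r∈P g′∈ g≈) (snoc {r = t} {h′} t∈P h′∈ h≈) =
    snoc (+-closed r∈P t∈P) (span-+ k g′∈ h′∈) (trans (+-cong g≈ h≈)
      (solve 5 (λ g r h t x → (g :+ r :* x) :+ (h :+ t :* x) := (g :+ h) :+ (r :+ t) :* x)
         refl g′ r h′ t _))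

  span-* : ∀ {X} k {x g} → x ∈ P → g ∈ Span X k → x * g ∈ Span X k
  span-* zero    x∈P (nil g≈0) = nil (trans (*-congˡ g≈0) (zeroʳ _))
  span-* (suc k) {x} x∈P (snoc {r = r} {g′} r∈P g′∈ g≈) =
    snoc (*-closed x∈P r∈P) (span-* k x∈P g′∈) (trans (*-congˡ g≈)
      (solve 4 (λ x g r y → x :* (g :+ r :* y) := x :* g :+ (x :* r) :* y) refl x g′ r _))

  span-neg : ∀ {X} k {g} → g ∈ Span X k → - g ∈ Span X k
  span-neg k g∈ = span-resp k (-1*x≈-x _) (span-* k (neg-closed 1#-closed) g∈)

  span-- : ∀ {X} k {g h} → g ∈ Span X k → h ∈ Span X k → g - h ∈ Span X k
  span-- k g∈ h∈ = span-+ k g∈ (span-neg k h∈)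

  span-term : ∀ {X} k {x} → x ∈ P → x * X ^ k ∈ Span X (suc k)
  span-term k x∈P = snoc x∈P (span-0 k) (sym (+-identityˡ _))

  span-const : ∀ {X} k {x} → x ∈ P → x ∈ Span X (suc k)
  span-const zero    x∈P = span-resp 1 (*-identityʳ _) (span-term 0 x∈P)
  span-const (suc k) x∈P = span-suc (suc k) (span-const k x∈P)

  span-shift : ∀ {X} k {g} → g ∈ Span X k → X * g ∈ Span X (suc k)
  span-shift zero    (nil g≈0) = span-resp 1 (sym (trans (*-congˡ g≈0) (zeroʳ _))) (span-0 1)
  span-shift {X} (suc k) (snoc {r = r} {g′} r∈P g′∈ g≈) =
    snoc r∈P (span-shift k g′∈) (trans (*-congˡ g≈)
      (solve 4 (λ x g r y → x :* (g :+ r :* y) := x :* g :+ r :* (x :* y)) refl X g′ r _))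

  module AffineChange {X Y w u : Carrier} (w∈P : w ∈ P) (u∈P : u ∈ P) (Y≈ : Y ≈ w * X + u) where

    -- The coefficient w^k of the top power stays visible because minimality is later applied to a
    -- multiple of it; everything lower is absorbed into `e`.
    affine-^ : ∀ k → ∃[ e ] e ∈ Span X k × Y ^ k ≈ w ^ k * X ^ k + e
    affine-^ zero = 0# , span-0 0 , sym (trans (+-identityʳ _) (*-identityˡ _))
    affine-^ (suc k) with e , e∈ , eq ← affine-^ k =
      w * (X * e) + (u * (w ^ k * X ^ k) + u * e) ,
      span-+ (suc k) (span-* (suc k) w∈P (span-shift k e∈))
        (span-+ (suc k) (span-* (suc k) u∈P (span-term k (^-closed k w∈P)))
                        (span-suc k (span-* k u∈P e∈))) ,
      trans (*-cong Y≈ eq)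
        (solve 6 (λ w x u a b e → (w :* x :+ u) :* (a :* b :+ e) :=
                    (w :* a) :* (x :* b) :+ (w :* (x :* e) :+ (u :* (a :* b) :+ u :* e)))
           refl w X u (w ^ k) (X ^ k) e)

    span-affine : ∀ k {g} → g ∈ Span Y k → g ∈ Span X k
    span-affine zero    (nil g≈0) = nil g≈0
    span-affine (suc k) (snoc {r = r} {g′} r∈P g′∈ g≈) with e , e∈ , eq ← affine-^ k =
      span-resp (suc k) (sym (trans g≈ (+-congˡ (*-congˡ eq))))
        (span-+ (suc k) (span-suc k (span-affine k g′∈))
          (span-* (suc k) r∈P (span-+ (suc k) (span-term k (^-closed k w∈P)) (span-suc k e∈))))

  -- Writing X in terms of w X would divide by w. The factor w^k pays for this in advance: w^k X^i
  -- is w^(k-i) (w X)^i.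
  span-scale : ∀ {X w} → w ∈ P → ∀ k {g} → g ∈ Span X k → w ^ k * g ∈ Span (w * X) k
  span-scale w∈P zero    (nil g≈0) = nil (trans (*-congˡ g≈0) (zeroʳ _))
  span-scale {X} {w} w∈P (suc k) (snoc {r = r} {g′} r∈P g′∈ g≈) =
    snoc (*-closed w∈P r∈P) (span-* k w∈P (span-scale w∈P k g′∈)) (begin
      w * w ^ k * _                               ≈⟨ *-congˡ g≈ ⟩
      w * w ^ k * (g′ + r * X ^ k)
        ≈⟨ solve 5 (λ w a g r x → w :* a :* (g :+ r :* x) := w :* (a :* g) :+ w :* r :* (a :* x))
             refl w (w ^ k) g′ r (X ^ k) ⟩
      w * (w ^ k * g′) + w * r * (w ^ k * X ^ k)  ≈⟨ +-congˡ (*-congˡ (^-distrib-* w X k)) ⟨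
      w * (w ^ k * g′) + w * r * (w * X) ^ k      ∎)

  -- Two terms of the expansion suffice, since relations are compared through their two leading
  -- coefficients only.
  binomial₂ : ∀ {Y u} → u ∈ P → ∀ k → ∃[ e ] e ∈ Span Y k ×
    (Y + u) ^ suc k ≈ Y ^ suc k + (suc k · u * Y ^ k + e)
  binomial₂ {Y} {u} u∈P zero = 0# , span-0 0 , (begin
    (Y + u) * 1#                     ≈⟨ distribʳ 1# Y u ⟩
    Y * 1# + u * 1#                  ≈⟨ solve 3 (λ a u e → a :+ u :* e := a :+ ((u :+ con (ℤ.+ 0)) :* e :+ con (ℤ.+ 0))) refl (Y * 1#) u 1# ⟩
    Y * 1# + ((u + 0#) * 1# + 0#)    ∎)
  binomial₂ {Y} {u} u∈P (suc k) with e , e∈ , eq ← binomial₂ u∈P k =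
    u * (suc k · u * Y ^ k) + (Y * e + u * e) ,
    span-+ (suc k) (span-* (suc k) u∈P (span-term k (·-closed (suc k) u∈P)))
      (span-+ (suc k) (span-shift k e∈) (span-suc k (span-* k u∈P e∈))) ,
    trans (*-congˡ eq)
      (solve 5 (λ y u a m e →
          (y :+ u) :* (y :* a :+ (m :* a :+ e)) :=
          y :* (y :* a) :+ ((u :+ m) :* (y :* a) :+ (u :* (m :* a) :+ (y :* e :+ u :* e))))
        refl Y u (Y ^ k) (suc k · u) e)

  -- An equation of degree d solved for its leading term. P need not allow division, so the leading
  -- coefficient is kept instead of being normalised to 1.
  Relation : Carrier → Pred ℕ (c ⊔ ℓ ⊔ s)
  Relation X d = ∃[ r ] r ∈ P × ¬ (r ≈ 0#) × r * X ^ d ∈ Span X d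

  module _ (P-zero? : ∀ {r} → r ∈ P → Dec (r ≈ 0#)) where

    -- `Algebraic` admits zero leading coefficients, so the degree is found by deciding from the top
    -- which coefficients vanish.
    leadingTerm : ∀ X {ks} → All P ks →
      (evaluate rawRing ks X ≈ 0# × ¬ NonzeroPolynomial rawRing ks) ⊎
      ∃[ d ] ∃[ r ] r ∈ P × ¬ (r ≈ 0#) ×
        ∃[ e ] e ∈ Span X d × evaluate rawRing ks X ≈ e + r * X ^ d
    leadingTerm X [] = inj₁ (refl , λ ())
    leadingTerm X (_∷_ {k} {ks} k∈P ks∈P) with leadingTerm X ks∈P
    ... | inj₂ (d , r , r∈P , r≉0 , e , e∈ , eq) = inj₂
      ( suc d , r , r∈P , r≉0 , k + X * e
      , span-+ (suc d) (span-const d k∈P) (span-shift d e∈)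
      , trans (+-congˡ (*-congˡ eq))
          (solve 5 (λ k x e r y → k :+ x :* (e :+ r :* y) := (k :+ x :* e) :+ r :* (x :* y))
             refl k X e r (X ^ d)))
    ... | inj₁ (ks≈0 , ks-zero) with P-zero? k∈P
    ...   | yes k≈0 = inj₁
      ( trans (+-cong k≈0 (*-congˡ ks≈0)) (trans (+-identityˡ _) (zeroʳ _))
      , λ { (here k≉0) → k≉0 k≈0 ; (there ks≉0) → ks-zero ks≉0 })
    ...   | no k≉0 = inj₂
      ( 0 , k , k∈P , k≉0 , 0# , span-0 0
      , trans (+-congˡ (trans (*-congˡ ks≈0) (zeroʳ _)))
          (trans (+-comm _ _) (+-congˡ (sym (*-identityʳ k)))))

    algebraic⇒relation : ∀ {X} → Algebraic rawRing P X → ∃[ d ] Relation X d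
    algebraic⇒relation {X} (ks , ks∈P , ks≉0 , eq) with leadingTerm X ks∈P
    ... | inj₁ (_ , ks-zero) = contradiction ks≉0 ks-zero
    ... | inj₂ (d , r , r∈P , r≉0 , e , e∈ , eq′) =
      d , r , r∈P , r≉0 , span-resp d -e≈ (span-neg d e∈)
      where
      -e≈ : - e ≈ r * X ^ d
      -e≈ = sym (+-inverseʳ-unique e _ (trans (sym eq′) eq))

  -- Comparing a relation for Y with its image under π gives one of lower degree,
  -- which has to vanish.
  module Descent {X : Carrier} {k : ℕ} (minimal : ¬ Relation X k)
    (P-zero? : ∀ {r} → r ∈ P → Dec (r ≈ 0#)) where

    relation-zero : ∀ {r} → r ∈ P → r * X ^ k ∈ Span X k → r ≈ 0#
    relation-zero r∈P r∈ with P-zero? r∈P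
    ... | yes r≈0 = r≈0
    ... | no  r≉0 = contradiction (_ , r∈P , r≉0 , r∈) minimal

    -- In the application X is `A`, Y is `w ⊛ D`, u is `U`, and π keeps the exponents in one residue
    -- class modulo N. It is linear over the powers of Y because these are series in t^N.
    module _ {r r′ e : Carrier} (r∈P : r ∈ P) (r′∈P : r′ ∈ P) (e∈ : e ∈ Span X k)
      (rX^≈ : r * X ^ suc k ≈ e + r′ * X ^ k)
      {w u Y : Carrier} (w∈P : w ∈ P) (u∈P : u ∈ P) (wX≈ : w * X ≈ Y + u)
      (w-cancel : ∀ {x} → w * x ≈ 0# → x ≈ 0#)
      (π : Carrier → Carrier) (π-cong : ∀ {x y} → x ≈ y → π x ≈ π y)
      (π-+ : ∀ x y → π (x + y) ≈ π x + π y) (π-0 : π 0# ≈ 0#)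
      (π-closed : ∀ {x} → x ∈ P → π x ∈ P)
      (π-linear : ∀ x k → π (x * Y ^ k) ≈ π x * Y ^ k)
      where

      -- The second coefficient of the relation for Y, whose leading coefficient is still r: r′ w
      -- comes from the relation for X multiplied by w^(k+1), and - (k+1) r u from expanding (Y +
      -- u)^(k+1).
      κ : Carrier
      κ = r′ * w - r * (suc k · u)

      κ∈P : κ ∈ P
      κ∈P = +-closed (*-closed r′∈P w∈P) (neg-closed (*-closed r∈P (·-closed (suc k) u∈P)))

      Y≈ : Y ≈ w * X + - u
      Y≈ = sym (trans (+-congʳ wX≈) (solve 2 (λ y u → y :+ u :- u := y) refl Y u))

      π-span : ∀ i {g} → g ∈ Span Y i → π g ∈ Span Y i
      π-span zero    (nil g≈0) = nil (trans (π-cong g≈0) π-0)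
      π-span (suc i) (snoc {r = t} {g′} t∈P g′∈ g≈) =
        snoc (π-closed t∈P) (π-span i g′∈)
          (trans (π-cong g≈) (trans (π-+ _ _) (+-congˡ (π-linear t i))))

      Y+u≈ : Y + u ≈ 1# * Y + u
      Y+u≈ = +-congʳ (sym (*-identityˡ Y))

      Y+u-^ : ∃[ a ] a ∈ Span Y k × (Y + u) ^ k ≈ Y ^ k + a
      Y+u-^ with a , a∈ , a≈ ← AffineChange.affine-^ 1#-closed u∈P Y+u≈ k =
        a , a∈ , trans a≈ (+-congʳ (trans (*-congʳ (1^ k)) (*-identityˡ _)))

      relation-Y+u : r * (Y + u) ^ suc k ≈ w * (w ^ k * e) + (r′ * w) * (Y + u) ^ k
      relation-Y+u = begin
        r * (Y + u) ^ suc k                ≈⟨ *-congˡ (^-congˡ (suc k) wX≈) ⟨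
        r * (w * X) ^ suc k                ≈⟨ *-congˡ (^-distrib-* w X (suc k)) ⟩
        r * (w ^ suc k * X ^ suc k)
          ≈⟨ solve 3 (λ r a b → r :* (a :* b) := a :* (r :* b)) refl r (w ^ suc k) (X ^ suc k) ⟩
        w ^ suc k * (r * X ^ suc k)        ≈⟨ *-congˡ rX^≈ ⟩
        w ^ suc k * (e + r′ * X ^ k)
          ≈⟨ solve 5 (λ w a e r x → (w :* a) :* (e :+ r :* x) := w :* (a :* e) :+ (r :* w) :* (a :* x))
               refl w (w ^ k) e r′ (X ^ k) ⟩
        w * (w ^ k * e) + (r′ * w) * (w ^ k * X ^ k)
          ≈⟨ +-congˡ (*-congˡ (trans (sym (^-distrib-* w X k)) (^-congˡ k wX≈))) ⟩
        w * (w ^ k * e) + (r′ * w) * (Y + u) ^ k ∎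

      lower∈ : w * (w ^ k * e) ∈ Span Y k
      lower∈ = AffineChange.span-affine 1#-closed u∈P Y+u≈ k
        (span-* k w∈P (span-base k wX≈ (span-scale w∈P k e∈)))

      relation-Y : ∃[ f ] f ∈ Span Y k × r * Y ^ suc k ≈ κ * Y ^ k + f
      relation-Y with a , a∈ , a≈ ← Y+u-^ | b , b∈ , b≈ ← binomial₂ {Y} {u} u∈P k =
        _ , span-+ k lower∈ (span-- k (span-* k (*-closed r′∈P w∈P) a∈) (span-* k r∈P b∈)) , (begin
          r * Y ^ suc k
            ≈⟨ solve 4 (λ r y m b → r :* y := r :* (y :+ (m :+ b)) :- r :* m :- r :* b)
                 refl r (Y ^ suc k) (suc k · u * Y ^ k) b ⟩
          r * (Y ^ suc k + (suc k · u * Y ^ k + b)) - r * (suc k · u * Y ^ k) - r * b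
            ≈⟨ +-congʳ (+-congʳ (*-congˡ b≈)) ⟨
          r * (Y + u) ^ suc k - r * (suc k · u * Y ^ k) - r * b
            ≈⟨ +-congʳ (+-congʳ (trans relation-Y+u (+-congˡ (*-congˡ a≈)))) ⟩
          w * (w ^ k * e) + (r′ * w) * (Y ^ k + a) - r * (suc k · u * Y ^ k) - r * b
            ≈⟨ solve 7 (λ e r′w y a r m b → e :+ r′w :* (y :+ a) :- r :* (m :* y) :- r :* b :=
                   (r′w :- r :* m) :* y :+ (e :+ (r′w :* a :- r :* b)))
                 refl (w * (w ^ k * e)) (r′ * w) (Y ^ k) a r (suc k · u) b ⟩
          κ * Y ^ k + (w * (w ^ k * e) + ((r′ * w) * a - r * b)) ∎)

      w-cancel-^ : ∀ i {x} → w ^ i * x ≈ 0# → x ≈ 0#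
      w-cancel-^ zero    eq = trans (sym (*-identityˡ _)) eq
      w-cancel-^ (suc i) eq = w-cancel-^ i (w-cancel (trans (sym (*-assoc _ _ _)) eq))

      δ : Carrier
      δ = π r * κ - r * π κ

      δ∈P : δ ∈ P
      δ∈P = +-closed (*-closed (π-closed r∈P) κ∈P) (neg-closed (*-closed r∈P (π-closed κ∈P)))

      -- Under π the relation for Y becomes one with leading coefficients π r and π κ.
      -- Cross-multiplying cancels Y^(k+1) and leaves δ as the coefficient of Y^k.
      δY^k∈ : δ * Y ^ k ∈ Span Y k
      δY^k∈ = cross relation-Y
        where
        cross : ∃[ f ] f ∈ Span Y k × r * Y ^ suc k ≈ κ * Y ^ k + f → δ * Y ^ k ∈ Span Y k
        cross (f , f∈ , eq) = span-resp k (begin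
          r * π f - π r * f
            ≈⟨ solve 7 (λ r p f g y a b → r :* g :- p :* f :=
                  (p :* a :- r :* b) :* y :+ (r :* (b :* y :+ g) :- p :* (a :* y :+ f)))
                 refl r (π r) f (π f) (Y ^ k) κ (π κ) ⟩
          δ * Y ^ k + (r * (π κ * Y ^ k + π f) - π r * (κ * Y ^ k + f))
            ≈⟨ +-congˡ (+-cong (*-congˡ eqπ) (-‿cong (*-congˡ eq))) ⟨
          δ * Y ^ k + (r * (π r * Y ^ suc k) - π r * (r * Y ^ suc k))
            ≈⟨ solve 4 (λ d r p y → d :+ (r :* (p :* y) :- p :* (r :* y)) := d)
                 refl (δ * Y ^ k) r (π r) (Y ^ suc k) ⟩
          δ * Y ^ k ∎)
          (span-- k (span-* k r∈P (π-span k f∈)) (span-* k (π-closed r∈P) f∈))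
          where
          eqπ : π r * Y ^ suc k ≈ π κ * Y ^ k + π f
          eqπ = begin
            π r * Y ^ suc k        ≈⟨ π-linear r (suc k) ⟨
            π (r * Y ^ suc k)      ≈⟨ π-cong eq ⟩
            π (κ * Y ^ k + f)      ≈⟨ π-+ _ _ ⟩
            π (κ * Y ^ k) + π f    ≈⟨ +-congʳ (π-linear κ k) ⟩
            π κ * Y ^ k + π f      ∎

      -- Passing back to X multiplies the coefficient of degree k by w^k and otherwise alters only
      -- lower terms. Minimality then applies to w^k δ.
      w^kδX^k∈ : w ^ k * δ * X ^ k ∈ Span X k
      w^kδX^k∈ with a , a∈ , a≈ ← AffineChange.affine-^ w∈P (neg-closed u∈P) Y≈ k =
        span-resp k (begin
          δ * Y ^ k - δ * a  ≈⟨ +-congʳ (*-congˡ a≈) ⟩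
          δ * (w ^ k * X ^ k + a) - δ * a
            ≈⟨ solve 4 (λ d a x e → d :* (a :* x :+ e) :- d :* e := a :* d :* x) refl δ (w ^ k) (X ^ k) a ⟩
          w ^ k * δ * X ^ k ∎)
        (span-- k (AffineChange.span-affine w∈P (neg-closed u∈P) Y≈ k δY^k∈) (span-* k δ∈P a∈))

      descent : π r * κ ≈ r * π κ
      descent = x∙y⁻¹≈ε⇒x≈y (π r * κ) (r * π κ)
        (w-cancel-^ k (relation-zero (*-closed (^-closed k w∈P) δ∈P) w^kδX^k∈))

-- Linear dependence, finite extensions and logarithmic derivatives

module Dependence (S : CommutativeRing c ℓ) (P : Pred (CommutativeRing.Carrier S) s)
  (P-subring : IsSubring S P)
  (P-zero? : ∀ {r} → r ∈ P → Dec (CommutativeRing._≈_ S r (CommutativeRing.0# S)))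
  (domain : ∀ {x y} → CommutativeRing._≈_ S (CommutativeRing._*_ S x y) (CommutativeRing.0# S) →
            ¬ CommutativeRing._≈_ S x (CommutativeRing.0# S) → CommutativeRing._≈_ S y (CommutativeRing.0# S))
  (1≉0 : ¬ CommutativeRing._≈_ S (CommutativeRing.1# S) (CommutativeRing.0# S)) where
  open CommutativeRing S hiding (zero)
  open IsSubring P-subring
  open Spans S P P-subring
  open SemiringExp semiring using (_^_; ^-congˡ; ^-homo-*)
  open CommutativeExp commutativeSemiring using (^-distrib-*)
  open SemiringMult semiring using (×-comm-*) renaming (_×_ to _·_)
  open SemiringSum semiring using (sum; sum-cong-≋; *-distribˡ-sum; *-distribʳ-sum; ∑-distrib-+; sum-remove)
  open RingProperties ring
  open SetoidReasoning setoid
  open IntegerCoefficients S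

  *-nonzero : ∀ {x y} → ¬ x ≈ 0# → ¬ y ≈ 0# → ¬ x * y ≈ 0#
  *-nonzero x≉0 y≉0 xy≈0 = y≉0 (domain xy≈0 x≉0)

  ^-nonzero : ∀ {x} k → ¬ x ≈ 0# → ¬ x ^ k ≈ 0#
  ^-nonzero zero    x≉0 = 1≉0
  ^-nonzero (suc k) x≉0 = *-nonzero x≉0 (^-nonzero k x≉0)

  Dependent : ∀ {n} → (Fin n → Carrier) → Set (c ⊔ ℓ ⊔ s)
  Dependent {n} G = Σ[ c ∈ (Fin n → Carrier) ] (∀ i → c i ∈ P) × (∃[ i ] ¬ c i ≈ 0#) × sum {n} (λ i → c i * G i) ≈ 0#

  -- A division-free elimination step. The dependence c′ unfolds to the coefficients `c′ j * x i`
  -- away from i, one of which is nonzero in a domain; the coefficient at i collects what was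
  -- subtracted.
  pivot : ∀ {n} (G x : Fin (suc n) → Carrier) → (∀ i → x i ∈ P) → ∀ i → ¬ x i ≈ 0# →
          Dependent (λ j → x i * G (punchIn i j) - x (punchIn i j) * G i) → Dependent G
  pivot {n} G x x∈P i xi≉0 (c′ , c′∈P , (j , c′j≉0) , eq) =
    γ , γ∈P , (punchIn i j , λ γj≈0 → *-nonzero c′j≉0 xi≉0 (trans (reflexive (≡.sym (γ-punchIn j))) γj≈0)) , (begin
      sum (λ k → γ k * G k)
        ≈⟨ sum-remove {n} {i} (λ k → γ k * G k) ⟩
      γ i * G i + sum (λ j → γ (punchIn i j) * G (punchIn i j))
        ≈⟨ +-cong (*-congʳ (reflexive (Vector.insertAt-lookup rest i γi)))
             (sum-cong-≋ (λ j → *-congʳ (reflexive (γ-punchIn j)))) ⟩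
      sum (λ j → c′ j * - x (punchIn i j)) * G i + sum (λ j → c′ j * x i * G (punchIn i j))
        ≈⟨ +-congʳ (*-distribʳ-sum {n} (G i) (λ j → c′ j * - x (punchIn i j))) ⟩
      sum (λ j → c′ j * - x (punchIn i j) * G i) + sum (λ j → c′ j * x i * G (punchIn i j))
        ≈⟨ ∑-distrib-+ {n} (λ j → c′ j * - x (punchIn i j) * G i) (λ j → c′ j * x i * G (punchIn i j)) ⟨
      sum (λ j → c′ j * - x (punchIn i j) * G i + c′ j * x i * G (punchIn i j))
        ≈⟨ sum-cong-≋ {n} (λ j → solve 5 (λ c y g x h → c :* (:- y) :* g :+ c :* x :* h := c :* (x :* h :- y :* g))
             refl (c′ j) (x (punchIn i j)) (G i) (x i) (G (punchIn i j))) ⟩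
      sum (λ j → c′ j * (x i * G (punchIn i j) - x (punchIn i j) * G i))
        ≈⟨ eq ⟩
      0# ∎)
    where
    rest : Fin n → Carrier
    rest j = c′ j * x i

    γi : Carrier
    γi = sum (λ j → c′ j * - x (punchIn i j))

    γ : Fin (suc n) → Carrier
    γ = insertAt rest i γi

    γ-punchIn : ∀ j → γ (punchIn i j) ≡ c′ j * x i
    γ-punchIn = Vector.insertAt-punchIn rest i γi

    sum-closed : ∀ {m} (f : Fin m → Carrier) → (∀ j → f j ∈ P) → sum f ∈ P
    sum-closed {zero}  f f∈P = 0#-closed
    sum-closed {suc m} f f∈P = +-closed (f∈P zero) (sum-closed (f ∘ suc) (f∈P ∘ suc))

    γ∈P : ∀ k → γ k ∈ P
    γ∈P k with i Fin.≟ k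
    ... | yes ≡.refl = ≡.subst P (≡.sym (Vector.insertAt-lookup rest i γi))
                         (sum-closed _ λ j → *-closed (c′∈P j) (neg-closed (x∈P _)))
    ... | no  i≢k    = ≡.subst (λ k → γ k ∈ P) (Fin.punchIn-punchOut i≢k)
                         (≡.subst P (≡.sym (γ-punchIn _)) (*-closed (c′∈P _) (x∈P i)))

  -- Gaussian elimination without division. A member with nonzero top coefficient serves as pivot
  -- and brings the others into a span of one power less; if there is none, all lie there already
  -- and one of them can be set aside.
  dependent : ∀ {X} d (G : Fin (suc d) → Carrier) → (∀ i → G i ∈ Span X d) → Dependent G
  dependent zero G G∈ = (λ _ → 1#) , (λ _ → 1#-closed) , (zero , 1≉0) ,
    trans (+-identityʳ _) (trans (*-identityˡ _) (vanish (G∈ zero)))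
    where
    vanish : ∀ {X g} → g ∈ Span X 0 → g ≈ 0#
    vanish (nil g≈0) = g≈0
  dependent {X} (suc d) G G∈ = eliminate (Fin.any? (λ i → ¬? (P-zero? (x∈P i))))
    where
    top : ∀ {g} → g ∈ Span X (suc d) → ∃[ r ] r ∈ P × ∃[ g′ ] g′ ∈ Span X d × g ≈ g′ + r * X ^ d
    top (snoc r∈P g′∈ eq) = _ , r∈P , _ , g′∈ , eq

    x : Fin (suc (suc d)) → Carrier
    x i = proj₁ (top (G∈ i))

    x∈P : ∀ i → x i ∈ P
    x∈P i = proj₁ (proj₂ (top (G∈ i)))

    H : Fin (suc (suc d)) → Carrier
    H i = proj₁ (proj₂ (proj₂ (top (G∈ i))))

    H∈ : ∀ i → H i ∈ Span X d
    H∈ i = proj₁ (proj₂ (proj₂ (proj₂ (top (G∈ i)))))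

    G≈ : ∀ i → G i ≈ H i + x i * X ^ d
    G≈ i = proj₂ (proj₂ (proj₂ (proj₂ (top (G∈ i)))))

    eliminate : Dec (∃[ i ] ¬ x i ≈ 0#) → Dependent G
    eliminate (yes (i , xi≉0)) = pivot G x x∈P i xi≉0 (dependent {X} d _ λ j →
      span-resp d (sym (trans
        (+-cong (*-congˡ (G≈ (punchIn i j))) (-‿cong (*-congˡ (G≈ i))))
        (solve 5 (λ x h y g a → x :* (h :+ y :* a) :- y :* (g :+ x :* a) := x :* h :- y :* g)
           refl (x i) (H (punchIn i j)) (x (punchIn i j)) (H i) (X ^ d))))
        (span-- d (span-* d (x∈P i) (H∈ (punchIn i j))) (span-* d (x∈P (punchIn i j)) (H∈ i))))
    eliminate (no none) = extend (dependent {X} d (G ∘ suc) λ j → span-resp d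
      (sym (trans (G≈ (suc j)) (trans (+-congˡ (trans
        (*-congʳ (decidable-stable (P-zero? (x∈P (suc j))) (λ xj≉0 → none (suc j , xj≉0))))
        (zeroˡ _))) (+-identityʳ _)))) (H∈ (suc j)))
      where
      extend : Dependent (G ∘ suc) → Dependent G
      extend (c , c∈P , (i , ci≉0) , eq) =
        (λ { zero → 0# ; (suc j) → c j }) , (λ { zero → 0#-closed ; (suc j) → c∈P j }) , (suc i , ci≉0) ,
        trans (+-cong (zeroˡ _) eq) (+-identityˡ _)

  evaluate-tabulate : ∀ {n} (c : Fin n → Carrier) X →
    evaluate rawRing (List.tabulate c) X ≈ sum (λ i → c i * X ^ toℕ i)
  evaluate-tabulate {zero}  c X = refl
  evaluate-tabulate {suc n} c X = +-cong (sym (*-identityʳ _)) (begin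
    X * evaluate rawRing (List.tabulate (c ∘ suc)) X
      ≈⟨ *-congˡ (evaluate-tabulate (c ∘ suc) X) ⟩
    X * sum (λ i → c (suc i) * X ^ toℕ i)
      ≈⟨ *-distribˡ-sum {n} X (λ i → c (suc i) * X ^ toℕ i) ⟩
    sum (λ i → X * (c (suc i) * X ^ toℕ i))
      ≈⟨ sum-cong-≋ {n} (λ i → solve 3 (λ x c a → x :* (c :* a) := c :* (x :* a)) refl X (c (suc i)) (X ^ toℕ i)) ⟩
    sum (λ i → c (suc i) * X ^ suc (toℕ i)) ∎)

  -- F generates a finite extension of the fraction field of P, and W consists of
  -- its elements that lie in the ambient ring.
  module FiniteExtension {F r : Carrier} {d : ℕ} (r∈P : r ∈ P) (r≉0 : ¬ r ≈ 0#)
    (rF^∈ : r * F ^ suc d ∈ Span F (suc d)) where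

    W : Pred Carrier (c ⊔ ℓ ⊔ s)
    W G = ∃[ t ] t ∈ P × ¬ t ≈ 0# × t * G ∈ Span F (suc d)

    -- Multipliers of `W`. They are closed under sums and products at once, whereas closure of `W`
    -- itself under products would need a product of two spans.
    Stable : Pred Carrier (c ⊔ ℓ ⊔ s)
    Stable X = ∀ {G} → W G → W (X * G)

    W-resp : ∀ {G H} → G ≈ H → W G → W H
    W-resp G≈H (t , t∈P , t≉0 , tG∈) = t , t∈P , t≉0 , span-resp (suc d) (*-congˡ G≈H) tG∈

    W-1 : W 1#
    W-1 = 1# , 1#-closed , 1≉0 , span-resp (suc d) (sym (*-identityʳ 1#)) (span-const d 1#-closed)

    W-+ : ∀ {G H} → W G → W H → W (G + H)
    W-+ {G} {H} (t , t∈P , t≉0 , tG∈) (u , u∈P , u≉0 , uH∈) =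
      t * u , *-closed t∈P u∈P , *-nonzero t≉0 u≉0 ,
      span-resp (suc d) (solve 4 (λ t u g h → u :* (t :* g) :+ t :* (u :* h) := t :* u :* (g :+ h)) refl t u G H)
        (span-+ (suc d) (span-* (suc d) u∈P tG∈) (span-* (suc d) t∈P uH∈))

    stable-P : ∀ {x} → x ∈ P → Stable x
    stable-P {x} x∈P {G} (t , t∈P , t≉0 , tG∈) = t , t∈P , t≉0 ,
      span-resp (suc d) (solve 3 (λ x t g → x :* (t :* g) := t :* (x :* g)) refl x t G)
        (span-* (suc d) x∈P tG∈)

    -- Multiplication by F produces a single power out of range, F^(d+1), which the factor r brings
    -- back through the relation.
    stable-F : Stable F
    stable-F {G} (t , t∈P , t≉0 , tG∈) = r * t , *-closed r∈P t∈P , *-nonzero r≉0 t≉0 ,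
      span-resp (suc d) (solve 4 (λ r t f g → r :* (f :* (t :* g)) := r :* t :* (f :* g)) refl r t F G)
        (reduce (span-shift (suc d) tG∈))
      where
      reduce : ∀ {g} → g ∈ Span F (suc (suc d)) → r * g ∈ Span F (suc d)
      reduce (snoc {r = x} {g′} x∈P g′∈ eq) = span-resp (suc d)
        (sym (trans (*-congˡ eq) (solve 4 (λ r g x y → r :* (g :+ x :* y) := r :* g :+ x :* (r :* y))
          refl r g′ x (F ^ suc d))))
        (span-+ (suc d) (span-* (suc d) r∈P g′∈) (span-* (suc d) x∈P rF^∈))

    stable-+ : ∀ {X Y} → Stable X → Stable Y → Stable (X + Y)
    stable-+ X-stable Y-stable w = W-resp (sym (distribʳ _ _ _)) (W-+ (X-stable w) (Y-stable w))

    stable-* : ∀ {X Y} → Stable X → Stable Y → Stable (X * Y)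
    stable-* X-stable Y-stable w = W-resp (sym (*-assoc _ _ _)) (X-stable (Y-stable w))

    stable-^ : ∀ {X} k → Stable X → Stable (X ^ k)
    stable-^ zero    X-stable = stable-P 1#-closed
    stable-^ (suc k) X-stable = stable-* X-stable (stable-^ k X-stable)

    stable-resp : ∀ {X Y} → X ≈ Y → Stable X → Stable Y
    stable-resp X≈Y X-stable w = W-resp (*-congʳ X≈Y) (X-stable w)

    stable-span : ∀ k {g} → g ∈ Span F k → Stable g
    stable-span zero    (nil g≈0)        = stable-resp (sym g≈0) (stable-P 0#-closed)
    stable-span (suc k) (snoc x∈P g′∈ eq) = stable-resp (sym eq)
      (stable-+ (stable-span k g′∈) (stable-* (stable-P x∈P) (stable-^ k stable-F)))

    -- The d + 2 monomials U^i V^(d+1-i) lie, up to denominators, in the span of d + 1 powers of F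
    -- and are therefore dependent. They equal V^(d+1) A^i, and V^(d+1) cancels in a domain.
    quotient-algebraic : ∀ {U V A} → Stable U → Stable V → ¬ V ≈ 0# → V * A ≈ U → Algebraic rawRing P A
    quotient-algebraic {U} {V} {A} U-stable V-stable V≉0 VA≈U =
      clear (dependent {F} (suc d) (λ i → t i * G i) (λ i → proj₂ (proj₂ (proj₂ (G∈W i)))))
      where
      n : ℕ
      n = suc (suc d)

      G : Fin n → Carrier
      G i = U ^ toℕ i * V ^ (suc d ∸ toℕ i)

      G∈W : ∀ i → W (G i)
      G∈W i = W-resp (*-identityʳ _)
        (stable-* (stable-^ (toℕ i) U-stable) (stable-^ (suc d ∸ toℕ i) V-stable) W-1)

      t : Fin n → Carrier
      t i = proj₁ (G∈W i)

      G≈ : ∀ i → G i ≈ V ^ suc d * A ^ toℕ i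
      G≈ i = begin
        U ^ toℕ i * V ^ (suc d ∸ toℕ i)                ≈⟨ *-congʳ (^-congˡ (toℕ i) VA≈U) ⟨
        (V * A) ^ toℕ i * V ^ (suc d ∸ toℕ i)          ≈⟨ *-congʳ (^-distrib-* V A (toℕ i)) ⟩
        V ^ toℕ i * A ^ toℕ i * V ^ (suc d ∸ toℕ i)
          ≈⟨ solve 3 (λ v a w → v :* a :* w := v :* w :* a) refl (V ^ toℕ i) (A ^ toℕ i) (V ^ (suc d ∸ toℕ i)) ⟩
        V ^ toℕ i * V ^ (suc d ∸ toℕ i) * A ^ toℕ i    ≈⟨ *-congʳ (^-homo-* V (toℕ i) (suc d ∸ toℕ i)) ⟨
        V ^ (toℕ i ℕ.+ (suc d ∸ toℕ i)) * A ^ toℕ i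
          ≡⟨ ≡.cong (λ k → V ^ k * A ^ toℕ i) (ℕ.m+[n∸m]≡n (Fin.toℕ≤pred[n] i)) ⟩
        V ^ suc d * A ^ toℕ i ∎

      clear : Dependent (λ i → t i * G i) → Algebraic rawRing P A
      clear (c , c∈P , (i , ci≉0) , eq) =
        List.tabulate ct ,
        All.tabulate⁺ {f = ct} (λ j → *-closed (c∈P j) (proj₁ (proj₂ (G∈W j)))) ,
        Any.tabulate⁺ {f = ct} i (*-nonzero ci≉0 (proj₁ (proj₂ (proj₂ (G∈W i))))) ,
        trans (evaluate-tabulate ct A) (domain (begin
          V ^ suc d * sum (λ j → ct j * A ^ toℕ j)
            ≈⟨ *-distribˡ-sum {n} (V ^ suc d) (λ j → ct j * A ^ toℕ j) ⟩
          sum (λ j → V ^ suc d * (ct j * A ^ toℕ j))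
            ≈⟨ sum-cong-≋ {n} (λ j → trans
                 (solve 4 (λ v c t a → v :* (c :* t :* a) := c :* (t :* (v :* a))) refl (V ^ suc d) (c j) (t j) (A ^ toℕ j))
                 (*-congˡ (*-congˡ (sym (G≈ j))))) ⟩
          sum (λ j → c j * (t j * G j)) ≈⟨ eq ⟩
          0# ∎) (^-nonzero (suc d) V≉0))
        where
        ct : Fin n → Carrier
        ct j = c j * t j

  module LogarithmicDerivative
    (char-0 : ∀ n {x} → suc n · x ≈ 0# → x ≈ 0#)
    (θ : Carrier → Carrier) (θ-cong : ∀ {x y} → x ≈ y → θ x ≈ θ y)
    (θ-+ : ∀ x y → θ (x + y) ≈ θ x + θ y)
    (θ-* : ∀ x y → θ (x * y) ≈ θ x * y + x * θ y)
    (θ-closed : ∀ {x} → x ∈ P → θ x ∈ P)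
    {F A : Carrier} (F≉0 : ¬ F ≈ 0#) (θF≈ : θ F ≈ A * F) where

    θ-1 : θ 1# ≈ 0#
    θ-1 = x+x≈x⇒x≈0 (θ 1#) (begin
      θ 1# + θ 1#              ≈⟨ +-cong (*-identityʳ _) (*-identityˡ _) ⟨
      θ 1# * 1# + 1# * θ 1#    ≈⟨ θ-* 1# 1# ⟨
      θ (1# * 1#)              ≈⟨ θ-cong (*-identityˡ 1#) ⟩
      θ 1#                     ∎)

    θ-^ : ∀ k → θ (F ^ k) ≈ k · 1# * (A * F ^ k)
    θ-^ zero    = trans θ-1 (sym (zeroˡ _))
    θ-^ (suc k) = begin
      θ (F * F ^ k)                                  ≈⟨ θ-* F (F ^ k) ⟩
      θ F * F ^ k + F * θ (F ^ k)                    ≈⟨ +-cong (*-congʳ θF≈) (*-congˡ (θ-^ k)) ⟩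
      A * F * F ^ k + F * (k · 1# * (A * F ^ k))
        ≈⟨ +-congʳ (*-identityˡ _) ⟨
      1# * (A * F * F ^ k) + F * (k · 1# * (A * F ^ k))
        ≈⟨ solve 5 (λ o a f x m → o :* (a :* f :* x) :+ f :* (m :* (a :* x)) := (o :+ m) :* (a :* (f :* x)))
             refl 1# A F (F ^ k) (k · 1#) ⟩
      suc k · 1# * (A * F ^ suc k) ∎

    -- θ(r F^i) is θr F^i + i r A F^i. The first summands are free of A; in the second ones the
    -- constant term i = 0 drops out, so a factor F can be extracted and `g₂` has one power less.
    θ-span : ∀ k {g} → g ∈ Span F (suc k) →
      ∃[ g₁ ] ∃[ g₂ ] g₁ ∈ Span F (suc k) × g₂ ∈ Span F k × θ g ≈ g₁ + A * (F * g₂)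
    θ-span k (snoc {r = r} {g′} r∈P g′∈ eq) = go k g′∈ eq
      where
      go : ∀ k {g g′} → g′ ∈ Span F k → g ≈ g′ + r * F ^ k →
           ∃[ g₁ ] ∃[ g₂ ] g₁ ∈ Span F (suc k) × g₂ ∈ Span F k × θ g ≈ g₁ + A * (F * g₂)
      go zero {g} {g′} (nil g′≈0) eq = θ r , 0# , span-const 0 (θ-closed r∈P) , span-0 0 ,
        trans (θ-cong (trans eq (trans (+-cong g′≈0 (*-identityʳ r)) (+-identityˡ r))))
          (sym (trans (+-congˡ (trans (*-congˡ (zeroʳ F)) (zeroʳ A))) (+-identityʳ _)))
      go (suc k) {g} {g′} g′∈ eq with g₁ , g₂ , g₁∈ , g₂∈ , eq′ ← θ-span k g′∈ =
        g₁ + θ r * F ^ suc k , g₂ + r * (suc k · 1#) * F ^ k ,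
        snoc (θ-closed r∈P) g₁∈ refl ,
        snoc (*-closed r∈P (·-closed (suc k) 1#-closed)) g₂∈ refl , (begin
          θ g                                           ≈⟨ θ-cong eq ⟩
          θ (g′ + r * F ^ suc k)                        ≈⟨ θ-+ _ _ ⟩
          θ g′ + θ (r * F ^ suc k)                      ≈⟨ +-cong eq′ (θ-* _ _) ⟩
          g₁ + A * (F * g₂) + (θ r * F ^ suc k + r * θ (F ^ suc k))
            ≈⟨ +-congˡ (+-congˡ (*-congˡ (θ-^ (suc k)))) ⟩
          g₁ + A * (F * g₂) + (θ r * F ^ suc k + r * (suc k · 1# * (A * F ^ suc k)))
            ≈⟨ solve 8 (λ g a f h t x r m →
                 g :+ a :* (f :* h) :+ (t :* (f :* x) :+ r :* (m :* (a :* (f :* x)))) :=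
                 (g :+ t :* (f :* x)) :+ a :* (f :* (h :+ r :* m :* x)))
               refl g₁ A F g₂ (θ r) (F ^ k) r (suc k · 1#) ⟩
          g₁ + θ r * F ^ suc k + A * (F * (g₂ + r * (suc k · 1#) * F ^ k)) ∎)

    ·-nonzero : ∀ n {x} → ¬ x ≈ 0# → ¬ x * (suc n · 1#) ≈ 0#
    ·-nonzero n x≉0 eq = x≉0 (char-0 n (begin
      suc n · _           ≈⟨ ×-congʳ (suc n) (*-identityʳ _) ⟨
      suc n · (_ * 1#)    ≈⟨ ×-comm-* (suc n) _ 1# ⟨
      _ * (suc n · 1#)    ≈⟨ eq ⟩
      0#                  ∎))
      where open SemiringMult semiring using (×-congʳ)

    -- Differentiating a relation r Fᵈ⁺¹ = Σ sᵢ Fⁱ and substituting θF = AF gives VA = U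
    -- with U and V in the extension, and V ≠ 0 unless there is a shorter relation.
    relation⇒algebraic : ¬ Algebraic rawRing P A → ∀ d → ¬ Relation F d
    relation⇒algebraic A-transcendental zero (r , r∈P , r≉0 , nil r≈0) = r≉0 (trans (sym (*-identityʳ r)) r≈0)
    relation⇒algebraic A-transcendental (suc d) (r , r∈P , r≉0 , rF∈) = differentiate (θ-span d rF∈)
      where
      open FiniteExtension r∈P r≉0 rF∈
      differentiate : ¬ (∃[ g₁ ] ∃[ g₂ ] g₁ ∈ Span F (suc d) × g₂ ∈ Span F d × θ (r * F ^ suc d) ≈ g₁ + A * (F * g₂))
      differentiate (g₁ , g₂ , g₁∈ , g₂∈ , eq) = A-transcendental (quotient-algebraic
        (stable-span (suc (suc d)) U∈) (stable-* stable-F (stable-span (suc d) V′∈)) (*-nonzero F≉0 V′≉0) VA≈U)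
        where
        m = suc d · 1#
        V′ U : Carrier
        V′ = r * m * F ^ d - g₂
        U  = g₁ - θ r * F ^ suc d
        rm∈P : r * m ∈ P
        rm∈P = *-closed r∈P (·-closed (suc d) 1#-closed)
        V′∈ : V′ ∈ Span F (suc d)
        V′∈ = span-- (suc d) (span-term d rm∈P) (span-suc d g₂∈)
        U∈ : U ∈ Span F (suc (suc d))
        U∈ = span-- (suc (suc d)) (span-suc (suc d) g₁∈) (span-term (suc d) (θ-closed r∈P))
        -- Otherwise there is a relation of degree d with leading coefficient r (d + 1), which is
        -- nonzero in characteristic 0.
        V′≉0 : ¬ V′ ≈ 0#
        V′≉0 V′≈0 = relation⇒algebraic A-transcendental d
          (r * m , rm∈P , ·-nonzero d r≉0 , span-resp d (sym (x∙y⁻¹≈ε⇒x≈y _ _ V′≈0)) g₂∈)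
        VA≈U : F * V′ * A ≈ U
        VA≈U = begin
          F * V′ * A
            ≈⟨ solve 8 (λ f r m x g a t h → f :* (r :* m :* x :- g) :* a :=
                 (t :* (f :* x) :+ r :* (m :* (a :* (f :* x)))) :- (t :* (f :* x) :+ a :* (f :* g)))
               refl F r m (F ^ d) g₂ A (θ r) g₁ ⟩
          (θ r * F ^ suc d + r * (m * (A * F ^ suc d))) - (θ r * F ^ suc d + A * (F * g₂))
            ≈⟨ +-congʳ (+-congˡ (*-congˡ (θ-^ (suc d)))) ⟨
          (θ r * F ^ suc d + r * θ (F ^ suc d)) - (θ r * F ^ suc d + A * (F * g₂))
            ≈⟨ +-congʳ (trans (sym (θ-* _ _)) eq) ⟩
          (g₁ + A * (F * g₂)) - (θ r * F ^ suc d + A * (F * g₂))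
            ≈⟨ solve 3 (λ g a t → (g :+ a) :- (t :+ a) := g :- t) refl g₁ (A * (F * g₂)) (θ r * F ^ suc d) ⟩
          U ∎

    algebraic⇒algebraic : ¬ Algebraic rawRing P A → ¬ Algebraic rawRing P F
    algebraic⇒algebraic A-transcendental F-algebraic =
      relation⇒algebraic A-transcendental _ (proj₂ (algebraic⇒relation P-zero? F-algebraic))

-- Power series over a domain: cancellation, polynomials, residue classes of exponents

record DiscreteDomain c ℓ : Set (lsuc (c ⊔ ℓ)) where
  field
    commutativeRing : CommutativeRing c ℓ

  open CommutativeRing commutativeRing public

  field
    1≉0    : ¬ 1# ≈ 0#
    domain : ∀ {x y} → x * y ≈ 0# → ¬ x ≈ 0# → y ≈ 0#
    _≟_    : Decidable _≈_

module PolynomialSeries (R : DiscreteDomain c ℓ)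
  (1ˢ : ℕ → DiscreteDomain.Carrier R)
  (1ˢ-zero : DiscreteDomain._≈_ R (1ˢ 0) (DiscreteDomain.1# R))
  (1ˢ-suc : ∀ n → DiscreteDomain._≈_ R (1ˢ (suc n)) (DiscreteDomain.0# R)) where
  open DiscreteDomain R hiding (zero)
  open PowerSeriesRing commutativeRing 1ˢ 1ˢ-zero 1ˢ-suc
  open SemiringMult semiring using (×-congʳ; ×-comm-*) renaming (_×_ to _·_)
  open SemiringSum semiring using (sum-cong-≋; sum-replicate-zero)
  open RingProperties ring
  open SetoidReasoning setoid
  open IntegerCoefficients commutativeRing

  ⊛-congˡ-≤ : ∀ f g g′ n → (∀ i → i ℕ.≤ n → g i ≈ g′ i) → (f ⊛ g) n ≈ (f ⊛ g′) n
  ⊛-congˡ-≤ f g g′ n g≈ = sum-cong-≋ {suc n} λ i → *-congˡ {f (toℕ i)} (g≈ (n ∸ toℕ i) (ℕ.m∸n≤m n (toℕ i)))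

  ⊛-zero-terms : ∀ f g n → (∀ i → i ℕ.≤ n → f i * g (n ∸ i) ≈ 0#) → (f ⊛ g) n ≈ 0#
  ⊛-zero-terms f g n terms = trans
    (sum-cong-≋ {suc n} λ i → terms (toℕ i) (Fin.toℕ≤pred[n] i)) (sum-replicate-zero (suc n))

  ⊛-zeroʳ-≤ : ∀ f g n → (∀ i → i ℕ.≤ n → g i ≈ 0#) → (f ⊛ g) n ≈ 0#
  ⊛-zeroʳ-≤ f g n g≈0 = ⊛-zero-terms f g n λ i i≤n →
    trans (*-congˡ (g≈0 (n ∸ i) (ℕ.m∸n≤m n i))) (zeroʳ _)

  cancel₀ : ∀ n f g → f ⊛ g ≈ˢ 0ˢ → ¬ g 0 ≈ 0# → f n ≈ 0#
  cancel₀ zero f g fg≈0 g₀≉0 =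
    domain (trans (*-comm _ _) (trans (sym (+-identityʳ _)) (fg≈0 0))) g₀≉0
  cancel₀ (suc n) f g fg≈0 g₀≉0 = cancel₀ n (tail f) g (λ m → begin
    (tail f ⊛ g) m                    ≈⟨ +-identityˡ _ ⟨
    0# + (tail f ⊛ g) m               ≈⟨ +-congʳ (trans (*-congʳ (cancel₀ 0 f g fg≈0 g₀≉0)) (zeroˡ _)) ⟨
    f 0 * g (suc m) + (tail f ⊛ g) m  ≈⟨ fg≈0 (suc m) ⟩
    0#                                ∎) g₀≉0

  -- Factors t are stripped from `g` until its constant term is nonzero; the index n of a nonzero
  -- coefficient bounds their number.
  ⊛-cancelʳ : ∀ n f g → f ⊛ g ≈ˢ 0ˢ → ¬ g n ≈ 0# → f ≈ˢ 0ˢ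
  ⊛-cancelʳ n f g fg≈0 gₙ≉0 with g 0 ≟ 0#
  ... | no  g₀≉0 = λ m → cancel₀ m f g fg≈0 g₀≉0
  ⊛-cancelʳ zero    f g fg≈0 g₀≉0 | yes g₀≈0 = contradiction g₀≈0 g₀≉0
  ⊛-cancelʳ (suc n) f g fg≈0 gₙ≉0 | yes g₀≈0 = ⊛-cancelʳ n f (tail g) (λ m → begin
    (f ⊛ tail g) m                   ≈⟨ +-identityʳ _ ⟨
    (f ⊛ tail g) m + 0#              ≈⟨ +-congˡ (trans (*-congˡ g₀≈0) (zeroʳ _)) ⟨
    (f ⊛ tail g) m + f (suc m) * g 0 ≈⟨ ⊛-sucʳ f g m ⟨
    (f ⊛ g) (suc m)                  ≈⟨ fg≈0 (suc m) ⟩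
    0#                               ∎) gₙ≉0

  ⊛-domain : ∀ {f g} → f ⊛ g ≈ˢ 0ˢ → ¬ f ≈ˢ 0ˢ → g ≈ˢ 0ˢ
  ⊛-domain {f} {g} fg≈0 f≉0 n with g n ≟ 0#
  ... | yes gₙ≈0 = gₙ≈0
  ... | no  gₙ≉0 = contradiction (⊛-cancelʳ n f g fg≈0 gₙ≉0) f≉0

  1ˢ≉0ˢ : ¬ 1ˢ ≈ˢ 0ˢ
  1ˢ≉0ˢ 1ˢ≈0ˢ = 1≉0 (trans (sym 1ˢ-zero) (1ˢ≈0ˢ 0))

  VanishesFrom : ℕ → Pred Series ℓ
  VanishesFrom h f = ∀ n → h ℕ.≤ n → f n ≈ 0#

  IsPolynomial : Pred Series ℓ
  IsPolynomial f = ∃[ h ] VanishesFrom h f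

  ⊛-vanishes : ∀ h k f g → VanishesFrom h f → VanishesFrom k g → VanishesFrom (h ℕ.+ k) (f ⊛ g)
  ⊛-vanishes zero    k f g f≈0 g≈0 n _ = trans (⊛-congʳ g (λ i → f≈0 i z≤n) n) (⊛-zeroˡ g n)
  ⊛-vanishes (suc h) k f g f≈0 g≈0 (suc n) (s≤s h+k≤n) = begin
    f 0 * g (suc n) + (tail f ⊛ g) n
      ≈⟨ +-cong (*-congˡ (g≈0 (suc n) (ℕ.≤-trans (ℕ.m≤n+m k h) (ℕ.m≤n⇒m≤1+n h+k≤n))))
                (⊛-vanishes h k (tail f) g (λ i h≤i → f≈0 (suc i) (s≤s h≤i)) g≈0 n h+k≤n) ⟩
    f 0 * 0# + 0#   ≈⟨ +-identityʳ _ ⟩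
    f 0 * 0#        ≈⟨ zeroʳ _ ⟩
    0#              ∎

  polynomial-subring : IsSubring seriesRing IsPolynomial
  polynomial-subring = record
    { respects   = λ f≈g (h , f≈0) → h , λ n h≤n → trans (sym (f≈g n)) (f≈0 n h≤n)
    ; 0#-closed  = 0 , λ _ _ → refl
    ; 1#-closed  = 1 , λ { (suc n) _ → 1ˢ-suc n }
    ; +-closed   = λ (h , f≈0) (k , g≈0) → h ℕ.+ k , λ n h+k≤n → trans
        (+-cong (f≈0 n (ℕ.≤-trans (ℕ.m≤m+n h k) h+k≤n)) (g≈0 n (ℕ.≤-trans (ℕ.m≤n+m k h) h+k≤n)))
        (+-identityˡ 0#)
    ; *-closed   = λ {f} {g} (h , f≈0) (k , g≈0) → h ℕ.+ k , ⊛-vanishes h k f g f≈0 g≈0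
    ; neg-closed = λ (h , f≈0) → h , λ n h≤n → trans (-‿cong (f≈0 n h≤n)) -0#≈0#
    }

  leadingIndex : ∀ f h → VanishesFrom h f →
    f ≈ˢ 0ˢ ⊎ ∃[ j ] ¬ f j ≈ 0# × VanishesFrom (suc j) f
  leadingIndex f zero    f≈0 = inj₁ λ n → f≈0 n z≤n
  leadingIndex f (suc h) f≈0 with f h ≟ 0#
  ... | no  fₕ≉0 = inj₂ (h , fₕ≉0 , f≈0)
  ... | yes fₕ≈0 = leadingIndex f h λ n h≤n → vanish n (ℕ.m≤n⇒m<n∨m≡n h≤n)
    where
    vanish : ∀ n → h ℕ.< n ⊎ h ≡ n → f n ≈ 0#
    vanish n (inj₁ h<n)    = f≈0 n h<n
    vanish n (inj₂ ≡.refl) = fₕ≈0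

  polynomial-zero? : ∀ {f} → IsPolynomial f → Dec (f ≈ˢ 0ˢ)
  polynomial-zero? {f} (h , f≈0) with leadingIndex f h f≈0
  ... | inj₁ f≈ˢ0            = yes f≈ˢ0
  ... | inj₂ (j , fⱼ≉0 , _) = no λ f≈ˢ0 → fⱼ≉0 (f≈ˢ0 j)

  -- The derivation t d/dt, preferred to d/dt because it leaves every index in place.
  θ : Series → Series
  θ f n = n · f n

  θ-⊛ : ∀ f g → θ (f ⊛ g) ≈ˢ θ f ⊛ g ⊕ f ⊛ θ g
  θ-⊛ f g zero = sym (begin
    (0# * g 0 + 0#) + (f 0 * 0# + 0#)  ≈⟨ +-cong (+-identityʳ _) (+-identityʳ _) ⟩
    0# * g 0 + f 0 * 0#                ≈⟨ +-cong (zeroˡ _) (zeroʳ _) ⟩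
    0# + 0#                            ≈⟨ +-identityˡ _ ⟩
    0#                                 ∎)
  θ-⊛ f g (suc n) = begin
    suc n · (f 0 * g (suc n) + T)
      ≈⟨ ×-distrib-+ _ _ (suc n) ⟩
    suc n · (f 0 * g (suc n)) + (T + n · T)
      ≈⟨ +-cong (sym (×-comm-* (suc n) _ _)) (+-congˡ (θ-⊛ (tail f) g n)) ⟩
    f 0 * (suc n · g (suc n)) + (T + ((θ (tail f) ⊛ g) n + (tail f ⊛ θ g) n))
      ≈⟨ solve 5 (λ a t x y z → a :+ (t :+ (x :+ y)) := (con (ℤ.+ 0) :* z :+ (t :+ x)) :+ (a :+ y))
           refl (f 0 * (suc n · g (suc n))) T ((θ (tail f) ⊛ g) n) ((tail f ⊛ θ g) n) (g (suc n)) ⟩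
    (0# * g (suc n) + (T + (θ (tail f) ⊛ g) n)) + (f 0 * (suc n · g (suc n)) + (tail f ⊛ θ g) n)
      ≈⟨ +-congʳ (+-congˡ (⊛-distribʳ g (tail f) (θ (tail f)) n)) ⟨
    (0# * g (suc n) + ((tail f ⊕ θ (tail f)) ⊛ g) n) + (f 0 * (suc n · g (suc n)) + (tail f ⊛ θ g) n) ∎
    where
    T = (tail f ⊛ g) n
    open CommutativeMult +-commutativeMonoid using (×-distrib-+)

  θ-closed : ∀ {f} → IsPolynomial f → IsPolynomial (θ f)
  θ-closed (h , f≈0) = h , λ n h≤n → trans (×-congʳ n (f≈0 n h≤n)) (·-zeroʳ n)
    where open TrivialPowers semiring using (·-zeroʳ)

  shift : ℕ → Series → Series
  shift zero    f n       = f n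
  shift (suc k) f zero    = 0#
  shift (suc k) f (suc n) = shift k f n

  shift-+ : ∀ k f n → shift k f (k ℕ.+ n) ≡ f n
  shift-+ zero    f n = ≡.refl
  shift-+ (suc k) f n = shift-+ k f n

  shift-< : ∀ k f n → n ℕ.< k → shift k f n ≡ 0#
  shift-< (suc k) f zero    _           = ≡.refl
  shift-< (suc k) f (suc n) (s≤s n<k) = shift-< k f n n<k

  ⊛-shift : ∀ k f g → shift k f ⊛ g ≈ˢ shift k (f ⊛ g)
  ⊛-shift zero    f g n       = refl
  ⊛-shift (suc k) f g zero    = trans (+-identityʳ _) (zeroˡ _)
  ⊛-shift (suc k) f g (suc n) = trans (+-cong (zeroˡ _) (⊛-shift k f g n)) (+-identityˡ _)

  shift-cong : ∀ k {f g} → f ≈ˢ g → shift k f ≈ˢ shift k g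
  shift-cong zero    f≈g n       = f≈g n
  shift-cong (suc k) f≈g zero    = refl
  shift-cong (suc k) f≈g (suc n) = shift-cong k f≈g n

  shift-vanishes : ∀ k h f → VanishesFrom h f → VanishesFrom (k ℕ.+ h) (shift k f)
  shift-vanishes zero    h f f≈0 n       h≤n         = f≈0 n h≤n
  shift-vanishes (suc k) h f f≈0 (suc n) (s≤s kh≤n) = shift-vanishes k h f f≈0 n kh≤n

  shift-1ˢ : ∀ j → shift j 1ˢ j ≈ 1#
  shift-1ˢ zero    = 1ˢ-zero
  shift-1ˢ (suc j) = shift-1ˢ j

  shift-1ˢ-≢ : ∀ j n → ¬ n ≡ j → shift j 1ˢ n ≈ 0#
  shift-1ˢ-≢ zero    zero    0≢0 = contradiction ≡.refl 0≢0
  shift-1ˢ-≢ zero    (suc n) _   = 1ˢ-suc n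
  shift-1ˢ-≢ (suc j) zero    _   = refl
  shift-1ˢ-≢ (suc j) (suc n) n≢j = shift-1ˢ-≢ j n (n≢j ∘ ≡.cong suc)

  -- These are the series in t^N.
  SupportedOnMultiples : ℕ → Pred Series ℓ
  SupportedOnMultiples N f = ∀ n → ¬ N ∣ n → f n ≈ 0#

  supported-1ˢ : ∀ N → SupportedOnMultiples N 1ˢ
  supported-1ˢ N zero    N∤0 = contradiction (N ℕ.∣0) N∤0
  supported-1ˢ N (suc n) _   = 1ˢ-suc n

  supported-⊛ : ∀ N {f g} → SupportedOnMultiples N f → SupportedOnMultiples N g → SupportedOnMultiples N (f ⊛ g)
  supported-⊛ N {f} {g} f-supp g-supp n N∤n = ⊛-zero-terms f g n term
    where
    term : ∀ i → i ℕ.≤ n → f i * g (n ∸ i) ≈ 0#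
    term i i≤n with N ∣? i
    ... | no  N∤i = trans (*-congʳ (f-supp i N∤i)) (zeroˡ _)
    ... | yes N∣i = trans (*-congˡ (g-supp (n ∸ i) λ N∣n-i → N∤n
      (≡.subst (N ∣_) (ℕ.m+[n∸m]≡n i≤n) (ℕ.∣m∣n⇒∣m+n N∣i N∣n-i)))) (zeroʳ _)

  supported-shift : ∀ N m {f} → N ∣ m → SupportedOnMultiples N f → SupportedOnMultiples N (shift m f)
  supported-shift N m {f} N∣m f-supp n N∤n with ℕ.<-≤-connex n m
  ... | inj₁ n<m = reflexive (shift-< m f n n<m)
  ... | inj₂ m≤n = trans (reflexive (≡.trans (≡.cong (shift m f) (≡.sym (ℕ.m+[n∸m]≡n m≤n))) (shift-+ m f (n ∸ m))))
    (f-supp (n ∸ m) λ N∣n-m → N∤n (≡.subst (N ∣_) (ℕ.m+[n∸m]≡n m≤n) (ℕ.∣m∣n⇒∣m+n N∣m N∣n-m)))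

  module Projection (N : ℕ) .{{_ : ℕ.NonZero N}} (j : ℕ) where

    -- The decision is an argument, so that properties follow by matching on it and are then
    -- instantiated at `n % N ℕ.≟ j`.
    select : ∀ {n} → Dec (n % N ≡ j) → Carrier → Carrier
    select (yes _) x = x
    select (no _)  x = 0#

    select-cong : ∀ {n} (d : Dec (n % N ≡ j)) {x y} → x ≈ y → select d x ≈ select d y
    select-cong (yes _) x≈y = x≈y
    select-cong (no _)  x≈y = refl

    select-+ : ∀ {n} (d : Dec (n % N ≡ j)) x y → select d (x + y) ≈ select d x + select d y
    select-+ (yes _) x y = refl
    select-+ (no _)  x y = sym (+-identityˡ 0#)

    select-0 : ∀ {n} (d : Dec (n % N ≡ j)) {x} → x ≈ 0# → select d x ≈ 0#
    select-0 (yes _) x≈0 = x≈0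
    select-0 (no _)  x≈0 = refl

    π : Series → Series
    π f n = select (n % N ℕ.≟ j) (f n)

    π-closed : ∀ {f} → IsPolynomial f → IsPolynomial (π f)
    π-closed (h , f≈0) = h , λ n h≤n → select-0 (n % N ℕ.≟ j) (f≈0 n h≤n)

    residue : ∀ {i n} → i ℕ.≤ n → N ∣ n ∸ i → n % N ≡ i % N
    residue {i} i≤n (divides m eq) = ≡.trans
      (≡.cong (_% N) (≡.trans (≡.sym (ℕ.m+[n∸m]≡n i≤n)) (≡.cong (i ℕ.+_) eq)))
      (ℕ.[m+kn]%n≡m%n i m N)

    -- In a nonzero term f i * g (n - i) the difference n - i is a multiple of N, so i and n lie in
    -- the same residue class and selecting by either is the same.
    π-linear : ∀ f g → SupportedOnMultiples N g → π (f ⊛ g) ≈ˢ π f ⊛ g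
    π-linear f g g-supp n with n % N ℕ.≟ j
    ... | yes n≡j = sum-cong-≋ {suc n} λ i → term (toℕ i) (Fin.toℕ≤pred[n] i)
      where
      term : ∀ i → i ℕ.≤ n → f i * g (n ∸ i) ≈ π f i * g (n ∸ i)
      term i i≤n with N ∣? (n ∸ i) | i % N ℕ.≟ j
      ... | no  N∤n-i | _       = trans (trans (*-congˡ (g-supp _ N∤n-i)) (zeroʳ _))
                                    (sym (trans (*-congˡ (g-supp _ N∤n-i)) (zeroʳ _)))
      ... | yes _     | yes _   = refl
      ... | yes N∣n-i | no i≢j = contradiction (≡.trans (≡.sym (residue i≤n N∣n-i)) n≡j) i≢j
    ... | no n≢j = sym (⊛-zero-terms (π f) g n term)
      where
      term : ∀ i → i ℕ.≤ n → π f i * g (n ∸ i) ≈ 0#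
      term i i≤n with N ∣? (n ∸ i) | i % N ℕ.≟ j
      ... | no  N∤n-i | _       = trans (*-congˡ (g-supp _ N∤n-i)) (zeroʳ _)
      ... | yes _     | no _    = zeroˡ _
      ... | yes N∣n-i | yes i≡j = contradiction (≡.trans (residue i≤n N∣n-i) i≡j) n≢j

-- It exhibits e p^(k+1) as e p^k shifted by p - 1 periods e p^k, the shift at which periodicity
-- breaks down.
*-^-suc : ∀ p e k .{{_ : ℕ.NonZero p}} → e ℕ.* p ℕ.^ suc k ≡ (p ∸ 1) ℕ.* (e ℕ.* p ℕ.^ k) ℕ.+ e ℕ.* p ℕ.^ k
*-^-suc (suc p) e k = solve 3 (λ p e r → e :* (r :+ p :* r) := p :* (e :* r) :+ e :* r) ≡.refl p e (suc p ℕ.^ k)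
  where open +-*-Solver using (solve; _:+_; _:*_; _:=_)

-- Transcendence of a series that is periodic only away from multiples of powers of p

module Transcendence (R : DiscreteDomain c ℓ)
  (1ˢ : ℕ → DiscreteDomain.Carrier R)
  (1ˢ-zero : DiscreteDomain._≈_ R (1ˢ 0) (DiscreteDomain.1# R))
  (1ˢ-suc : ∀ n → DiscreteDomain._≈_ R (1ˢ (suc n)) (DiscreteDomain.0# R)) where
  open DiscreteDomain R hiding (zero)
  open PowerSeriesRing commutativeRing 1ˢ 1ˢ-zero 1ˢ-suc
  open PolynomialSeries R 1ˢ 1ˢ-zero 1ˢ-suc
  open SemiringMult semiring using (×-congʳ; ×-comm-*) renaming (_×_ to _·_)
  open SemiringExp semiring using (_^_)
  open RingProperties ring
  open SetoidReasoning setoid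
  open IntegerCoefficients commutativeRing

  module S = CommutativeRing seriesRing
  open Spans seriesRing IsPolynomial polynomial-subring
  open SemiringExp S.semiring using () renaming (_^_ to _^ˢ_)
  open SemiringMult S.semiring using () renaming (_×_ to _·ˢ_)

  supported-^ : ∀ N {f} k → SupportedOnMultiples N f → SupportedOnMultiples N (f ^ˢ k)
  supported-^ N zero        f-supp = supported-1ˢ N
  supported-^ N {f} (suc k) f-supp = supported-⊛ N {f} {f ^ˢ k} f-supp (supported-^ N k f-supp)

  ⊛-·ˢ : ∀ f m g n → (f ⊛ (m ·ˢ g)) n ≈ m · (f ⊛ g) n
  ⊛-·ˢ f m g n = trans (×-comm-*ˢ m f g n) (·ˢ-coefficient m (f ⊛ g) n)
    where open SemiringMult S.semiring using () renaming (×-comm-* to ×-comm-*ˢ)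

  -- Away from the multiples of pᵏ, the sequence A n / τⁿ has period e pᵏ.
  module _ (p e : ℕ) (2≤p : 2 ℕ.≤ p) (1≤e : 1 ℕ.≤ e) (τ : Carrier)
    (char-0 : ∀ n {x} → suc n · x ≈ 0# → x ≈ 0#)
    (A : Series) (A₀≈0 : A 0 ≈ 0#)
    (periodic : ∀ k m n → ¬ (p ℕ.^ k ∣ n) →
                A (m ℕ.* (e ℕ.* p ℕ.^ k) ℕ.+ n) ≈ τ ^ (m ℕ.* (e ℕ.* p ℕ.^ k)) * A n)
    (aperiodic : ∀ k → ¬ A (e ℕ.* p ℕ.^ suc k) ≈
                 τ ^ ((p ∸ 1) ℕ.* (e ℕ.* p ℕ.^ k)) * A (e ℕ.* p ℕ.^ k)) where

    private instance
      p≢0 : ℕ.NonZero p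
      p≢0 = ℕ.>-nonZero (ℕ.≤-trans (s≤s z≤n) 2≤p)

    n<p^n : ∀ n → n ℕ.< p ℕ.^ n
    n<p^n zero    = s≤s z≤n
    n<p^n (suc n) = ℕ.≤-trans (s≤s (n<p^n n)) (ℕ.≤-trans
      (ℕ.≤-trans (ℕ.+-monoˡ-≤ (p ℕ.^ n) (ℕ.m^n>0 p n)) (ℕ.≤-reflexive (≡.cong (p ℕ.^ n ℕ.+_) (≡.sym (ℕ.+-identityʳ _)))))
      (ℕ.*-monoˡ-≤ (p ℕ.^ n) 2≤p))

    drop : ℕ → Series → Series
    drop x f n = f (x ℕ.+ n)

    -- As `r` ends at index j, the coefficient at x + j sees only the window of `f` from x to x + j.
    ⊛-drop : ∀ j r → VanishesFrom (suc j) r → ∀ x f → (r ⊛ f) (x ℕ.+ j) ≈ (r ⊛ drop x f) j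
    ⊛-drop j r r-top zero    f = refl
    ⊛-drop j r r-top (suc x) f = begin
      (r ⊛ f) (suc (x ℕ.+ j))                            ≈⟨ ⊛-sucʳ r f (x ℕ.+ j) ⟩
      (r ⊛ tail f) (x ℕ.+ j) + r (suc (x ℕ.+ j)) * f 0   ≈⟨ +-cong (⊛-drop j r r-top x (tail f))
                                                          (*-congʳ (r-top _ (s≤s (ℕ.m≤n+m j x)))) ⟩
      (r ⊛ drop (suc x) f) j + 0# * f 0                  ≈⟨ +-congˡ (zeroˡ _) ⟩
      (r ⊛ drop (suc x) f) j + 0#                        ≈⟨ +-identityʳ _ ⟩
      (r ⊛ drop (suc x) f) j ∎

    ⊛-head : ∀ j r f → (∀ i → i ℕ.< j → f (suc i) ≈ 0#) → (r ⊛ f) j ≈ r j * f 0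
    ⊛-head zero    r f f≈0 = +-identityʳ _
    ⊛-head (suc j) r f f≈0 = begin
      (r ⊛ f) (suc j)                       ≈⟨ ⊛-sucʳ r f j ⟩
      (r ⊛ tail f) j + r (suc j) * f 0      ≈⟨ +-congʳ (⊛-zeroʳ-≤ r (tail f) j λ i i≤j → f≈0 i (s≤s i≤j)) ⟩
      0# + r (suc j) * f 0                  ≈⟨ +-identityˡ _ ⟩
      r (suc j) * f 0                       ∎

    -- The windows of A of length j starting at e pᵏ and at e pᵏ⁺¹ are proportional
    -- except for their first entries, so r A cannot vanish at both.
    window : ∀ j k r → j ℕ.< p ℕ.^ k → ¬ r j ≈ 0# → VanishesFrom (suc j) r →
             (r ⊛ A) (e ℕ.* p ℕ.^ k ℕ.+ j) ≈ 0# → ¬ (r ⊛ A) (e ℕ.* p ℕ.^ suc k ℕ.+ j) ≈ 0#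
    window j k r j<p^k rⱼ≉0 r-top rA₁≈0 rA₂≈0 = aperiodic k
      (trans (reflexive (≡.cong A (≡.sym (ℕ.+-identityʳ _)))) (trans
        (x∙y⁻¹≈ε⇒x≈y (A (x₂ ℕ.+ 0)) (σ * A (x₁ ℕ.+ 0)) (domain (trans (sym (⊛-head j r B B-vanishes)) rB≈0) rⱼ≉0))
        (*-congˡ (reflexive (≡.cong A (ℕ.+-identityʳ _))))))
      where
      x₁ = e ℕ.* p ℕ.^ k
      x₂ = e ℕ.* p ℕ.^ suc k
      σ = τ ^ ((p ∸ 1) ℕ.* x₁)
      B : Series
      B n = A (x₂ ℕ.+ n) - σ * A (x₁ ℕ.+ n)

      -- From 0 < i + 1 ≤ j < p^k it follows that x₁ + i + 1 is not a multiple of p^k, while x₁ is.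
      -- So the factor σ is the one that `periodic` predicts.
      B-vanishes : ∀ i → i ℕ.< j → B (suc i) ≈ 0#
      B-vanishes i i<j = x≈y⇒x∙y⁻¹≈ε (trans
        (reflexive (≡.cong A (≡.trans (≡.cong (ℕ._+ suc i) (*-^-suc p e k)) (ℕ.+-assoc _ x₁ (suc i)))))
        (periodic k (p ∸ 1) (x₁ ℕ.+ suc i) λ p^k∣ →
          ℕ.>⇒∤ (ℕ.≤-<-trans i<j j<p^k) (ℕ.∣m+n∣m⇒∣n p^k∣ (ℕ.n∣m*n e))))

      rB≈0 : (r ⊛ B) j ≈ 0#
      rB≈0 = begin
        (r ⊛ B) j
          ≈⟨ ⊛-congˡ-≤ r B (drop x₂ A ⊕ (- σ) • drop x₁ A) j (λ i _ → +-congˡ (-‿distribˡ-* _ _)) ⟩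
        (r ⊛ (drop x₂ A ⊕ (- σ) • drop x₁ A)) j
          ≈⟨ S.distribˡ r (drop x₂ A) ((- σ) • drop x₁ A) j ⟩
        (r ⊛ drop x₂ A) j + (r ⊛ ((- σ) • drop x₁ A)) j
          ≈⟨ +-congˡ (trans (⊛-comm r ((- σ) • drop x₁ A) j) (trans (•-⊛ (- σ) (drop x₁ A) r j)
               (*-congˡ (⊛-comm (drop x₁ A) r j)))) ⟩
        (r ⊛ drop x₂ A) j + - σ * (r ⊛ drop x₁ A) j
          ≈⟨ +-cong (⊛-drop j r r-top x₂ A) (*-congˡ (⊛-drop j r r-top x₁ A)) ⟨
        (r ⊛ A) (x₂ ℕ.+ j) + - σ * (r ⊛ A) (x₁ ℕ.+ j)
          ≈⟨ +-cong rA₂≈0 (*-congˡ rA₁≈0) ⟩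
        0# + - σ * 0#  ≈⟨ trans (+-identityˡ _) (zeroʳ _) ⟩
        0# ∎

    module Approximation (k : ℕ) where
      N M : ℕ
      N = p ℕ.^ k
      M = e ℕ.* N

      instance
        N≢0 : ℕ.NonZero N
        N≢0 = ℕ.>-nonZero (ℕ.m^n>0 p k)

      N≤M : N ℕ.≤ M
      N≤M = ℕ.≤-trans (ℕ.≤-reflexive (≡.sym (ℕ.*-identityˡ N))) (ℕ.*-monoˡ-≤ N 1≤e)

      1≤M : 1 ℕ.≤ M
      1≤M = ℕ.≤-trans (ℕ.m^n>0 p k) N≤M

      σ : Carrier
      σ = - τ ^ M

      -- The polynomial 1 - τ^M t^M. The terms of `E` are multiplied by τ^M after M steps, so `U` is
      -- a polynomial and U / w is the rational part of `A`.
      w : Series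
      w = 1ˢ ⊕ σ • shift M 1ˢ

      D E U Y : Series
      D n with N ∣? n
      ... | yes _ = A n
      ... | no  _ = 0#
      E n with N ∣? n
      ... | yes _ = 0#
      ... | no  _ = A n
      U = w ⊛ E
      Y = w ⊛ D

      A≈D⊕E : A ≈ˢ D ⊕ E
      A≈D⊕E n with N ∣? n
      ... | yes _ = sym (+-identityʳ _)
      ... | no  _ = sym (+-identityˡ _)

      wA≈Y⊕U : w ⊛ A ≈ˢ Y ⊕ U
      wA≈Y⊕U n = trans (⊛-congˡ-≤ w A (D ⊕ E) n (λ i _ → A≈D⊕E i)) (S.distribˡ w D E n)

      w⊛ : ∀ f n → (w ⊛ f) n ≈ f n + σ * shift M f n
      w⊛ f n = begin
        (w ⊛ f) n                              ≈⟨ ⊛-distribʳ f 1ˢ (σ • shift M 1ˢ) n ⟩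
        (1ˢ ⊛ f) n + ((σ • shift M 1ˢ) ⊛ f) n  ≈⟨ +-cong (⊛-identityˡ f n) (•-⊛ σ (shift M 1ˢ) f n) ⟩
        f n + σ * (shift M 1ˢ ⊛ f) n           ≈⟨ +-congˡ (*-congˡ (⊛-shift M 1ˢ f n)) ⟩
        f n + σ * shift M (1ˢ ⊛ f) n           ≈⟨ +-congˡ (*-congˡ (shift-cong M (⊛-identityˡ f) n)) ⟩
        f n + σ * shift M f n                  ∎

      w⊛-< : ∀ f n → n ℕ.< M → (w ⊛ f) n ≈ f n
      w⊛-< f n n<M = trans (w⊛ f n) (trans
        (+-congˡ (trans (*-congˡ (reflexive (shift-< M f n n<M))) (zeroʳ σ))) (+-identityʳ _))

      w-polynomial : IsPolynomial w
      w-polynomial = M ℕ.+ 1 , λ n M+1≤n → trans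
        (+-cong (1ˢ≈0 n (ℕ.≤-trans (ℕ.m≤n+m 1 M) M+1≤n))
          (trans (*-congˡ (shift-vanishes M 1 1ˢ 1ˢ≈0 n M+1≤n)) (zeroʳ σ)))
        (+-identityˡ 0#)
        where
        1ˢ≈0 : VanishesFrom 1 1ˢ
        1ˢ≈0 (suc n) _ = 1ˢ-suc n

      w≉0 : ¬ w ≈ˢ 0ˢ
      w≉0 w≈0 = 1≉0 (begin
        1#          ≈⟨ 1ˢ-zero ⟨
        1ˢ 0        ≈⟨ w⊛-< 1ˢ 0 1≤M ⟨
        (w ⊛ 1ˢ) 0  ≈⟨ S.*-identityʳ w 0 ⟩
        w 0         ≈⟨ w≈0 0 ⟩
        0#          ∎)

      E-periodic : ∀ i → E (M ℕ.+ i) ≈ τ ^ M * E i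
      E-periodic i with N ∣? (M ℕ.+ i) | N ∣? i
      ... | yes _     | yes _   = sym (zeroʳ _)
      ... | yes N∣M+i | no  N∤i = contradiction (ℕ.∣m+n∣m⇒∣n N∣M+i (ℕ.n∣m*n e)) N∤i
      ... | no  N∤M+i | yes N∣i = contradiction (ℕ.∣m∣n⇒∣m+n (ℕ.n∣m*n e) N∣i) N∤M+i
      ... | no  _     | no  N∤i = ≡.subst (λ m → A (m ℕ.+ i) ≈ τ ^ m * A i) (ℕ.*-identityˡ M) (periodic k 1 i N∤i)

      U-polynomial : IsPolynomial U
      U-polynomial = M , λ n M≤n → ≡.subst (λ n → U n ≈ 0#) (ℕ.m+[n∸m]≡n M≤n) (begin
        U (M ℕ.+ (n ∸ M))
          ≈⟨ w⊛ E (M ℕ.+ (n ∸ M)) ⟩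
        E (M ℕ.+ (n ∸ M)) + σ * shift M E (M ℕ.+ (n ∸ M))
          ≈⟨ +-cong (E-periodic (n ∸ M)) (*-congˡ (reflexive (shift-+ M E (n ∸ M)))) ⟩
        τ ^ M * E (n ∸ M) + - τ ^ M * E (n ∸ M)
          ≈⟨ solve 2 (λ t x → t :* x :+ (:- t) :* x := con (ℤ.+ 0)) refl (τ ^ M) (E (n ∸ M)) ⟩
        0# ∎)

      -- Below M multiplication by `w` changes nothing, and the only multiple of N below N is 0,
      -- where `A` vanishes.
      U≈A : ∀ n → n ℕ.< N → U n ≈ A n
      U≈A n n<N = trans (w⊛-< E n (ℕ.<-≤-trans n<N N≤M)) (E≈A n n<N)
        where
        E≈A : ∀ n → n ℕ.< N → E n ≈ A n
        E≈A n n<N with N ∣? n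
        ... | no  _ = refl
        E≈A zero    n<N | yes _   = sym A₀≈0
        E≈A (suc n) n<N | yes N∣n = contradiction N∣n (ℕ.>⇒∤ n<N)

      supported-w : SupportedOnMultiples N w
      supported-w n N∤n = trans (+-cong (supported-1ˢ N n N∤n)
        (trans (*-congˡ (supported-shift N M {1ˢ} (ℕ.n∣m*n e) (supported-1ˢ N) n N∤n)) (zeroʳ σ))) (+-identityˡ 0#)

      supported-D : SupportedOnMultiples N D
      supported-D n N∤n with N ∣? n
      ... | yes N∣n = contradiction N∣n N∤n
      ... | no  _   = refl

      supported-Y : SupportedOnMultiples N Y
      supported-Y = supported-⊛ N {w} {D} supported-w supported-D

      -- Since π r = rⱼ tʲ, descent makes κ the product of r and a series in tᴺ, and
      -- modulo tᴺ that series is constant, w is 1 and U is A.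
      κ-vanishes : ∀ d j h r r′ → ¬ r j ≈ 0# → VanishesFrom (suc j) r → VanishesFrom h r′ →
        let open Projection N j in
        π r ⊛ (r′ ⊛ w ⊕ ⊖ (r ⊛ (suc d ·ˢ U))) ≈ˢ r ⊛ π (r′ ⊛ w ⊕ ⊖ (r ⊛ (suc d ·ˢ U))) →
        ∀ l → j ℕ.< l → h ℕ.≤ l → j ℕ.+ l ℕ.< N → (r ⊛ A) l ≈ 0#
      κ-vanishes d j h r r′ rⱼ≉0 r-top r′-top descends l j<l h≤l j+l<N = char-0 d (begin
        suc d · (r ⊛ A) l
          ≈⟨ ×-congʳ (suc d) (⊛-congˡ-≤ r U A l λ i i≤l → U≈A i (ℕ.≤-<-trans i≤l l<N)) ⟨
        suc d · (r ⊛ U) l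
          ≈⟨ ⊛-·ˢ r (suc d) U l ⟨
        (r ⊛ (suc d ·ˢ U)) l
          ≈⟨ +-identityˡ _ ⟨
        0# + (r ⊛ (suc d ·ˢ U)) l
          ≈⟨ +-congʳ κₗ≈0 ⟨
        κ l + (r ⊛ (suc d ·ˢ U)) l
          ≈⟨ solve 2 (λ a b → (a :- b) :+ b := a) refl ((r′ ⊛ w) l) _ ⟩
        (r′ ⊛ w) l
          ≈⟨ ⊛-comm r′ w l ⟩
        (w ⊛ r′) l
          ≈⟨ w⊛-< r′ l (ℕ.<-≤-trans l<N N≤M) ⟩
        r′ l
          ≈⟨ r′-top l h≤l ⟩
        0# ∎)
        where
        open Projection N j
        κ : Series
        κ = r′ ⊛ w ⊕ ⊖ (r ⊛ (suc d ·ˢ U))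

        l<N : l ℕ.< N
        l<N = ℕ.≤-<-trans (ℕ.m≤n+m l j) j+l<N

        j<N : j ℕ.< N
        j<N = ℕ.<-trans j<l l<N

        -- Since `r` has no exponent beyond j and j < N, its only exponent congruent to j is j
        -- itself.
        πr≈ : π r ≈ˢ r j • shift j 1ˢ
        πr≈ n with n ℕ.≟ j
        ... | no n≢j = trans (select-0≢ (n % N ℕ.≟ j)) (sym (trans (*-congˡ (shift-1ˢ-≢ j n n≢j)) (zeroʳ _)))
          where
          select-0≢ : (d : Dec (n % N ≡ j)) → select {n} d (r n) ≈ 0#
          select-0≢ (no _)    = refl
          select-0≢ (yes n≡j) with ℕ.<-≤-connex j n
          ... | inj₁ j<n = r-top n j<n
          ... | inj₂ n≤j = contradiction (≡.trans (≡.sym (ℕ.m<n⇒m%n≡m (ℕ.≤-<-trans n≤j j<N))) n≡j) n≢j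
        ... | yes ≡.refl = trans (select-yes (n % N ℕ.≟ n)) (sym (trans (*-congˡ (shift-1ˢ n)) (*-identityʳ _)))
          where
          select-yes : (d : Dec (n % N ≡ n)) → select {n} d (r n) ≈ r n
          select-yes (yes _)  = refl
          select-yes (no n≢n) = contradiction (ℕ.m<n⇒m%n≡m j<N) n≢n

        πr⊛κ : (π r ⊛ κ) (j ℕ.+ l) ≈ r j * κ l
        πr⊛κ = begin
          (π r ⊛ κ) (j ℕ.+ l)                   ≈⟨ ⊛-congʳ κ πr≈ (j ℕ.+ l) ⟩
          ((r j • shift j 1ˢ) ⊛ κ) (j ℕ.+ l)    ≈⟨ •-⊛ (r j) (shift j 1ˢ) κ (j ℕ.+ l) ⟩
          r j * (shift j 1ˢ ⊛ κ) (j ℕ.+ l)      ≈⟨ *-congˡ (⊛-shift j 1ˢ κ (j ℕ.+ l)) ⟩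
          r j * shift j (1ˢ ⊛ κ) (j ℕ.+ l)      ≈⟨ *-congˡ (reflexive (shift-+ j (1ˢ ⊛ κ) l)) ⟩
          r j * (1ˢ ⊛ κ) l                      ≈⟨ *-congˡ (⊛-identityˡ κ l) ⟩
          r j * κ l                             ∎

        -- Only i ≤ j contributes, and then j < l ≤ j + l - i < N, so the exponent j + l - i is not
        -- congruent to j modulo N.
        r⊛πκ : (r ⊛ π κ) (j ℕ.+ l) ≈ 0#
        r⊛πκ = ⊛-zero-terms r (π κ) (j ℕ.+ l) term
          where
          term : ∀ i → i ℕ.≤ j ℕ.+ l → r i * π κ (j ℕ.+ l ∸ i) ≈ 0#
          term i _ with ℕ.<-≤-connex j i
          ... | inj₁ j<i = trans (*-congʳ (r-top i j<i)) (zeroˡ _)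
          ... | inj₂ i≤j = trans (*-congˡ (outside (j ℕ.+ l ∸ i)
              (ℕ.<-≤-trans j<l (ℕ.≤-trans (ℕ.m≤n+m l (j ∸ i)) (ℕ.≤-reflexive (≡.sym (ℕ.+-∸-comm l i≤j)))))
              (ℕ.≤-<-trans (ℕ.m∸n≤m _ i) j+l<N))) (zeroʳ _)
            where
            outside : ∀ n → j ℕ.< n → n ℕ.< N → π κ n ≈ 0#
            outside n j<n n<N with n % N ℕ.≟ j
            ... | no  _   = refl
            ... | yes n≡j = contradiction (≡.trans (≡.sym n≡j) (ℕ.m<n⇒m%n≡m n<N)) (ℕ.<⇒≢ j<n)

        κₗ≈0 : κ l ≈ 0#
        κₗ≈0 = domain (trans (sym πr⊛κ) (trans (descends (j ℕ.+ l)) r⊛πκ)) rⱼ≉0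

    -- Induction on the degree stands in for the choice of a relation of least degree: the case d
    -- supplies the minimality that the descent for d + 1 uses.
    no-relation : ∀ d → ¬ Relation A d
    no-relation zero (r , _ , r≉0 , nil r≈0) = r≉0 λ n → trans (sym (S.*-identityʳ r n)) (r≈0 n)
    no-relation (suc d) (r , (b , r-vanishes) , r≉0 , snoc {r = r′} {g′} (h , r′-top) g′∈ eq)
      with leadingIndex r b r-vanishes
    ... | inj₁ r≈0 = r≉0 r≈0
    ... | inj₂ (j , rⱼ≉0 , r-top) = window j K r (ℕ.≤-<-trans (ℕ.m≤m+n j h) (n<p^n K)) rⱼ≉0 r-top
        (vanishes (e ℕ.* p ℕ.^ K) big small) (vanishes (e ℕ.* p ℕ.^ suc K) big′ ℕ.≤-refl)
      where
      -- `K` bounds the degrees of `r` and `r′` and is less than e p^K, so both windows start beyond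
      -- these degrees. `k` is such that N = p^k > k = j + (x₂ + j), the largest value of j + l that
      -- `κ-vanishes` meets.
      K = j ℕ.+ h
      x₂ = e ℕ.* p ℕ.^ suc K
      k = j ℕ.+ (x₂ ℕ.+ j)
      open Approximation k

      p^K≤ : p ℕ.^ K ℕ.≤ e ℕ.* p ℕ.^ K
      p^K≤ = ℕ.≤-trans (ℕ.≤-reflexive (≡.sym (ℕ.*-identityˡ _))) (ℕ.*-monoˡ-≤ (p ℕ.^ K) 1≤e)

      big : K ℕ.< e ℕ.* p ℕ.^ K
      big = ℕ.<-≤-trans (n<p^n K) p^K≤

      small : e ℕ.* p ℕ.^ K ℕ.≤ x₂
      small = ℕ.*-monoʳ-≤ e (ℕ.m≤n*m (p ℕ.^ K) p)

      big′ : K ℕ.< x₂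
      big′ = ℕ.<-≤-trans big small

      open Projection N j

      vanishes : ∀ x → K ℕ.< x → x ℕ.≤ x₂ → (r ⊛ A) (x ℕ.+ j) ≈ 0#
      vanishes x K<x x≤x₂ = κ-vanishes d j h r r′ rⱼ≉0 r-top r′-top
        (Descent.descent {X = A} {k = d} (no-relation d) polynomial-zero?
          {r} {r′} {g′} (b , r-vanishes) (h , r′-top) g′∈ eq
          {w} {U} {Y} w-polynomial U-polynomial wA≈Y⊕U
          (λ {x} wx≈0 → ⊛-domain {w} {x} wx≈0 w≉0)
          π (λ x≈y n → select-cong (n % N ℕ.≟ j) (x≈y n))
          (λ x y n → select-+ (n % N ℕ.≟ j) (x n) (y n))
          (λ n → select-0 (n % N ℕ.≟ j) refl)
          π-closed
          (λ x i → π-linear x (Y ^ˢ i) (supported-^ N i supported-Y)))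
        (x ℕ.+ j)
        (ℕ.≤-<-trans (ℕ.m≤m+n j h) (ℕ.<-≤-trans K<x (ℕ.m≤m+n x j)))
        (ℕ.≤-trans (ℕ.m≤n+m h j) (ℕ.≤-trans (ℕ.<⇒≤ K<x) (ℕ.m≤m+n x j)))
        (ℕ.≤-<-trans (ℕ.+-monoʳ-≤ j (ℕ.+-monoˡ-≤ j x≤x₂)) (n<p^n k))

    transcendental : ¬ Algebraic S.rawRing IsPolynomial A
    transcendental A-algebraic = no-relation _ (proj₂ (algebraic⇒relation polynomial-zero? A-algebraic))

-- The differential equation of the exponential series

module Derivation (S : CommutativeRing c ℓ)
  (θ : CommutativeRing.Carrier S → CommutativeRing.Carrier S)
  (θ-cong : ∀ {x y} → CommutativeRing._≈_ S x y → CommutativeRing._≈_ S (θ x) (θ y))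
  (θ-* : ∀ x y → CommutativeRing._≈_ S (θ (CommutativeRing._*_ S x y))
    (CommutativeRing._+_ S (CommutativeRing._*_ S (θ x) y) (CommutativeRing._*_ S x (θ y)))) where
  open CommutativeRing S hiding (zero)
  open SemiringExp semiring using (_^_)
  open SemiringMult semiring using (×-comm-*; ×-congʳ) renaming (_×_ to _·_)
  open SetoidReasoning setoid
  open IntegerCoefficients S

  θ-^ : ∀ x k → θ (x ^ suc k) ≈ suc k · (θ x * x ^ k)
  θ-^ x zero = begin
    θ (x * 1#)       ≈⟨ θ-cong (*-identityʳ x) ⟩
    θ x              ≈⟨ *-identityʳ _ ⟨
    θ x * 1#         ≈⟨ +-identityʳ _ ⟨
    θ x * 1# + 0#    ∎
  θ-^ x (suc k) = begin
    θ (x * x ^ suc k)                                  ≈⟨ θ-* x (x ^ suc k) ⟩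
    θ x * x ^ suc k + x * θ (x ^ suc k)                ≈⟨ +-congˡ (*-congˡ (θ-^ x k)) ⟩
    θ x * x ^ suc k + x * (suc k · (θ x * x ^ k))      ≈⟨ +-congˡ (×-comm-* (suc k) x _) ⟩
    θ x * x ^ suc k + suc k · (x * (θ x * x ^ k))
      ≈⟨ +-congˡ (×-congʳ (suc k) (solve 3 (λ x t y → x :* (t :* y) := t :* (x :* y)) refl x (θ x) (x ^ k))) ⟩
    suc (suc k) · (θ x * x ^ suc k)                    ∎

module Exponential (R : DiscreteDomain c ℓ)
  (1ˢ : ℕ → DiscreteDomain.Carrier R)
  (1ˢ-zero : DiscreteDomain._≈_ R (1ˢ 0) (DiscreteDomain.1# R))
  (1ˢ-suc : ∀ n → DiscreteDomain._≈_ R (1ˢ (suc n)) (DiscreteDomain.0# R)) where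
  open DiscreteDomain R hiding (zero)
  open PowerSeriesRing commutativeRing 1ˢ 1ˢ-zero 1ˢ-suc
  open PolynomialSeries R 1ˢ 1ˢ-zero 1ˢ-suc
  open SemiringMult semiring using (×-congʳ; ×-comm-*; ×-assoc-*) renaming (_×_ to _·_)
  open SemiringSum semiring using (sum; sum⁺-syntax; sum-init-last; sum-cong-≋)
  open SetoidReasoning setoid
  open IntegerCoefficients commutativeRing
  module S = CommutativeRing seriesRing
  open SemiringExp S.semiring using () renaming (_^_ to _^ˢ_)

  θ-^ˢ : ∀ f k n → θ (f ^ˢ suc k) n ≈ suc k · (θ f ⊛ f ^ˢ k) n
  θ-^ˢ f k n = trans
    (Derivation.θ-^ seriesRing θ (λ f≈g n → ×-congʳ n (f≈g n)) θ-⊛ f k n)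
    (·ˢ-coefficient (suc k) (θ f ⊛ f ^ˢ k) n)

  ^ˢ-vanishes-< : ∀ f → f 0 ≈ 0# → ∀ k n → n ℕ.< k → (f ^ˢ k) n ≈ 0#
  ^ˢ-vanishes-< f f₀≈0 (suc k) n (s≤s n≤k) = ⊛-zero-terms f (f ^ˢ k) n term
    where
    term : ∀ i → i ℕ.≤ n → f i * (f ^ˢ k) (n ∸ i) ≈ 0#
    term zero    _    = trans (*-congʳ f₀≈0) (zeroˡ _)
    term (suc i) i<n = trans (*-congˡ (^ˢ-vanishes-< f f₀≈0 k (n ∸ suc i)
      (ℕ.<-≤-trans (ℕ.∸-monoʳ-< (s≤s z≤n) i<n) n≤k))) (zeroʳ _)

  -- `ι` is the sequence of inverse factorials; its recursion is all that the differential equation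
  -- needs.
  module _ (ι : ℕ → Carrier) (ι-zero : ι 0 ≈ 1#) (ι-suc : ∀ k → suc k · ι (suc k) ≈ ι k)
           (f : Series) (f₀≈0 : f 0 ≈ 0#) where

    -- The number of summands of `expˢ n` grows with n, which obstructs working termwise with
    -- series. Here the number of terms is fixed and n is free.
    partial : ℕ → Series
    partial zero    n = 0#
    partial (suc m) n = partial m n + ι m * (f ^ˢ m) n

    expˢ : Series
    expˢ n = ∑[ k ≤ n ] (ι (toℕ k) * (f ^ˢ toℕ k) n)

    sum≈partial : ∀ m n → sum {m} (λ k → ι (toℕ k) * (f ^ˢ toℕ k) n) ≈ partial m n
    sum≈partial zero    n = refl
    sum≈partial (suc m) n = begin
      sum {suc m} t                    ≈⟨ sum-init-last {m} t ⟩
      sum {m} (Vector.init t) + t (Fin.fromℕ m)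
        ≈⟨ +-cong (trans (sum-cong-≋ {m} (λ i → reflexive (≡.cong (λ k → ι k * (f ^ˢ k) n) (Fin.toℕ-inject₁ i))))
                    (sum≈partial m n))
             (reflexive (≡.cong (λ k → ι k * (f ^ˢ k) n) (Fin.toℕ-fromℕ m))) ⟩
      partial m n + ι m * (f ^ˢ m) n   ∎
      where
      t : Fin (suc m) → Carrier
      t k = ι (toℕ k) * (f ^ˢ toℕ k) n

    partial-stable : ∀ d n → partial (d ℕ.+ suc n) n ≈ expˢ n
    partial-stable zero    n = sym (sum≈partial (suc n) n)
    partial-stable (suc d) n = begin
      partial (d ℕ.+ suc n) n + ι (d ℕ.+ suc n) * (f ^ˢ (d ℕ.+ suc n)) n
        ≈⟨ +-cong (partial-stable d n)
             (trans (*-congˡ (^ˢ-vanishes-< f f₀≈0 (d ℕ.+ suc n) n (ℕ.m≤n+m (suc n) d))) (zeroʳ _)) ⟩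
      expˢ n + 0# ≈⟨ +-identityʳ _ ⟩
      expˢ n      ∎

    -- θ sends f^(m+1) / (m+1)! to θf times f^m / m!, so it only shifts the summation by one.
    θ-partial : ∀ m n → θ (partial (suc m)) n ≈ (θ f ⊛ partial m) n
    θ-partial zero n = trans (vanish n) (sym (⊛-zeroʳ-≤ (θ f) 0ˢ n λ _ _ → refl))
      where
      open TrivialPowers semiring using (·-zeroʳ)
      vanish : ∀ n → n · (0# + ι 0 * 1ˢ n) ≈ 0#
      vanish zero    = refl
      vanish (suc n) = trans (×-congʳ (suc n) (trans (+-identityˡ _) (trans (*-congˡ (1ˢ-suc n)) (zeroʳ _))))
                         (·-zeroʳ (suc n))
    θ-partial (suc m) n = begin
      n · (partial (suc m) n + ι (suc m) * (f ^ˢ suc m) n)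
        ≈⟨ ×-distrib-+ _ _ n ⟩
      n · partial (suc m) n + n · (ι (suc m) * (f ^ˢ suc m) n)
        ≈⟨ +-cong (θ-partial m n) (sym (×-comm-* n _ _)) ⟩
      (θ f ⊛ partial m) n + ι (suc m) * θ (f ^ˢ suc m) n
        ≈⟨ +-congˡ (*-congˡ (θ-^ˢ f m n)) ⟩
      (θ f ⊛ partial m) n + ι (suc m) * (suc m · (θ f ⊛ f ^ˢ m) n)
        ≈⟨ +-congˡ (trans (×-comm-* (suc m) _ _) (trans (sym (×-assoc-* (suc m) _ _)) (*-congʳ (ι-suc m)))) ⟩
      (θ f ⊛ partial m) n + ι m * (θ f ⊛ f ^ˢ m) n
        ≈⟨ +-congˡ (trans (*-congˡ (⊛-comm (θ f) (f ^ˢ m) n))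
             (trans (sym (•-⊛ (ι m) (f ^ˢ m) (θ f) n)) (⊛-comm (ι m • (f ^ˢ m)) (θ f) n))) ⟩
      (θ f ⊛ partial m) n + (θ f ⊛ (ι m • (f ^ˢ m))) n
        ≈⟨ S.distribˡ (θ f) (partial m) (ι m • (f ^ˢ m)) n ⟨
      (θ f ⊛ partial (suc m)) n ∎
      where
      open CommutativeMult +-commutativeMonoid using (×-distrib-+)

    θ-exp : θ expˢ ≈ˢ θ f ⊛ expˢ
    θ-exp n = begin
      -- One term beyond the n + 1 relevant ones is included, because `θ-partial` loses one.
      n · expˢ n                      ≈⟨ ×-congʳ n (partial-stable 1 n) ⟨
      n · partial (suc (suc n)) n     ≈⟨ θ-partial (suc n) n ⟩
      (θ f ⊛ partial (suc n)) n
        ≈⟨ ⊛-congˡ-≤ (θ f) (partial (suc n)) expˢ n (λ i i≤n →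
             trans (reflexive (≡.cong (λ m → partial m i) (≡.trans (≡.cong suc (≡.sym (ℕ.m∸n+n≡m i≤n))) (≡.sym (ℕ.+-suc (n ∸ i) i)))))
               (partial-stable (n ∸ i) i)) ⟩
      (θ f ⊛ expˢ) n                  ∎

    exp₀ : expˢ 0 ≈ 1#
    exp₀ = trans (+-identityʳ _) (trans (*-cong ι-zero 1ˢ-zero) (*-identityˡ 1#))

-- Counting by duplicate-free lists

module Cardinality (A : Setoid c ℓ) where
  open Setoid A
  open SetoidMembership A using () renaming (_∈_ to _∈ₗ_)
  open SetoidPermutation A using (_↭_; ↭-refl; ↭-trans; ↭-sym; ↭-reflexive-≋; ↭-prep; prep)
  open SetoidUnique A using (Unique)

  -- The first element of `xs` is found in `ys` and moved to the front. The remaining ones differ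
  -- from it, so they are still found in the rest of `ys`.
  Unique⊆⇒↭ : ∀ {xs} ys → Unique xs → (∀ {x} → x ∈ₗ xs → x ∈ₗ ys) → ∃[ zs ] ys ↭ xs ++ zs
  Unique⊆⇒↭ {[]}     ys _ _ = ys , ↭-refl
  Unique⊆⇒↭ {x ∷ xs} ys (x∉xs ∷ xs!) xs⊆ys
    with as , bs , w , x≈w , eq ← Membership.∈-∃++ A (xs⊆ys (here refl)) =
    let ys↭ : ys ↭ x ∷ (as ++ bs)
        ys↭ = ↭-trans (↭-reflexive-≋ eq) (Permutation.shift A (sym x≈w) as bs)
        zs , rest = Unique⊆⇒↭ (as ++ bs) xs! (λ {y} y∈xs →
          other y∈xs (Permutation.∈-resp-↭ A ys↭ (xs⊆ys (there y∈xs))))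
    in zs , ↭-trans ys↭ (↭-prep x rest)
    where
    other : ∀ {y zs} → y ∈ₗ xs → y ∈ₗ (x ∷ zs) → y ∈ₗ zs
    other y∈xs (here y≈x)  = contradiction y∈xs
      (λ y∈xs → All.lookupWith (λ x≉z y≈z → x≉z (trans (sym y≈x) y≈z)) x∉xs y∈xs)
    other y∈xs (there y∈zs) = y∈zs

  Unique⊆⇒≤ : ∀ {xs ys} → Unique xs → (∀ {x} → x ∈ₗ xs → x ∈ₗ ys) → length xs ℕ.≤ length ys
  Unique⊆⇒≤ {xs} {ys} xs! xs⊆ys with zs , ys↭ ← Unique⊆⇒↭ ys xs! xs⊆ys =
    ℕ.≤-trans (ℕ.m≤m+n _ (length zs)) (ℕ.≤-reflexive (≡.sym
      (≡.trans (Permutation.xs↭ys⇒|xs|≡|ys| A ys↭) (List.length-++ xs))))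

  Unique⊆-length⇒↭ : ∀ {xs ys} → Unique xs → (∀ {x} → x ∈ₗ xs → x ∈ₗ ys) →
                     length xs ≡ length ys → ys ↭ xs
  Unique⊆-length⇒↭ {xs} {ys} xs! xs⊆ys len with Unique⊆⇒↭ ys xs! xs⊆ys
  ... | []     , ys↭ = ↭-trans ys↭ (Permutation.++-identityʳ A xs)
  ... | z ∷ zs , ys↭ = contradiction
    (≡.trans len (≡.trans (Permutation.xs↭ys⇒|xs|≡|ys| A ys↭) (List.length-++ xs))) (ℕ.m≢1+m+n _ ∘ λ eq → ≡.trans eq (ℕ.+-suc _ _))

  cardinality-≤ : ∀ {P : Pred Carrier s} {Q : Pred Carrier s′} {m n} → (∀ {x y} → x ≈ y → P x → P y) →
    (∀ {x} → P x → Q x) → HasCardinality A P m → HasCardinality A Q n → m ℕ.≤ n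
  cardinality-≤ P-resp P⇒Q P-card Q-card = ≡.subst₂ ℕ._≤_ (HasCardinality.size P-card) (HasCardinality.size Q-card)
    (Unique⊆⇒≤ (HasCardinality.unique P-card) λ x∈ → HasCardinality.complete Q-card
      (P⇒Q (All.lookupWith (λ Py x≈y → P-resp (sym x≈y) Py) (HasCardinality.sound P-card) x∈)))

  cardinality-unique : ∀ {P : Pred Carrier s} {Q : Pred Carrier s′} {m n} →
    (∀ {x y} → x ≈ y → P x → P y) → (∀ {x y} → x ≈ y → Q x → Q y) →
    (∀ {x} → P x → Q x) → (∀ {x} → Q x → P x) → HasCardinality A P m → HasCardinality A Q n → m ≡ n
  cardinality-unique P-resp Q-resp P⇒Q Q⇒P P-card Q-card =
    ℕ.≤-antisym (cardinality-≤ P-resp P⇒Q P-card Q-card) (cardinality-≤ Q-resp Q⇒P Q-card P-card)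

  cardinality-⇔ : ∀ {P : Pred Carrier s} {Q : Pred Carrier s′} {n} →
    (∀ {x} → P x → Q x) → (∀ {x} → Q x → P x) → HasCardinality A P n → HasCardinality A Q n
  cardinality-⇔ P⇒Q Q⇒P P-card = record
    { elements = elements ; unique = unique ; sound = All.map P⇒Q sound
    ; complete = λ Qx → complete (Q⇒P Qx) ; size = size }
    where open HasCardinality P-card

-- Binomial coefficients modulo p and the Frobenius map

m∣m^n : ∀ {m n} → 1 ≤ n → m ∣ m ℕ.^ n
m∣m^n {m} {suc n} _ = ℕ.m∣m*n (m ℕ.^ n)

prime∣n!⇒p≤n : ∀ {p} → Prime p → ∀ n → p ∣ n ! → p ℕ.≤ n
prime∣n!⇒p≤n p-prime zero    p∣1 = contradiction (ℕ.∣1⇒≡1 p∣1) (ℕ.nonTrivial⇒≢1 {{prime⇒nonTrivial p-prime}})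
prime∣n!⇒p≤n p-prime (suc n) p∣n! with euclidsLemma (suc n) (n !) p-prime p∣n!
... | inj₁ p∣1+n = ℕ.∣⇒≤ p∣1+n
... | inj₂ p∣n!′ = ℕ.m≤n⇒m≤1+n (prime∣n!⇒p≤n p-prime n p∣n!′)

-- p divides p! = (p C k) k! (p - k)! but neither of the two factorials, whose factors are all
-- smaller than p.
prime∣pCk : ∀ {p k} → Prime p → 0 ℕ.< k → k ℕ.< p → p ∣ p C k
prime∣pCk {suc p} {suc k} p-prime _ k<p with euclidsLemma (suc p C suc k) (suc k ! ℕ.* (p ∸ k) !) p-prime
    (≡.subst (suc p ∣_) (≡.sym nCk*k!*[n-k]!≡n!) (ℕ.m∣m*n (p !)))
  where
  instance k!≢0 = ℕ._!*_!≢0 (suc k) (p ∸ k)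
  nCk*k!*[n-k]!≡n! : (suc p C suc k) ℕ.* (suc k ! ℕ.* (p ∸ k) !) ≡ suc p !
  nCk*k!*[n-k]!≡n! = ≡.trans (≡.cong (ℕ._* (suc k ! ℕ.* (p ∸ k) !)) (nCk≡n!/k![n-k]! (ℕ.<⇒≤ k<p)))
    (ℕ.m/n*n≡m (k![n∸k]!∣n! (ℕ.<⇒≤ k<p)))
... | inj₁ p∣C = p∣C
... | inj₂ p∣  with euclidsLemma (suc k !) ((p ∸ k) !) p-prime p∣
...   | inj₁ p∣k! = contradiction (prime∣n!⇒p≤n p-prime (suc k) p∣k!) (ℕ.<⇒≱ k<p)
...   | inj₂ p∣[p-k]! = contradiction (prime∣n!⇒p≤n p-prime (p ∸ k) p∣[p-k]!) (ℕ.<⇒≱ (s≤s (ℕ.m∸n≤m p k)))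

module Frobenius (R : CommutativeRing c ℓ) {p : ℕ} (p-prime : Prime p)
  (characteristic : CommutativeRing._≈_ R
    (SemiringMult._×_ (CommutativeRing.semiring R) p (CommutativeRing.1# R)) (CommutativeRing.0# R)) where
  open CommutativeRing R hiding (zero)
  open SemiringMult semiring using (×-assoc-*; ×-congʳ; ×1-homo-*; ×-homo-1) renaming (_×_ to _·_)
  open SemiringExp semiring using (_^_; ^-congˡ; ^-assocʳ)
  open SemiringSum semiring using (sum; sum-init-last; sum-cong-≋; sum-replicate-zero)
  open RingProperties ring
  open SetoidReasoning setoid

  ∣⇒·≈0 : ∀ {n} → p ∣ n → ∀ x → n · x ≈ 0#
  ∣⇒·≈0 {n} (divides m ≡.refl) x = begin
    (m ℕ.* p) · x                ≈⟨ ×-congʳ (m ℕ.* p) (*-identityˡ x) ⟨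
    (m ℕ.* p) · (1# * x)         ≈⟨ ×-assoc-* (m ℕ.* p) 1# x ⟨
    ((m ℕ.* p) · 1#) * x         ≈⟨ *-congʳ (×1-homo-* m p) ⟩
    (m · 1#) * (p · 1#) * x      ≈⟨ *-congʳ (trans (*-congˡ characteristic) (zeroʳ _)) ⟩
    0# * x                       ≈⟨ zeroˡ x ⟩
    0#                           ∎

  frobenius-+ : ∀ x y → (x + y) ^ p ≈ x ^ p + y ^ p
  frobenius-+ x y = go p ≡.refl
    where
    open Binomial commutativeSemiring using (theorem; binomialTerm)
    go : ∀ n → n ≡ p → (x + y) ^ n ≈ x ^ n + y ^ n
    go zero    0≡p = contradiction 0≡p (λ 0≡p → ℕ.≢-nonZero⁻¹ p {{prime⇒nonZero p-prime}} (≡.sym 0≡p))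
    go (suc n) ≡.refl = begin
      (x + y) ^ suc n
        ≈⟨ theorem (suc n) x y ⟩
      T zero + sum {suc n} (T ∘ suc)
        ≈⟨ +-cong (trans (+-identityʳ _) (*-identityˡ _)) (sum-init-last {n} (T ∘ suc)) ⟩
      y ^ suc n + (sum {n} (Vector.init (T ∘ suc)) + T (suc (Fin.fromℕ n)))
        ≈⟨ +-congˡ (+-cong (trans (sum-cong-≋ {n} middle) (sum-replicate-zero n)) last≈) ⟩
      y ^ suc n + (0# + x ^ suc n)
        ≈⟨ trans (+-congˡ (+-identityˡ _)) (+-comm _ _) ⟩
      x ^ suc n + y ^ suc n ∎
      where
      T : Fin (suc (suc n)) → Carrier
      T = binomialTerm x y (suc n)
      middle : ∀ i → T (suc (Fin.inject₁ i)) ≈ 0#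
      middle i = ∣⇒·≈0 (prime∣pCk p-prime (s≤s z≤n)
        (s≤s (≡.subst (ℕ._< n) (≡.sym (Fin.toℕ-inject₁ i)) (Fin.toℕ<n i)))) _
      last≈ : T (suc (Fin.fromℕ n)) ≈ x ^ suc n
      last≈ = begin
        (suc n C suc (toℕ (Fin.fromℕ n))) · (x ^ suc (toℕ (Fin.fromℕ n)) * y ^ (n ∸ toℕ (Fin.fromℕ n)))
          ≡⟨ ≡.cong (λ m → (suc n C suc m) · (x ^ suc m * y ^ (n ∸ m))) (Fin.toℕ-fromℕ n) ⟩
        (suc n C suc n) · (x ^ suc n * y ^ (n ∸ n))
          ≡⟨ ≡.cong₂ (λ m d → m · (x ^ suc n * y ^ d)) (ℕ.nCn≡1 (suc n)) (ℕ.n∸n≡0 n) ⟩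
        1 · (x ^ suc n * 1#)   ≈⟨ ×-homo-1 _ ⟩
        x ^ suc n * 1#         ≈⟨ *-identityʳ _ ⟩
        x ^ suc n              ∎

  frobenius-^-+ : ∀ k x y → (x + y) ^ (p ℕ.^ k) ≈ x ^ (p ℕ.^ k) + y ^ (p ℕ.^ k)
  frobenius-^-+ zero    x y = trans (*-identityʳ _) (+-cong (sym (*-identityʳ x)) (sym (*-identityʳ y)))
  frobenius-^-+ (suc k) x y = begin
    (x + y) ^ (p ℕ.* p ℕ.^ k)                    ≈⟨ ^-assocʳ (x + y) p (p ℕ.^ k) ⟨
    ((x + y) ^ p) ^ (p ℕ.^ k)                    ≈⟨ ^-congˡ (p ℕ.^ k) (frobenius-+ x y) ⟩
    (x ^ p + y ^ p) ^ (p ℕ.^ k)                  ≈⟨ frobenius-^-+ k (x ^ p) (y ^ p) ⟩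
    (x ^ p) ^ (p ℕ.^ k) + (y ^ p) ^ (p ℕ.^ k)    ≈⟨ +-cong (^-assocʳ x p (p ℕ.^ k)) (^-assocʳ y p (p ℕ.^ k)) ⟩
    x ^ (p ℕ.* p ℕ.^ k) + y ^ (p ℕ.* p ℕ.^ k)    ∎

-- Fields and the orders of elements of a finite subfield

module FieldTheory (K : DiscreteField c ℓ) where
  open DiscreteField K hiding (zero; _^_; _·_)
  open SemiringExp semiring using (_^_)
  open RingProperties ring
  open SetoidReasoning setoid
  open IntegerCoefficients commutativeRing
  open SetoidMembership setoid using () renaming (_∈_ to _∈ₗ_)
  open SetoidUnique setoid using (Unique)
  open SetoidPermutation setoid using (_↭_; ↭-sym)

  1≉0 : ¬ 1# ≈ 0#
  1≉0 1≈0 = 0≉1 (sym 1≈0)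

  domain : ∀ {x y} → x * y ≈ 0# → ¬ x ≈ 0# → y ≈ 0#
  domain {x} {y} xy≈0 x≉0 with z , xz≈1 ← inverse x≉0 = begin
    y              ≈⟨ *-identityˡ y ⟨
    1# * y         ≈⟨ *-congʳ xz≈1 ⟨
    (x * z) * y    ≈⟨ solve 3 (λ x y z → x :* z :* y := z :* (x :* y)) refl x y z ⟩
    z * (x * y)    ≈⟨ *-congˡ xy≈0 ⟩
    z * 0#         ≈⟨ zeroʳ z ⟩
    0#             ∎

  discreteDomain : DiscreteDomain c ℓ
  discreteDomain = record { commutativeRing = commutativeRing ; 1≉0 = 1≉0 ; domain = domain ; _≟_ = _≟_ }

  *-cancelˡ-nonzero : ∀ {x y z} → ¬ x ≈ 0# → x * y ≈ x * z → y ≈ z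
  *-cancelˡ-nonzero {x} {y} {z} x≉0 eq = x∙y⁻¹≈ε⇒x≈y y z (domain (begin
    x * (y - z)     ≈⟨ solve 3 (λ x y z → x :* (y :- z) := x :* y :- x :* z) refl x y z ⟩
    x * y - x * z   ≈⟨ x≈y⇒x∙y⁻¹≈ε eq ⟩
    0#              ∎) x≉0)

  ^-zero⇒zero : ∀ {x} n → x ^ n ≈ 0# → x ≈ 0#
  ^-zero⇒zero {x} n xⁿ≈0 with x ≟ 0#
  ... | yes x≈0 = x≈0
  ^-zero⇒zero zero    xⁿ≈0 | no x≉0 = contradiction xⁿ≈0 1≉0
  ^-zero⇒zero (suc n) xⁿ≈0 | no x≉0 = ^-zero⇒zero n (domain xⁿ≈0 x≉0)

  -- Multiplication by a permutes the nonzero elements of F.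
  fermat : ∀ {F : Pred Carrier s} {q} → IsSubfield K F → HasCardinality setoid F q →
           ∀ {a} → a ∈ F → ¬ a ≈ 0# → ∃[ e ] q ≡ suc e × a ^ e ≈ 1#
  fermat {F = F} {q} F-subfield F-card {a} a∈F a≉0
    -- Splitting 0 off the enumeration of F leaves the list `zs` of its nonzero elements; its length
    -- q - 1 is the exponent.
    with zs , elements↭ ← Cardinality.Unique⊆⇒↭ setoid {0# ∷ []} (HasCardinality.elements F-card) ([] ∷ [])
           (λ { (here x≈0) → HasCardinality.complete F-card
             (IsSubfield.respects F-subfield (sym x≈0) (IsSubfield.0#-closed F-subfield)) }) =
    length zs , ≡.trans (≡.sym size) (Permutation.xs↭ys⇒|xs|≡|ys| setoid elements↭) ,
    *-cancelˡ-nonzero (product≉0 zs zs≉0) (begin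
      product zs * a ^ length zs  ≈⟨ *-comm _ _ ⟩
      a ^ length zs * product zs  ≈⟨ product-map zs ⟨
      product (List.map (a *_) zs)
        ≈⟨ Permutation.foldr-commMonoid setoid *-isCommutativeMonoid permuted ⟨
      product zs                  ≈⟨ *-identityʳ _ ⟨
      product zs * 1#             ∎)
    where
    open HasCardinality F-card
    open IsSubfield F-subfield

    product : List Carrier → Carrier
    product = List.foldr _*_ 1#

    product-map : ∀ xs → product (List.map (a *_) xs) ≈ a ^ length xs * product xs
    product-map []       = sym (*-identityʳ 1#)
    product-map (x ∷ xs) = trans (*-congˡ (product-map xs))
      (solve 4 (λ a x b y → a :* x :* (b :* y) := a :* b :* (x :* y)) refl a x (a ^ length xs) (product xs))

    product≉0 : ∀ xs → (∀ {x} → x ∈ₗ xs → ¬ x ≈ 0#) → ¬ product xs ≈ 0#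
    product≉0 []       _     eq = 1≉0 eq
    product≉0 (x ∷ xs) xs≉0 eq = product≉0 xs (xs≉0 ∘ there) (domain eq (xs≉0 (here refl)))

    0∷zs! : Unique (0# ∷ zs)
    0∷zs! = Permutation.Unique-resp-↭ setoid elements↭ unique

    zs≉0 : ∀ {x} → x ∈ₗ zs → ¬ x ≈ 0#
    zs≉0 x∈zs x≈0 = All.lookupWith (λ 0≉y x≈y → 0≉y (trans (sym x≈0) x≈y)) (AllPairs.head 0∷zs!) x∈zs

    zs∈F : ∀ {x} → x ∈ₗ zs → F x
    zs∈F x∈zs = All.lookupWith (λ Fy x≈y → respects (sym x≈y) Fy) sound
      (Permutation.∈-resp-↭ setoid (↭-sym elements↭) (there x∈zs))

    F⇒zs : ∀ {x} → F x → ¬ x ≈ 0# → x ∈ₗ zs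
    F⇒zs x∈F x≉0 with Permutation.∈-resp-↭ setoid elements↭ (complete x∈F)
    ... | here x≈0   = contradiction x≈0 x≉0
    ... | there x∈zs = x∈zs

    permuted : zs ↭ List.map (a *_) zs
    permuted = Cardinality.Unique⊆-length⇒↭ setoid
      (Unique.map⁺ setoid setoid (*-cancelˡ-nonzero a≉0) (AllPairs.tail 0∷zs!))
      image (List.length-map (a *_) zs)
      where
      image : ∀ {x} → x ∈ₗ List.map (a *_) zs → x ∈ₗ zs
      image x∈ with y , y∈zs , x≈ay ← Membership.∈-map⁻ setoid setoid x∈ =
        F⇒zs (respects (sym x≈ay) (*-closed a∈F (zs∈F y∈zs)))
          (λ x≈0 → zs≉0 y∈zs (domain (trans (sym x≈ay) x≈0) a≉0))

-- Root counts of separable and of additive polynomials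

module SeparablePolynomials (K : DiscreteField c ℓ) where
  open DiscreteField K hiding (zero; _^_; _·_)
  open TrivialPowers semiring using (0^)
  open FieldTheory K
  open SemiringMult semiring using (×1-homo-*) renaming (_×_ to _·_)
  open SemiringExp semiring using (_^_; ^-congˡ; ^-assocʳ)
  open RingProperties ring
  open SetoidReasoning setoid
  open IntegerCoefficients commutativeRing
  open SetoidMembership setoid using () renaming (_∈_ to _∈ₗ_)

  ev : List Carrier → Carrier → Carrier
  ev = evaluate rawRing

  -- The value at x of the formal derivative, by the product rule for k + x g(x); a coefficient list
  -- of the derivative is never formed.
  derivative : List Carrier → Carrier → Carrier
  derivative []       x = 0#
  derivative (k ∷ ks) x = ev ks x + x * derivative ks x

  -- Synthetic division by x - r. Dividend and quotient share the leading coefficient k, so only the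
  -- lower coefficients are listed; those of the quotient are the Horner values of the dividend at
  -- r.
  quotient : Carrier → Carrier → List Carrier → List Carrier
  quotient r k []            = []
  quotient r k (l ∷ [])      = []
  quotient r k (l ∷ m ∷ ks) = ev ((m ∷ ks) ++ [ k ]) r ∷ quotient r k (m ∷ ks)

  quotient-length : ∀ r k l ks → length (quotient r k (l ∷ ks)) ≡ length ks
  quotient-length r k l []       = ≡.refl
  quotient-length r k l (m ∷ ks) = ≡.cong suc (quotient-length r k m ks)

  quotient-ev : ∀ r k l ks x → let h = quotient r k (l ∷ ks) ++ [ k ] in
    ev (l ∷ ks ++ [ k ]) x ≈ ev (l ∷ ks ++ [ k ]) r + (x - r) * ev h x
  quotient-ev r k l [] x =
    solve 4 (λ r k l x → l :+ x :* (k :+ x :* o) := (l :+ r :* (k :+ r :* o)) :+ (x :- r) :* (k :+ x :* o)) refl r k l x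
    where o = con (ℤ.+ 0)
  quotient-ev r k l (m ∷ ks) x = begin
    l + x * e x                               ≈⟨ +-congˡ (*-congˡ (quotient-ev r k m ks x)) ⟩
    l + x * (e r + (x - r) * h)
      ≈⟨ solve 5 (λ l x e r h → l :+ x :* (e :+ (x :- r) :* h) := (l :+ r :* e) :+ (x :- r) :* (e :+ x :* h))
           refl l x (e r) r h ⟩
    (l + r * e r) + (x - r) * (e r + x * h)   ∎
    where
    e = ev (m ∷ ks ++ [ k ])
    h = ev (quotient r k (m ∷ ks) ++ [ k ]) x

  quotient-derivative : ∀ r k l ks x → let h = quotient r k (l ∷ ks) ++ [ k ] in
    derivative (l ∷ ks ++ [ k ]) x ≈ ev h x + (x - r) * derivative h x
  quotient-derivative r k l [] x =
    solve 3 (λ r k x → (k :+ x :* o) :+ x :* (o :+ x :* o) := (k :+ x :* o) :+ (x :- r) :* (o :+ x :* o)) refl r k x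
    where o = con (ℤ.+ 0)
  quotient-derivative r k l (m ∷ ks) x = begin
    e x + x * derivative (m ∷ ks ++ [ k ]) x
      ≈⟨ +-cong (quotient-ev r k m ks x) (*-congˡ (quotient-derivative r k m ks x)) ⟩
    (e r + (x - r) * h) + x * (h + (x - r) * h′)
      ≈⟨ solve 5 (λ x e r h d → (e :+ (x :- r) :* h) :+ x :* (h :+ (x :- r) :* d) :=
            (e :+ x :* h) :+ (x :- r) :* (h :+ x :* d)) refl x (e r) r h h′ ⟩
    (e r + x * h) + (x - r) * (h + x * h′) ∎
    where
    e = ev (m ∷ ks ++ [ k ])
    h = ev (quotient r k (m ∷ ks) ++ [ k ]) x
    h′ = derivative (quotient r k (m ∷ ks) ++ [ k ]) x

  Separable : List Carrier → Set (c ⊔ ℓ)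
  Separable ks = ∀ x → ev ks x ≈ 0# → ¬ derivative ks x ≈ 0#

  ev-cong : ∀ ks {x y} → x ≈ y → ev ks x ≈ ev ks y
  ev-cong []       x≈y = refl
  ev-cong (k ∷ ks) x≈y = +-congˡ (*-cong x≈y (ev-cong ks x≈y))

  module _ (closed : AlgebraicallyClosed K) where

    -- Split off a root r, with quotient h. As the derivative is h + (x - r) h′, separability shows
    -- both that r is not a root of h and that h is again separable, so each step adds exactly one
    -- new root.
    rootCount : ∀ d ks k → length ks ≡ d → ¬ k ≈ 0# → Separable (ks ++ [ k ]) →
                HasCardinality setoid (λ x → ev (ks ++ [ k ]) x ≈ 0#) d
    rootCount zero [] k _ k≉0 _ = record
      { elements = [] ; unique = [] ; sound = [] ; size = ≡.refl
      ; complete = λ {x} kx≈0 → contradiction (trans (sym (trans (+-congˡ (zeroʳ x)) (+-identityʳ k))) kx≈0) k≉0 }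
    rootCount (suc d) (l ∷ ks) k len k≉0 separable
      with r , gr≈0 ← closed l (ks ++ [ k ]) (Any.++⁺ʳ ks (here k≉0)) = record
      { elements = r ∷ elements
      ; unique   = All.map (λ hx≈0 r≈x → hr≉0 (trans (ev-cong h r≈x) hx≈0)) sound ∷ unique
      ; sound    = gr≈0 ∷ All.map (λ {x} hx≈0 → trans (g≈ x) (trans (*-congˡ hx≈0) (zeroʳ _))) sound
      ; complete = covered
      ; size     = ≡.cong suc size
      }
      where
      h : List Carrier
      h = quotient r k (l ∷ ks) ++ [ k ]

      g≈ : ∀ x → ev (l ∷ ks ++ [ k ]) x ≈ (x - r) * ev h x
      g≈ x = trans (quotient-ev r k l ks x) (trans (+-congʳ gr≈0) (+-identityˡ _))

      hr≉0 : ¬ ev h r ≈ 0#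
      hr≉0 hr≈0 = separable r gr≈0 (begin
        derivative (l ∷ ks ++ [ k ]) r      ≈⟨ quotient-derivative r k l ks r ⟩
        ev h r + (r - r) * derivative h r   ≈⟨ +-cong hr≈0 (trans (*-congʳ (-‿inverseʳ r)) (zeroˡ _)) ⟩
        0# + 0#                             ≈⟨ +-identityˡ 0# ⟩
        0#                                  ∎)

      h-separable : Separable h
      h-separable x hx≈0 h′x≈0 = separable x (trans (g≈ x) (trans (*-congˡ hx≈0) (zeroʳ _))) (begin
        derivative (l ∷ ks ++ [ k ]) x      ≈⟨ quotient-derivative r k l ks x ⟩
        ev h x + (x - r) * derivative h x   ≈⟨ +-cong hx≈0 (trans (*-congˡ h′x≈0) (zeroʳ _)) ⟩
        0# + 0#                             ≈⟨ +-identityˡ 0# ⟩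
        0#                                  ∎)

      open HasCardinality (rootCount d (quotient r k (l ∷ ks)) k
        (≡.trans (quotient-length r k l ks) (ℕ.suc-injective len)) k≉0 h-separable)

      covered : ∀ {x} → ev (l ∷ ks ++ [ k ]) x ≈ 0# → x ∈ₗ (r ∷ elements)
      covered {x} gx≈0 with x ≟ r
      ... | yes x≈r = here x≈r
      ... | no  x≉r = there (complete (domain (trans (sym (g≈ x)) gx≈0) λ x-r≈0 → x≉r (x∙y⁻¹≈ε⇒x≈y _ _ x-r≈0)))

  ev-++ : ∀ xs ys x → ev (xs ++ ys) x ≈ ev xs x + x ^ length xs * ev ys x
  ev-++ []       ys x = sym (trans (+-identityˡ _) (*-identityˡ _))
  ev-++ (k ∷ xs) ys x = trans (+-congˡ (*-congˡ (ev-++ xs ys x)))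
    (solve 5 (λ k x e p f → k :+ x :* (e :+ p :* f) := (k :+ x :* e) :+ (x :* p) :* f) refl k x (ev xs x) (x ^ length xs) (ev ys x))

  ev-zeros : ∀ m x → ev (List.replicate m 0#) x ≈ 0#
  ev-zeros zero    x = refl
  ev-zeros (suc m) x = trans (+-identityˡ _) (trans (*-congˡ (ev-zeros m x)) (zeroʳ x))

  derivative-zeros : ∀ m x → derivative (List.replicate m 0#) x ≈ 0#
  derivative-zeros zero    x = refl
  derivative-zeros (suc m) x = trans (+-cong (ev-zeros m x) (trans (*-congˡ (derivative-zeros m x)) (zeroʳ x))) (+-identityˡ 0#)

  -- This is n x^(n-1), by the recursion that `derivative` follows and without a predecessor in the
  -- exponent.
  monomial′ : ℕ → Carrier → Carrier
  monomial′ zero    x = 0#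
  monomial′ (suc n) x = x ^ n + x * monomial′ n x

  x*monomial′ : ∀ n x → x * monomial′ n x ≈ n · 1# * x ^ n
  x*monomial′ zero    x = trans (zeroʳ x) (sym (zeroˡ _))
  x*monomial′ (suc n) x = begin
    x * (x ^ n + x * monomial′ n x)    ≈⟨ *-congˡ (+-cong (sym (*-identityˡ _)) (x*monomial′ n x)) ⟩
    x * (1# * x ^ n + n · 1# * x ^ n)
      ≈⟨ solve 4 (λ x o p m → x :* (o :* p :+ m :* p) := (o :+ m) :* (x :* p)) refl x 1# (x ^ n) (n · 1#) ⟩
    suc n · 1# * (x * x ^ n)           ∎

  monomial′-inseparable : ∀ n x → n · 1# ≈ 0# → monomial′ n x ≈ 0#
  monomial′-inseparable zero    x _    = refl
  monomial′-inseparable (suc n) x n≈0 = begin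
    x ^ n + x * monomial′ n x       ≈⟨ +-cong (sym (*-identityˡ _)) (x*monomial′ n x) ⟩
    1# * x ^ n + n · 1# * x ^ n     ≈⟨ distribʳ _ _ _ ⟨
    suc n · 1# * x ^ n              ≈⟨ *-congʳ n≈0 ⟩
    0# * x ^ n                      ≈⟨ zeroˡ _ ⟩
    0#                              ∎

  derivative-++ : ∀ xs k m x → derivative (xs ++ k ∷ List.replicate m 0#) x ≈
                  derivative xs x + k * monomial′ (length xs) x
  derivative-++ [] k m x = trans (+-cong (ev-zeros m x) (trans (*-congˡ (derivative-zeros m x)) (zeroʳ x)))
    (+-congˡ (sym (zeroʳ k)))
  derivative-++ (l ∷ xs) k m x = begin
    ev (xs ++ k ∷ List.replicate m 0#) x + x * derivative (xs ++ k ∷ List.replicate m 0#) x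
      ≈⟨ +-cong (trans (ev-++ xs _ x) (+-congˡ (*-congˡ (trans (+-congˡ (trans (*-congˡ (ev-zeros m x)) (zeroʳ x))) (+-identityʳ k)))))
                (*-congˡ (derivative-++ xs k m x)) ⟩
    (ev xs x + x ^ length xs * k) + x * (derivative xs x + k * monomial′ (length xs) x)
      ≈⟨ solve 6 (λ e p k x d m → (e :+ p :* k) :+ x :* (d :+ k :* m) := (e :+ x :* d) :+ k :* (p :+ x :* m))
           refl (ev xs x) (x ^ length xs) k x (derivative xs x) (monomial′ (length xs) x) ⟩
    (ev xs x + x * derivative xs x) + k * (x ^ length xs + x * monomial′ (length xs) x) ∎

  -- additive s c x = c₀ x + c₁ x^q + ... + cₛ x^(qˢ).
  module Additive {q : ℕ} (2≤q : 2 ≤ q) (q≈0 : q · 1# ≈ 0#)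
    (frobenius : ∀ x y → (x + y) ^ q ≈ x ^ q + y ^ q) where

    additive : ℕ → (ℕ → Carrier) → Carrier → Carrier
    additive zero    f x = f 0 * x
    additive (suc s) f x = f 0 * x + additive s (f ∘ suc) (x ^ q)

    private instance
      q≢0 : ℕ.NonZero q
      q≢0 = ℕ.>-nonZero (ℕ.≤-trans (s≤s z≤n) 2≤q)

    1≤q^ : ∀ s → 1 ℕ.≤ q ℕ.^ s
    1≤q^ s = ℕ.m^n>0 q s

    additive-cong : ∀ s {f g x y} → (∀ i → f i ≈ g i) → x ≈ y → additive s f x ≈ additive s g y
    additive-cong zero    f≈g x≈y = *-cong (f≈g 0) x≈y
    additive-cong (suc s) f≈g x≈y = +-cong (*-cong (f≈g 0) x≈y) (additive-cong s (f≈g ∘ suc) (^-congˡ q x≈y))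

    additive-suc : ∀ s f x → additive (suc s) f x ≈ additive s f x + f (suc s) * x ^ (q ℕ.^ suc s)
    additive-suc zero    f x = +-congˡ (*-congˡ (reflexive (≡.cong (x ^_) (≡.sym (ℕ.*-identityʳ q)))))
    additive-suc (suc s) f x = begin
      f 0 * x + additive (suc s) (f ∘ suc) (x ^ q)
        ≈⟨ +-congˡ (additive-suc s (f ∘ suc) (x ^ q)) ⟩
      f 0 * x + (additive s (f ∘ suc) (x ^ q) + f (suc (suc s)) * (x ^ q) ^ (q ℕ.^ suc s))
        ≈⟨ +-assoc _ _ _ ⟨
      additive (suc s) f x + f (suc (suc s)) * (x ^ q) ^ (q ℕ.^ suc s)
        ≈⟨ +-congˡ (*-congˡ (^-assocʳ x q (q ℕ.^ suc s))) ⟩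
      additive (suc s) f x + f (suc (suc s)) * x ^ (q ℕ.^ suc (suc s)) ∎

    padding : ℕ → ℕ
    padding s = q ℕ.^ suc s ∸ suc (q ℕ.^ s)

    -- The coefficients of the additive polynomial in degrees below q^s, from the constant term 0
    -- on. The next one, in degree q^s, is `f s`; `padding` counts the zeros between consecutive
    -- powers of q.
    lower : (ℕ → Carrier) → ℕ → List Carrier
    lower f zero    = [ 0# ]
    lower f (suc s) = lower f s ++ f s ∷ List.replicate (padding s) 0#

    length-lower : ∀ f s → length (lower f s) ≡ q ℕ.^ s
    length-lower f zero    = ≡.refl
    length-lower f (suc s) = ≡.trans (List.length-++ (lower f s)) (≡.trans
      (≡.cong₂ (λ m n → m ℕ.+ suc n) (length-lower f s) (List.length-replicate (padding s)))
      (≡.trans (ℕ.+-suc _ _) (ℕ.m+[n∸m]≡n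
        (ℕ.≤-trans (ℕ.+-mono-≤ (1≤q^ s) ℕ.≤-refl)
          (ℕ.≤-trans (ℕ.≤-reflexive (≡.cong (q ℕ.^ s ℕ.+_) (≡.sym (ℕ.+-identityʳ _)))) (ℕ.*-monoˡ-≤ (q ℕ.^ s) 2≤q))))))

    ev-lower : ∀ f s x → ev (lower f (suc s)) x ≈ additive s f x
    -- The tail `zs` is the zero padding during the recursion and empty when the whole polynomial is
    -- meant.
    ev-step : ∀ f s x zs → ev zs x ≈ 0# → ev (lower f s ++ f s ∷ zs) x ≈ additive s f x

    ev-step f s x zs zs≈0 = trans (ev-++ (lower f s) _ x) (trans
      (+-congˡ (*-cong (reflexive (≡.cong (x ^_) (length-lower f s)))
                        (trans (+-congˡ (trans (*-congˡ zs≈0) (zeroʳ x))) (+-identityʳ (f s)))))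
      (last s))
      where
      last : ∀ s → ev (lower f s) x + x ^ (q ℕ.^ s) * f s ≈ additive s f x
      last zero    = begin
        (0# + x * 0#) + x * 1# * f 0  ≈⟨ +-cong (trans (+-identityˡ _) (zeroʳ x)) (*-congʳ (*-identityʳ x)) ⟩
        0# + x * f 0                  ≈⟨ trans (+-identityˡ _) (*-comm _ _) ⟩
        f 0 * x                       ∎
      last (suc s) = trans (+-cong (ev-lower f s x) (*-comm _ _)) (sym (additive-suc s f x))

    ev-lower f s x = ev-step f s x (List.replicate (padding s) 0#) (ev-zeros (padding s) x)

    q^≈0 : ∀ s → (q ℕ.^ suc s) · 1# ≈ 0#
    q^≈0 s = trans (×1-homo-* q (q ℕ.^ s)) (trans (*-congʳ q≈0) (zeroˡ _))

    -- Every exponent other than 1 is a positive power of q, which is 0 in K. So the derivative is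
    -- constant, and a nonzero `f 0` makes the polynomial separable.
    derivative-lower : ∀ f s x m → derivative (lower f s ++ f s ∷ List.replicate m 0#) x ≈ f 0
    derivative-lower f zero    x m = begin
      derivative (0# ∷ f 0 ∷ List.replicate m 0#) x   ≈⟨ derivative-++ [ 0# ] (f 0) m x ⟩
      (0# + x * 0#) + f 0 * (1# + x * 0#)
        ≈⟨ +-cong (trans (+-identityˡ _) (zeroʳ x)) (*-congˡ (trans (+-congˡ (zeroʳ x)) (+-identityʳ 1#))) ⟩
      0# + f 0 * 1#                                   ≈⟨ trans (+-identityˡ _) (*-identityʳ _) ⟩
      f 0                                             ∎
    derivative-lower f (suc s) x m = begin
      derivative (lower f (suc s) ++ f (suc s) ∷ List.replicate m 0#) x
        ≈⟨ derivative-++ (lower f (suc s)) (f (suc s)) m x ⟩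
      derivative (lower f (suc s)) x + f (suc s) * monomial′ (length (lower f (suc s))) x
        ≈⟨ +-cong (derivative-lower f s x (padding s)) (*-congˡ (trans
             (reflexive (≡.cong (λ n → monomial′ n x) (length-lower f (suc s)))) (monomial′-inseparable (q ℕ.^ suc s) x (q^≈0 s)))) ⟩
      f 0 + f (suc s) * 0#   ≈⟨ trans (+-congˡ (zeroʳ _)) (+-identityʳ _) ⟩
      f 0                    ∎

    additive-rootCount : AlgebraicallyClosed K → ∀ s f → ¬ f 0 ≈ 0# → ¬ f s ≈ 0# →
      HasCardinality setoid (λ x → additive s f x ≈ 0#) (q ℕ.^ s)
    additive-rootCount closed s f f₀≉0 fₛ≉0 = Cardinality.cardinality-⇔ setoid
      (λ {x} → trans (sym (ev-step f s x [] refl))) (λ {x} → trans (ev-step f s x [] refl))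
      (rootCount closed (q ℕ.^ s) (lower f s) (f s) (length-lower f s) fₛ≉0
        λ x _ f′x≈0 → f₀≉0 (trans (sym (derivative-lower f s x 0)) f′x≈0))

    -- Such elements form the field of q elements. As coefficients they commute with the operator x
    -- ↦ x^q, so that composing additive polynomials is like multiplying polynomials in T.
    Fixed : Carrier → Set ℓ
    Fixed x = x ^ q ≈ x

    open CommutativeExp commutativeSemiring using (^-distrib-*)

    additive-frobenius : ∀ s f → (∀ i → Fixed (f i)) → ∀ x → additive s f (x ^ q) ≈ additive s f x ^ q
    additive-frobenius zero    f f-fixed x = sym (trans (^-distrib-* (f 0) x q) (*-congʳ (f-fixed 0)))
    additive-frobenius (suc s) f f-fixed x = sym (trans (frobenius _ _) (+-cong
      (trans (^-distrib-* (f 0) x q) (*-congʳ (f-fixed 0)))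
      (sym (additive-frobenius s (f ∘ suc) (f-fixed ∘ suc) (x ^ q)))))

    additive-+ : ∀ s f x y → additive s f (x + y) ≈ additive s f x + additive s f y
    additive-+ zero    f x y = distribˡ _ _ _
    additive-+ (suc s) f x y = trans
      (+-cong (distribˡ (f 0) x y) (trans (additive-cong s (λ _ → refl) (frobenius x y)) (additive-+ s (f ∘ suc) (x ^ q) (y ^ q))))
      (solve 4 (λ a b c d → (a :+ b) :+ (c :+ d) := (a :+ c) :+ (b :+ d)) refl _ _ _ _)

    additive-* : ∀ s f {a} → Fixed a → ∀ x → additive s f (a * x) ≈ a * additive s f x
    additive-* zero    f {a} a-fixed x = solve 3 (λ f a x → f :* (a :* x) := a :* (f :* x)) refl (f 0) a x
    additive-* (suc s) f {a} a-fixed x = trans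
      (+-congˡ (trans (additive-cong s (λ _ → refl) (trans (^-distrib-* a x q) (*-congʳ a-fixed)))
        (additive-* s (f ∘ suc) a-fixed (x ^ q))))
      (solve 4 (λ f a x y → f :* (a :* x) :+ a :* y := a :* (f :* x :+ y)) refl (f 0) a x _)

    additive-⊕ : ∀ s f g x → additive s (λ i → f i + g i) x ≈ additive s f x + additive s g x
    additive-⊕ zero    f g x = distribʳ _ _ _
    additive-⊕ (suc s) f g x = trans (+-cong (distribʳ x (f 0) (g 0)) (additive-⊕ s (f ∘ suc) (g ∘ suc) (x ^ q)))
      (solve 4 (λ a b c d → (a :+ b) :+ (c :+ d) := (a :+ c) :+ (b :+ d)) refl _ _ _ _)

    additive-• : ∀ s a f x → additive s (λ i → a * f i) x ≈ a * additive s f x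
    additive-• zero    a f x = *-assoc _ _ _
    additive-• (suc s) a f x = trans (+-cong (*-assoc a (f 0) x) (additive-• s a (f ∘ suc) (x ^ q))) (sym (distribˡ a _ _))

    -- A vanishing lowest coefficient means that every term is a q-th power, and so is the whole
    -- since the coefficients are fixed. Removing v of them replaces the polynomial by a q^v-th root
    -- with the same zeros.
    additive-drop : ∀ v s f → (∀ i → Fixed (f i)) → (∀ i → i ℕ.< v → f i ≈ 0#) → ∀ {x} →
      (additive (v ℕ.+ s) f x ≈ 0# → additive s (λ i → f (v ℕ.+ i)) x ≈ 0#) ×
      (additive s (λ i → f (v ℕ.+ i)) x ≈ 0# → additive (v ℕ.+ s) f x ≈ 0#)
    additive-drop zero    s f f-fixed f≈0 = id , id
    additive-drop (suc v) s f f-fixed f≈0 {x}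
      with to , from ← additive-drop v s (f ∘ suc) (f-fixed ∘ suc) (λ i i<v → f≈0 (suc i) (s≤s i<v)) {x} =
      (λ f≈0 → to (^-zero⇒zero q (trans (sym step) f≈0))) ,
      (λ g≈0 → trans step (trans (^-congˡ q (from g≈0)) (0^ q)))
      where
      step : additive (suc v ℕ.+ s) f x ≈ additive (v ℕ.+ s) (f ∘ suc) x ^ q
      step = trans (+-cong (trans (*-congʳ (f≈0 0 (s≤s z≤n))) (zeroˡ x))
               (additive-frobenius (v ℕ.+ s) (f ∘ suc) (f-fixed ∘ suc) x)) (+-identityˡ _)

    kernelCount : AlgebraicallyClosed K → ∀ v s f → (∀ i → Fixed (f i)) → (∀ i → i ℕ.< v → f i ≈ 0#) →
      ¬ f v ≈ 0# → ¬ f (v ℕ.+ s) ≈ 0# → HasCardinality setoid (λ x → additive (v ℕ.+ s) f x ≈ 0#) (q ℕ.^ s)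
    kernelCount closed v s f f-fixed f≈0 fᵥ≉0 fₜ≉0 = Cardinality.cardinality-⇔ setoid
      (proj₂ (additive-drop v s f f-fixed f≈0)) (proj₁ (additive-drop v s f f-fixed f≈0))
      (additive-rootCount closed s (λ i → f (v ℕ.+ i))
        (λ fᵥ≈0 → fᵥ≉0 (trans (reflexive (≡.cong f (≡.sym (ℕ.+-identityʳ v)))) fᵥ≈0)) fₜ≉0)

-- Fixed points of the iterates of x^q + a x

prime∤⇒coprime : ∀ {p n} → Prime p → ¬ p ∣ n → Coprime p n
prime∤⇒coprime p-prime p∤n (d∣p , d∣n) with prime⇒irreducible p-prime d∣p
... | inj₁ d≡1    = d≡1
... | inj₂ ≡.refl = contradiction d∣n p∤n

module FixedPointCount (K : DiscreteField c ℓ) {p : ℕ} (p-prime : Prime p)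
  (characteristic : DiscreteField._≈_ K (DiscreteField._·_ K p (DiscreteField.1# K)) (DiscreteField.0# K))
  (closed : AlgebraicallyClosed K) {m : ℕ} (1≤m : 1 ≤ m)
  {a : DiscreteField.Carrier K}
  (a-fixed : DiscreteField._≈_ K (DiscreteField._^_ K a (p ℕ.^ m)) a)
  (a≉0 : ¬ DiscreteField._≈_ K a (DiscreteField.0# K)) where
  open DiscreteField K hiding (zero; _^_; _·_)
  open FieldTheory K
  open SeparablePolynomials K
  open TrivialPowers semiring using (1^; 0^)
  open Frobenius commutativeRing p-prime characteristic
  open SemiringMult semiring using (×1-homo-*) renaming (_×_ to _·_)
  open SemiringExp semiring using (_^_; ^-congˡ; ^-assocʳ)
  open RingProperties ring
  open SetoidReasoning setoid
  open IntegerCoefficients commutativeRing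
  open Endo Carrier using () renaming (_^_ to _^∘_)

  q : ℕ
  q = p ℕ.^ m

  private instance
    p≢0 : ℕ.NonZero p
    p≢0 = prime⇒nonZero p-prime

  q≈0 : q · 1# ≈ 0#
  q≈0 = ∣⇒·≈0 (m∣m^n 1≤m) 1#

  2≤q : 2 ℕ.≤ q
  2≤q = 2≤p^m p-prime 1≤m

  open Additive 2≤q q≈0 (frobenius-^-+ m)

  1ˢ : ℕ → Carrier
  1ˢ zero    = 1#
  1ˢ (suc _) = 0#

  open PowerSeriesRing commutativeRing 1ˢ refl (λ _ → refl)
  open PolynomialSeries discreteDomain 1ˢ refl (λ _ → refl) using (⊛-zeroʳ-≤)
  open Exponential discreteDomain 1ˢ refl (λ _ → refl) using (^ˢ-vanishes-<)

  private
    module S = CommutativeRing seriesRing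
  open SemiringExp S.semiring using () renaming (_^_ to _^ˢ_; ^-congˡ to ^ˢ-congˡ; ^-assocʳ to ^ˢ-assocʳ)

  -- The Frobenius identity is also needed for polynomials in T, whose ring inherits characteristic
  -- p coefficientwise.
  module Frobeniusˢ = Frobenius seriesRing p-prime
    (λ n → trans (·ˢ-coefficient p 1ˢ n) (∣⇒·≈0 ℕ.∣-refl (1ˢ n)))

  T+a : Series
  T+a zero          = a
  T+a (suc zero)    = 1#
  T+a (suc (suc _)) = 0#

  T+a-tail : tail T+a ≈ˢ 1ˢ
  T+a-tail zero    = refl
  T+a-tail (suc n) = refl

  T+a-⊛-suc : ∀ f n → (T+a ⊛ f) (suc n) ≈ a * f (suc n) + f n
  T+a-⊛-suc f n = +-congˡ (trans (⊛-congʳ f T+a-tail n) (⊛-identityˡ f n))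

  P : ℕ → Series
  P n = T+a ^ˢ n

  P₀ : ∀ n → P n 0 ≈ a ^ n
  P₀ zero    = refl
  P₀ (suc n) = trans (+-identityʳ _) (*-congˡ (P₀ n))

  -- The linear coefficient of (T + a)^n decides, when p does not divide n, that (T + a)^n - 1
  -- vanishes at most to first order at T = 0.
  P₁ : ∀ n → P (suc n) 1 ≈ suc n · 1# * a ^ n
  P₁ zero = trans (T+a-⊛-suc 1ˢ 0) (trans (+-congʳ (zeroʳ a)) (trans (+-identityˡ 1#)
    (sym (trans (*-identityʳ _) (+-identityʳ 1#)))))
  P₁ (suc n) = begin
    P (suc (suc n)) 1                            ≈⟨ T+a-⊛-suc (P (suc n)) 0 ⟩
    a * P (suc n) 1 + P (suc n) 0                ≈⟨ +-cong (*-congˡ (P₁ n)) (trans (P₀ (suc n)) (sym (*-identityˡ _))) ⟩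
    a * (suc n · 1# * a ^ n) + 1# * (a * a ^ n)
      ≈⟨ solve 4 (λ a m x o → a :* (m :* x) :+ o :* (a :* x) := (o :+ m) :* (a :* x)) refl a (suc n · 1#) (a ^ n) 1# ⟩
    suc (suc n) · 1# * a ^ suc n                 ∎

  P-vanishes : ∀ n i → n ℕ.< i → P n i ≈ 0#
  P-vanishes zero    (suc i) _         = refl
  P-vanishes (suc n) (suc i) (s≤s n<i) = trans (T+a-⊛-suc (P n) i) (trans
    (+-cong (trans (*-congˡ (P-vanishes n (suc i) (ℕ.m≤n⇒m≤1+n n<i))) (zeroʳ a)) (P-vanishes n i n<i)) (+-identityˡ 0#))

  P-leading : ∀ n → P n n ≈ 1#
  P-leading zero    = refl
  P-leading (suc n) = trans (T+a-⊛-suc (P n) n) (trans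
    (+-cong (trans (*-congˡ (P-vanishes n (suc n) ℕ.≤-refl)) (zeroʳ a)) (P-leading n)) (+-identityˡ 1#))

  Fixed-+ : ∀ {x y} → Fixed x → Fixed y → Fixed (x + y)
  Fixed-+ x-fixed y-fixed = trans (frobenius-^-+ m _ _) (+-cong x-fixed y-fixed)

  open CommutativeExp commutativeSemiring using (^-distrib-*)

  Fixed-* : ∀ {x y} → Fixed x → Fixed y → Fixed (x * y)
  Fixed-* x-fixed y-fixed = trans (^-distrib-* _ _ q) (*-cong x-fixed y-fixed)

  Fixed-0 : Fixed 0#
  Fixed-0 = 0^ q {{ℕ.m^n≢0 p m}}

  Fixed-- : ∀ {x y} → Fixed x → Fixed y → Fixed (x - y)
  Fixed-- {x} {y} x-fixed y-fixed = begin
    (x - y) ^ q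
      ≈⟨ solve 2 (λ u v → u := (u :+ v) :- v) refl ((x - y) ^ q) (y ^ q) ⟩
    ((x - y) ^ q + y ^ q) - y ^ q      ≈⟨ +-cong (frobenius-^-+ m (x - y) y) (-‿cong (sym y-fixed)) ⟨
    ((x - y) + y) ^ q - y
      ≈⟨ +-congʳ (^-congˡ q (solve 2 (λ x y → (x :- y) :+ y := x) refl x y)) ⟩
    x ^ q - y                          ≈⟨ +-congʳ x-fixed ⟩
    x - y                              ∎

  P-fixed : ∀ n i → Fixed (P n i)
  P-fixed zero    zero    = 1^ q
  P-fixed zero    (suc i) = Fixed-0
  P-fixed (suc n) zero    = trans (^-congˡ q (+-identityʳ _)) (trans (Fixed-* a-fixed (P-fixed n 0)) (sym (+-identityʳ _)))
  P-fixed (suc n) (suc i) = trans (^-congˡ q (T+a-⊛-suc (P n) i)) (trans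
    (Fixed-+ (Fixed-* a-fixed (P-fixed n (suc i))) (P-fixed n i)) (sym (T+a-⊛-suc (P n) i)))

  f : Carrier → Carrier
  f x = x ^ q + a * x

  f-cong : ∀ {x y} → x ≈ y → f x ≈ f y
  f-cong x≈y = +-cong (^-congˡ q x≈y) (*-congˡ x≈y)

  -- Iterates unfold with `f` outermost, whereas `additive-P` recurses with `f` innermost.
  f^-suc : ∀ n x → (f ^∘ suc n) x ≡ (f ^∘ n) (f x)
  f^-suc zero    x = ≡.refl
  f^-suc (suc n) x = ≡.cong f (f^-suc n x)

  prepend : (ℕ → Carrier) → ℕ → Carrier
  prepend g zero    = 0#
  prepend g (suc i) = g i

  T+a-⊛ : ∀ g i → (T+a ⊛ g) i ≈ a * g i + prepend g i
  T+a-⊛ g zero    = refl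
  T+a-⊛ g (suc i) = T+a-⊛-suc g i

  -- For additive L one has L(x^q + a x) = L(x^q) + a L(x): the first summand shifts the
  -- coefficients, and in the second a comes out as a scalar because it is fixed. Together this is
  -- multiplication by T + a.
  additive-P : ∀ n x → additive n (P n) x ≈ (f ^∘ n) x
  additive-P zero    x = *-identityˡ x
  additive-P (suc n) x = begin
    additive (suc n) (P (suc n)) x
      ≈⟨ additive-cong (suc n) (T+a-⊛ (P n)) refl ⟩
    additive (suc n) (λ i → a * P n i + prepend (P n) i) x
      ≈⟨ additive-⊕ (suc n) (λ i → a * P n i) (prepend (P n)) x ⟩
    additive (suc n) (λ i → a * P n i) x + (0# * x + additive n (P n) (x ^ q))
      ≈⟨ +-cong (additive-• (suc n) a (P n) x) (trans (+-congʳ (zeroˡ x)) (+-identityˡ _)) ⟩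
    a * additive (suc n) (P n) x + additive n (P n) (x ^ q)
      ≈⟨ +-congʳ (*-congˡ (trans (additive-suc n (P n) x) (trans
           (+-congˡ (trans (*-congʳ (P-vanishes n (suc n) ℕ.≤-refl)) (zeroˡ _))) (+-identityʳ _)))) ⟩
    a * additive n (P n) x + additive n (P n) (x ^ q)
      ≈⟨ +-congʳ (additive-* n (P n) a-fixed x) ⟨
    additive n (P n) (a * x) + additive n (P n) (x ^ q)
      ≈⟨ +-comm _ _ ⟩
    additive n (P n) (x ^ q) + additive n (P n) (a * x)
      ≈⟨ additive-+ n (P n) (x ^ q) (a * x) ⟨
    additive n (P n) (f x)
      ≈⟨ additive-P n (f x) ⟩
    (f ^∘ n) (f x)
      ≡⟨ f^-suc n x ⟨
    (f ^∘ suc n) x ∎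

  G : ℕ → Series
  G n i = P n i - 1ˢ i

  additive-1ˢ : ∀ n x → additive n 1ˢ x ≈ x
  additive-1ˢ zero    x = *-identityˡ x
  additive-1ˢ (suc n) x = trans (+-cong (*-identityˡ x) (additive-0 n (x ^ q))) (+-identityʳ x)
    where
    additive-0 : ∀ n x → additive n (λ _ → 0#) x ≈ 0#
    additive-0 zero    x = zeroˡ x
    additive-0 (suc n) x = trans (+-cong (zeroˡ x) (additive-0 n (x ^ q))) (+-identityˡ 0#)

  additive-G : ∀ n x → additive n (G n) x ≈ (f ^∘ n) x - x
  additive-G n x = begin
    additive n (G n) x
      ≈⟨ additive-cong n (λ i → +-congˡ (sym (-1*x≈-x (1ˢ i)))) refl ⟩
    additive n (λ i → P n i + - 1# * 1ˢ i) x
      ≈⟨ additive-⊕ n (P n) (λ i → - 1# * 1ˢ i) x ⟩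
    additive n (P n) x + additive n (λ i → - 1# * 1ˢ i) x
      ≈⟨ +-cong (additive-P n x) (trans (additive-• n (- 1#) 1ˢ x) (trans (-1*x≈-x _) (-‿cong (additive-1ˢ n x)))) ⟩
    (f ^∘ n) x - x ∎

  G-fixed : ∀ n i → Fixed (G n i)
  G-fixed n zero    = Fixed-- (P-fixed n 0) (1^ q)
  G-fixed n (suc i) = Fixed-- (P-fixed n (suc i)) Fixed-0

  G-leading : ∀ n → G (suc n) (suc n) ≈ 1#
  G-leading n = trans (+-cong (P-leading (suc n)) -0#≈0#) (+-identityʳ 1#)

  -- v is the order of vanishing of (T + a)ⁿ - 1 at T = 0.
  count : ∀ {N} v s n → v ℕ.+ s ≡ suc n → (∀ i → i ℕ.< v → G (suc n) i ≈ 0#) → ¬ G (suc n) v ≈ 0# →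
          HasCardinality setoid (FixedPoint K (f ^∘ suc n)) N → N ≡ q ℕ.^ s
  count v s n v+s≡ G≈0 Gᵥ≉0 card = Cardinality.cardinality-unique setoid respects respects id id card
    (Cardinality.cardinality-⇔ setoid (λ {x} → root⇒fixed {x}) (λ {x} → fixed⇒root {x})
      (kernelCount closed v s (G (suc n)) (G-fixed (suc n)) G≈0 Gᵥ≉0
        (λ Gₙ≈0 → 1≉0 (trans (sym (G-leading n)) (trans (reflexive (≡.cong (G (suc n)) (≡.sym v+s≡))) Gₙ≈0)))))
    where
    additive≈ : ∀ x → additive (v ℕ.+ s) (G (suc n)) x ≈ (f ^∘ suc n) x - x
    additive≈ x = trans (reflexive (≡.cong (λ k → additive k (G (suc n)) x) v+s≡)) (additive-G (suc n) x)
    root⇒fixed : ∀ {x} → additive (v ℕ.+ s) (G (suc n)) x ≈ 0# → (f ^∘ suc n) x ≈ x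
    root⇒fixed {x} root = x∙y⁻¹≈ε⇒x≈y _ _ (trans (sym (additive≈ x)) root)
    fixed⇒root : ∀ {x} → (f ^∘ suc n) x ≈ x → additive (v ℕ.+ s) (G (suc n)) x ≈ 0#
    fixed⇒root {x} fixed = trans (additive≈ x) (x≈y⇒x∙y⁻¹≈ε fixed)
    f^-cong : ∀ k {x y} → x ≈ y → (f ^∘ k) x ≈ (f ^∘ k) y
    f^-cong zero    x≈y = x≈y
    f^-cong (suc k) x≈y = f-cong (f^-cong k x≈y)
    respects : ∀ {x y} → x ≈ y → (f ^∘ suc n) x ≈ x → (f ^∘ suc n) y ≈ y
    respects x≈y fixed = trans (f^-cong (suc n) (sym x≈y)) (trans fixed x≈y)

  count-a^n≉1 : ∀ {N} n → ¬ a ^ suc n ≈ 1# → HasCardinality setoid (FixedPoint K (f ^∘ suc n)) N → N ≡ q ℕ.^ suc n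
  count-a^n≉1 n aⁿ≉1 = count 0 (suc n) n ≡.refl (λ _ ())
    (λ G₀≈0 → aⁿ≉1 (trans (sym (P₀ (suc n))) (x∙y⁻¹≈ε⇒x≈y _ _ G₀≈0)))

  p∤n⇒n≉0 : ∀ {n} → ¬ p ∣ n → ¬ n · 1# ≈ 0#
  p∤n⇒n≉0 {n} p∤n n≈0 = 1≉0 (bézout (coprime-Bézout (prime∤⇒coprime p-prime p∤n)))
    where
    bézout : GCD.Bézout.Identity 1 p n → 1# ≈ 0#
    bézout (GCD.Bézout.+- x y 1+yn≡xp) = begin
      1#                          ≈⟨ +-identityʳ _ ⟨
      1# + 0#                     ≈⟨ +-congˡ (trans (×1-homo-* y n) (trans (*-congˡ n≈0) (zeroʳ _))) ⟨
      1# + (y ℕ.* n) · 1#         ≡⟨ ≡.cong (_· 1#) 1+yn≡xp ⟩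
      (x ℕ.* p) · 1#              ≈⟨ trans (×1-homo-* x p) (trans (*-congˡ characteristic) (zeroʳ _)) ⟩
      0#                          ∎
    bézout (GCD.Bézout.-+ x y 1+xp≡yn) = begin
      1#                          ≈⟨ +-identityʳ _ ⟨
      1# + 0#                     ≈⟨ +-congˡ (trans (×1-homo-* x p) (trans (*-congˡ characteristic) (zeroʳ _))) ⟨
      1# + (x ℕ.* p) · 1#         ≡⟨ ≡.cong (_· 1#) 1+xp≡yn ⟩
      (y ℕ.* n) · 1#              ≈⟨ trans (×1-homo-* y n) (trans (*-congˡ n≈0) (zeroʳ _)) ⟩
      0#                          ∎

  ⊛-lowest : ∀ g h n → (∀ i → i ℕ.< n → h i ≈ 0#) → (g ⊛ h) n ≈ g 0 * h n
  ⊛-lowest g h zero    _    = +-identityʳ _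
  ⊛-lowest g h (suc n) h≈0 = trans (+-congˡ (⊛-zeroʳ-≤ (tail g) h n (λ i i≤n → h≈0 i (s≤s i≤n)))) (+-identityʳ _)

  ^ˢ-lowest : ∀ g → g 0 ≈ 0# → ∀ n → (g ^ˢ n) n ≈ g 1 ^ n
  ^ˢ-lowest g g₀≈0 zero    = refl
  ^ˢ-lowest g g₀≈0 (suc n) = trans (+-cong (trans (*-congʳ g₀≈0) (zeroˡ _))
      (trans (⊛-lowest (tail g) (g ^ˢ n) n (^ˢ-vanishes-< g g₀≈0 n)) (*-congˡ (^ˢ-lowest g g₀≈0 n))))
    (+-identityˡ _)

  -- With n = n′ p^k for the exponent n of the iterate, (T + a)^n - 1 is the p^k-th power of z = (T
  -- + a)^n′ - 1, and z vanishes to order exactly 1 at T = 0. The product form avoids subtracting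
  -- exponents.
  count-a^n≈1 : ∀ {N} n k n′ → suc n ≡ n′ ℕ.* p ℕ.^ k → ¬ p ∣ n′ → a ^ suc n ≈ 1# →
    HasCardinality setoid (FixedPoint K (f ^∘ suc n)) N → N ℕ.* q ℕ.^ (p ℕ.^ k) ≡ q ℕ.^ suc n
  count-a^n≈1 n k zero     ()
  count-a^n≈1 {N} n k n′@(suc n″) eq p∤n′ aⁿ≈1 card = ≡.trans
    (≡.cong (ℕ._* q ℕ.^ v) (count v (suc n ∸ v) n (ℕ.m+[n∸m]≡n v≤n) G≈0 Gᵥ≉0 card))
    (≡.trans (≡.sym (ℕ.^-distribˡ-+-* q (suc n ∸ v) v)) (≡.cong (q ℕ.^_) (ℕ.m∸n+n≡m v≤n)))
    where
    v : ℕ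
    v = p ℕ.^ k

    v≤n : v ℕ.≤ suc n
    v≤n = ℕ.≤-trans (ℕ.m≤n*m v n′) (ℕ.≤-reflexive (≡.sym eq))

    z : Series
    z = P n′ ⊕ ⊖ 1ˢ

    G≈ : G (suc n) ≈ˢ z ^ˢ v
    G≈ i = begin
      P (suc n) i - 1ˢ i
        ≈⟨ +-congʳ (reflexive (≡.cong (λ j → P j i) eq)) ⟩
      P (n′ ℕ.* v) i - 1ˢ i
        ≈⟨ +-cong (^ˢ-assocʳ T+a n′ v i) (-‿cong (1^ˢ v i)) ⟨
      (P n′ ^ˢ v) i - (1ˢ ^ˢ v) i
        ≈⟨ +-congʳ (^ˢ-congˡ v (λ j → solve 2 (λ x y → x := (x :- y) :+ y) refl (P n′ j) (1ˢ j)) i) ⟩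
      ((z ⊕ 1ˢ) ^ˢ v) i - (1ˢ ^ˢ v) i
        ≈⟨ +-congʳ (Frobeniusˢ.frobenius-^-+ k z 1ˢ i) ⟩
      (z ^ˢ v) i + (1ˢ ^ˢ v) i - (1ˢ ^ˢ v) i
        ≈⟨ solve 2 (λ x y → (x :+ y) :- y := x) refl ((z ^ˢ v) i) ((1ˢ ^ˢ v) i) ⟩
      (z ^ˢ v) i ∎
      where
      open TrivialPowers S.semiring using () renaming (1^ to 1^ˢ)

    -- Only a^n = 1 is given, not a^n′ = 1; but the p^k-th power of a^n′ - 1 is a^n - 1, and a field
    -- has no nilpotents.
    z₀≈0 : z 0 ≈ 0#
    z₀≈0 = ^-zero⇒zero v (begin
      z 0 ^ v          ≈⟨ ^ˢ₀ v ⟨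
      (z ^ˢ v) 0       ≈⟨ G≈ 0 ⟨
      P (suc n) 0 - 1# ≈⟨ x≈y⇒x∙y⁻¹≈ε (trans (P₀ (suc n)) aⁿ≈1) ⟩
      0#               ∎)
      where
      ^ˢ₀ : ∀ v → (z ^ˢ v) 0 ≈ z 0 ^ v
      ^ˢ₀ zero    = refl
      ^ˢ₀ (suc v) = trans (+-identityʳ _) (*-congˡ (^ˢ₀ v))

    z₁≉0 : ¬ z 1 ≈ 0#
    z₁≉0 z₁≈0 = a≉0 (^-zero⇒zero n″ (domain (begin
      n′ · 1# * a ^ n″   ≈⟨ P₁ n″ ⟨
      P n′ 1             ≈⟨ trans (+-congˡ -0#≈0#) (+-identityʳ _) ⟨
      z 1                ≈⟨ z₁≈0 ⟩
      0#                 ∎) (p∤n⇒n≉0 p∤n′)))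

    G≈0 : ∀ i → i ℕ.< v → G (suc n) i ≈ 0#
    G≈0 i i<v = trans (G≈ i) (^ˢ-vanishes-< z z₀≈0 v i i<v)

    Gᵥ≉0 : ¬ G (suc n) v ≈ 0#
    Gᵥ≉0 Gᵥ≈0 = z₁≉0 (^-zero⇒zero v (trans (sym (^ˢ-lowest z z₀≈0 v)) (trans (sym (G≈ v)) Gᵥ≈0)))

-- Rational coefficients and the passage from Laurent series to power series

module RationalSeries where

  ℚ-ring : CommutativeRing 0ℓ 0ℓ
  ℚ-ring = ℚ.+-*-commutativeRing

  module ℚ-Mult = SemiringMult (CommutativeRing.semiring ℚ-ring)
  open ℚ-Mult using () renaming (_×_ to _·_)

  ℚ-1≢0 : ¬ 1ℚ ≡ 0ℚ
  ℚ-1≢0 ()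

  ℚ-domain : ∀ {x y} → x ℚ.* y ≡ 0ℚ → ¬ x ≡ 0ℚ → y ≡ 0ℚ
  ℚ-domain {x} {y} xy≡0 x≢0 = begin
    y                        ≡⟨ ℚ.*-identityˡ y ⟨
    1ℚ ℚ.* y                 ≡⟨ ≡.cong (ℚ._* y) (ℚ.*-inverseˡ x) ⟨
    (ℚ.1/ x) ℚ.* x ℚ.* y     ≡⟨ ℚ.*-assoc (ℚ.1/ x) x y ⟩
    (ℚ.1/ x) ℚ.* (x ℚ.* y)   ≡⟨ ≡.cong ((ℚ.1/ x) ℚ.*_) xy≡0 ⟩
    (ℚ.1/ x) ℚ.* 0ℚ          ≡⟨ ℚ.*-zeroʳ (ℚ.1/ x) ⟩
    0ℚ                       ∎
    where
    instance
      x-nonZero : ℚ.NonZero x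
      x-nonZero = ℚ.≢-nonZero x≢0
    open ≡-Reasoning

  ℚ-discreteDomain : DiscreteDomain 0ℓ 0ℓ
  ℚ-discreteDomain = record { commutativeRing = ℚ-ring ; 1≉0 = ℚ-1≢0 ; domain = ℚ-domain ; _≟_ = ℚ._≟_ }

  n·1≥0 : ∀ n → 0ℚ ℚ.≤ n · 1ℚ
  n·1≥0 zero    = ℚ.≤-refl
  n·1≥0 (suc n) = ℚ.≤-trans (n·1≥0 n) (ℚ.≤-trans (ℚ.≤-reflexive (≡.sym (ℚ.+-identityˡ _)))
    (ℚ.+-monoˡ-≤ (n · 1ℚ) (ℚ.<⇒≤ (ℚ.positive⁻¹ 1ℚ))))

  1+n·1≢0 : ∀ n → ¬ suc n · 1ℚ ≡ 0ℚ
  1+n·1≢0 n eq = ℚ.<-irrefl (≡.sym eq) (ℚ.+-mono-<-≤ (ℚ.positive⁻¹ 1ℚ) (n·1≥0 n))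

  ℚ-char-0 : ∀ n {x} → suc n · x ≡ 0ℚ → x ≡ 0ℚ
  ℚ-char-0 n {x} nx≡0 = ℚ-domain {suc n · 1ℚ} (≡.trans (ℚ-Mult.×-assoc-* (suc n) 1ℚ x)
    (≡.trans (≡.cong (suc n ·_) (ℚ.*-identityˡ x)) nx≡0)) (1+n·1≢0 n)

  ·1-injective : ∀ m n → m · 1ℚ ≡ n · 1ℚ → m ≡ n
  ·1-injective zero    zero    eq = ≡.refl
  ·1-injective zero    (suc n) eq = contradiction (≡.sym eq) (1+n·1≢0 n)
  ·1-injective (suc m) zero    eq = contradiction eq (1+n·1≢0 m)
  ·1-injective (suc m) (suc n) eq = ≡.cong suc (·1-injective m n
    (RingProperties.+-cancelˡ (CommutativeRing.ring ℚ-ring) 1ℚ (m · 1ℚ) (n · 1ℚ) eq))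

  n·1≡n/1 : ∀ n → n · 1ℚ ≡ (ℤ.+ n) ℚ./ 1
  n·1≡n/1 zero    = ≡.refl
  n·1≡n/1 (suc n) = ≡.trans (≡.cong (1ℚ ℚ.+_) (n·1≡n/1 n)) (ℚ.toℚᵘ-injective (begin
    ℚ.toℚᵘ (1ℚ ℚ.+ (ℤ.+ n) ℚ./ 1)             ≈⟨ ℚ.toℚᵘ-homo-+ 1ℚ ((ℤ.+ n) ℚ./ 1) ⟩
    ℚ.toℚᵘ 1ℚ ℚᵘ.+ ℚ.toℚᵘ ((ℤ.+ n) ℚ./ 1)     ≈⟨ ℚᵘ.+-congʳ (ℚ.toℚᵘ 1ℚ) (ℚ.toℚᵘ-fromℚᵘ (ℚᵘ.mkℚᵘ (ℤ.+ n) 0)) ⟩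
    ℚ.toℚᵘ 1ℚ ℚᵘ.+ ℚᵘ.mkℚᵘ (ℤ.+ n) 0          ≈⟨ ℚᵘ.*≡* (≡.cong (λ i → (ℤ.+ 1 ℤ.+ i) ℤ.* ℤ.+ 1) (ℤ.*-identityʳ (ℤ.+ n))) ⟩
    ℚᵘ.mkℚᵘ (ℤ.+ suc n) 0                     ≈⟨ ℚ.toℚᵘ-fromℚᵘ (ℚᵘ.mkℚᵘ (ℤ.+ suc n) 0) ⟨
    ℚ.toℚᵘ ((ℤ.+ suc n) ℚ./ 1)                ∎))
    where open SetoidReasoning ℚᵘ.≃-setoid

  d·[m/d] : ∀ m d .{{_ : ℕ.NonZero d}} → d · ((ℤ.+ m) ℚ./ d) ≡ m · 1ℚ
  d·[m/d] m d@(suc d-1) = ≡.trans (≡.sym (≡.trans (ℚ-Mult.×-assoc-* d 1ℚ x) (≡.cong (d ·_) (ℚ.*-identityˡ x))))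
    (≡.trans (≡.cong (ℚ._* x) (n·1≡n/1 d)) (≡.trans (ℚ.toℚᵘ-injective (begin
    ℚ.toℚᵘ ((ℤ.+ d) ℚ./ 1 ℚ.* x)               ≈⟨ ℚ.toℚᵘ-homo-* ((ℤ.+ d) ℚ./ 1) x ⟩
    ℚ.toℚᵘ ((ℤ.+ d) ℚ./ 1) ℚᵘ.* ℚ.toℚᵘ x
      ≈⟨ ℚᵘ.*-cong (ℚ.toℚᵘ-fromℚᵘ (ℚᵘ.mkℚᵘ (ℤ.+ d) 0)) (ℚ.toℚᵘ-fromℚᵘ (ℚᵘ.mkℚᵘ (ℤ.+ m) d-1)) ⟩
    ℚᵘ.mkℚᵘ (ℤ.+ d) 0 ℚᵘ.* ℚᵘ.mkℚᵘ (ℤ.+ m) d-1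
      ≈⟨ ℚᵘ.*≡* (≡.trans (ℤ.*-identityʳ _) (≡.trans (ℤ.*-comm (ℤ.+ d) (ℤ.+ m))
           (≡.cong (λ k → ℤ.+ m ℤ.* ℤ.+ k) (≡.sym (ℕ.*-identityˡ d))))) ⟩
    ℚᵘ.mkℚᵘ (ℤ.+ m) 0                          ≈⟨ ℚ.toℚᵘ-fromℚᵘ (ℚᵘ.mkℚᵘ (ℤ.+ m) 0) ⟨
    ℚ.toℚᵘ ((ℤ.+ m) ℚ./ 1)                     ∎)) (≡.sym (n·1≡n/1 m))))
    where
    x = (ℤ.+ m) ℚ./ d
    open SetoidReasoning ℚᵘ.≃-setoid

  inverseFactorial : ℕ → ℚ
  inverseFactorial k = ((ℤ.+ 1) ℚ./ (k !)) {{k ℕ.!≢0}}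

  -- Both sides become 1 after multiplication by k!, which cancels in characteristic 0.
  inverseFactorial-suc : ∀ k → suc k · inverseFactorial (suc k) ≡ inverseFactorial k
  inverseFactorial-suc k = RingProperties.x∙y⁻¹≈ε⇒x≈y (CommutativeRing.ring ℚ-ring) _ _ (cancel (k !) {{k ℕ.!≢0}} (begin
    (k !) · (x ℚ.- y)                    ≡⟨ ×-distrib-+ x (ℚ.- y) (k !) ⟩
    (k !) · x ℚ.+ (k !) · (ℚ.- y)        ≡⟨ ≡.cong ((k !) · x ℚ.+_) (neg (k !)) ⟩
    (k !) · x ℚ.- (k !) · y              ≡⟨ ≡.cong₂ ℚ._-_ k!x≡1 (d·[m/d] 1 (k !) {{k ℕ.!≢0}}) ⟩
    1 · 1ℚ ℚ.- 1 · 1ℚ                    ≡⟨⟩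
    0ℚ                                   ∎))
    where
    open ≡-Reasoning
    open CommutativeMult (CommutativeRing.+-commutativeMonoid ℚ-ring) using (×-distrib-+)
    x = suc k · inverseFactorial (suc k)
    y = inverseFactorial k
    neg : ∀ n → n · (ℚ.- y) ≡ ℚ.- (n · y)
    neg zero    = ≡.refl
    neg (suc n) = ≡.trans (≡.cong (ℚ.- y ℚ.+_) (neg n)) (≡.sym (ℚ.neg-distrib-+ y (n · y)))
    k!x≡1 : (k !) · x ≡ 1 · 1ℚ
    k!x≡1 = begin
      (k !) · (suc k · inverseFactorial (suc k))   ≡⟨ ℚ-Mult.×-assocˡ _ (k !) (suc k) ⟩
      (k ! ℕ.* suc k) · inverseFactorial (suc k)   ≡⟨ ≡.cong (_· inverseFactorial (suc k)) (ℕ.*-comm (k !) (suc k)) ⟩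
      (suc k !) · inverseFactorial (suc k)         ≡⟨ d·[m/d] 1 (suc k !) {{suc k ℕ.!≢0}} ⟩
      1 · 1ℚ                                       ∎
    cancel : ∀ n .{{_ : ℕ.NonZero n}} {z} → n · z ≡ 0ℚ → z ≡ 0ℚ
    cancel (suc n) = ℚ-char-0 n

  1ˢ : PowerSeries
  1ˢ = RawRing.1# ℚ⟦t⟧

  open PowerSeriesRing ℚ-ring 1ˢ ≡.refl (λ _ → ≡.refl) public
  open PolynomialSeries ℚ-discreteDomain 1ˢ ≡.refl (λ _ → ≡.refl) public

  module ClearDenominators where
    open CommutativeRing seriesRing hiding (zero)
    open IsSubring polynomial-subring
    open Dependence seriesRing IsPolynomial polynomial-subring polynomial-zero? ⊛-domain 1ˢ≉0ˢ using (*-nonzero)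
    open SetoidReasoning setoid
    open IntegerCoefficients seriesRing

    -- With t^k as a series, the shifts in the Laurent operations become products that the ring
    -- solver can treat.
    T : ℕ → PowerSeries
    T k = shift k 1ˢ

    t^≈T : ∀ k f → (t^ k ∙ f) ≈ T k * f
    t^≈T k f n = ≡.trans (t^≡shift k f n) (≡.sym (≡.trans (⊛-shift k 1ˢ f n) (shift-cong k (⊛-identityˡ f) n)))
      where
      t^≡shift : ∀ k f n → (t^ k ∙ f) n ≡ shift k f n
      t^≡shift zero    f n       = ≡.refl
      t^≡shift (suc k) f zero    = ≡.refl
      t^≡shift (suc k) f (suc n) = t^≡shift k f n

    t^-0 : ∀ k n → (t^ k ∙ 0#) n ≡ 0ℚ
    t^-0 zero    n       = ≡.refl
    t^-0 (suc k) zero    = ≡.refl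
    t^-0 (suc k) (suc n) = t^-0 k n

    T-polynomial : ∀ k → IsPolynomial (T k)
    T-polynomial k = k ℕ.+ 1 , shift-vanishes k 1 1ˢ (λ { (suc n) _ → ≡.refl })

    T≉0 : ∀ k → ¬ T k ≈ 0#
    T≉0 k T≈0 = ℚ-1≢0 (≡.trans (≡.sym (shift-+ k 1ˢ 0)) (T≈0 (k ℕ.+ 0)))

    coefficients : List ℚ → PowerSeries
    coefficients ks = LaurentSeries.series (fromPolynomial ks)

    coefficients-polynomial : ∀ ks → IsPolynomial (coefficients ks)
    coefficients-polynomial ks = length ks , vanish ks
      where
      vanish : ∀ ks n → length ks ℕ.≤ n → coefficients ks n ≡ 0ℚ
      vanish []       n       _          = ≡.refl
      vanish (k ∷ ks) (suc n) (s≤s k≤n) = vanish ks n k≤n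

    coefficients≉0 : ∀ {ks} → NonzeroPolynomial ℚ.+-*-rawRing ks → ¬ coefficients ks ≈ 0#
    coefficients≉0 (here k≉0)   eq = k≉0 (eq 0)
    coefficients≉0 (there ks≉0) eq = coefficients≉0 ks≉0 (eq ∘ suc)

    evaluate-map : ∀ s rs X → evaluate rawRing (List.map (s *_) rs) X ≈ s * evaluate rawRing rs X
    evaluate-map s []       X = sym (zeroʳ s)
    evaluate-map s (r ∷ rs) X = begin
      s * r + X * evaluate rawRing (List.map (s *_) rs) X ≈⟨ +-congˡ {s * r} (*-congˡ {X} (evaluate-map s rs X)) ⟩
      s * r + X * (s * evaluate rawRing rs X)
        ≈⟨ solve 4 (λ s r x e → s :* r :+ x :* (s :* e) := s :* (r :+ x :* e)) (λ {_} {_} {_} {_} → refl) s r X (evaluate rawRing rs X) ⟩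
      s * (r + X * evaluate rawRing rs X)                 ∎

    open LaurentSeries using (pole; series)

    module _ (F : PowerSeries) where

      ev : List LaurentSeries → LaurentSeries
      ev ks = evaluate ℚ⦅t⦆ ks (fromPowerSeries F)

      -- A coefficient t^-a h satisfies d h = t^a n with polynomials d and n. Adding it to a value
      -- with pole b makes the series t^b h + t^a F g; the factor d ρ clears both summands, ρ being
      -- the product of the earlier denominators.
      clear : ∀ {ks} → All ℚ⟨t⟩ ks →
        ∃[ ρ ] IsPolynomial ρ × ¬ ρ ≈ 0# × ∃[ rs ] All IsPolynomial rs ×
        (NonzeroPolynomial ℚ⦅t⦆ ks → NonzeroPolynomial rawRing rs) ×
        ρ * series (ev ks) ≈ evaluate rawRing rs F
      clear [] = 1# , 1#-closed , 1ˢ≉0ˢ , [] , [] , (λ ()) , zeroʳ 1#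
      clear {(t^- a ∙ h) ∷ ks} ((num , den , den≉0 , eq) ∷ ks∈)
        with ρ , ρ-poly , ρ≉0 , rs , rs-poly , rs≉0 , eq′ ← clear ks∈ =
        d * ρ , *-closed d-poly ρ-poly , *-nonzero d≉0 ρ≉0 ,
        head ∷ List.map ((d * T a) *_) rs ,
        *-closed ρ-poly (*-closed (T-polynomial b) (*-closed (T-polynomial a) (coefficients-polynomial num))) ∷
          All.map⁺ (All.map (*-closed (*-closed d-poly (T-polynomial a))) rs-poly) ,
        nonzero , total
        where
        b : ℕ
        b = pole (ev ks)
        g d n head : PowerSeries
        g = series (ev ks)
        d = coefficients den
        n = coefficients num
        head = ρ * (T b * (T a * n))

        d-poly : IsPolynomial d
        d-poly = coefficients-polynomial den
        d≉0 : ¬ d ≈ 0#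
        d≉0 = coefficients≉0 den≉0

        dh≈ : d * h ≈ T a * n
        dh≈ i = ≡.trans (eq i) (t^≈T a n i)

        nonzero : NonzeroPolynomial ℚ⦅t⦆ ((t^- a ∙ h) ∷ ks) → NonzeroPolynomial rawRing (head ∷ List.map ((d * T a) *_) rs)
        nonzero (there ks≉0) = there (Any.map⁺ (Any.map (*-nonzero (*-nonzero d≉0 (T≉0 a))) (rs≉0 ks≉0)))
        nonzero (here k≉0)   = here (*-nonzero ρ≉0 (*-nonzero (T≉0 b) λ Tn≈0 → k≉0 λ i →
          ≡.trans (⊛-domain {d} {h} (λ j → ≡.trans (dh≈ j) (Tn≈0 j)) d≉0 i) (≡.sym (t^-0 a i))))

        total : d * ρ * ((t^ b ∙ h) + (t^ a ∙ (F * g))) ≈ head + F * evaluate rawRing (List.map ((d * T a) *_) rs) F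
        total = begin
          d * ρ * ((t^ b ∙ h) + (t^ a ∙ (F * g)))
            ≈⟨ *-congˡ {d * ρ} (+-cong {t^ b ∙ h} (t^≈T b h) (t^≈T a (F * g))) ⟩
          d * ρ * (T b * h + T a * (F * g))
            ≈⟨ solve 7 (λ d ρ b h a f g → d :* ρ :* (b :* h :+ a :* (f :* g)) := ρ :* (b :* (d :* h)) :+ f :* (d :* a :* (ρ :* g)))
                 (λ {_} {_} {_} {_} {_} {_} {_} → refl) d ρ (T b) h (T a) F g ⟩
          ρ * (T b * (d * h)) + F * (d * T a * (ρ * g))
            ≈⟨ +-cong {ρ * (T b * (d * h))} (*-congˡ {ρ} (*-congˡ {T b} dh≈)) (*-congˡ {F} (*-congˡ {d * T a} eq′)) ⟩
          head + F * (d * T a * evaluate rawRing rs F)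
            ≈⟨ +-congˡ {head} (*-congˡ {F} (evaluate-map (d * T a) rs F)) ⟨
          head + F * evaluate rawRing (List.map ((d * T a) *_) rs) F ∎

      clearDenominators : Algebraic ℚ⦅t⦆ ℚ⟨t⟩ (fromPowerSeries F) → Algebraic rawRing IsPolynomial F
      clearDenominators (ks , ks∈ , ks≉0 , ev≈0) with ρ , _ , _ , rs , rs-poly , rs≉0 , eq ← clear ks∈ =
        rs , rs-poly , rs≉0 ks≉0 , (begin
          evaluate rawRing rs F ≈⟨ eq ⟨
          ρ * series (ev ks)    ≈⟨ *-congˡ {ρ} (λ i → ≡.trans (ev≈0 i) (t^-0 (pole (ev ks)) i)) ⟩
          ρ * 0#                ≈⟨ zeroʳ ρ ⟩
          0#                    ∎)

-- The zeta function

p-part : ∀ {p} → 2 ℕ.≤ p → ∀ n → 1 ℕ.≤ n → ∃[ k ] ∃[ n′ ] n ≡ n′ ℕ.* p ℕ.^ k × ¬ p ∣ n′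
p-part {p} 2≤p n 1≤n = go n 1≤n (<-wellFounded n)
  where
  go : ∀ n → 1 ℕ.≤ n → Acc ℕ._<_ n → ∃[ k ] ∃[ n′ ] n ≡ n′ ℕ.* p ℕ.^ k × ¬ p ∣ n′
  go n 1≤n (acc rec) with p ∣? n
  ... | no  p∤n = 0 , n , ≡.sym (ℕ.*-identityʳ n) , p∤n
  ... | yes (divides (suc m) ≡.refl) with k , n′ , eq , p∤n′ ← go (suc m) (s≤s z≤n) (rec (ℕ.m<m*n (suc m) p 2≤p)) =
    suc k , n′ , ≡.trans (≡.cong (ℕ._* p) eq) (≡.trans (ℕ.*-assoc n′ _ p) (≡.cong (n′ ℕ.*_) (ℕ.*-comm _ p))) , p∤n′
  go .0 () (acc rec) | yes (divides zero ≡.refl)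

module ZetaFunction (K : DiscreteField c ℓ) {p m : ℕ} (p-prime : Prime p) (1≤m : 1 ≤ m)
  (characteristic : DiscreteField._≈_ K (DiscreteField._·_ K p (DiscreteField.1# K)) (DiscreteField.0# K))
  (closed : AlgebraicallyClosed K) {a : DiscreteField.Carrier K}
  (a≉0 : ¬ DiscreteField._≈_ K a (DiscreteField.0# K))
  (order : ∃[ e ] p ℕ.^ m ≡ suc e × DiscreteField._≈_ K (DiscreteField._^_ K a e) (DiscreteField.1# K)) where
  open DiscreteField K using (Carrier; _≈_; _+_; _*_; 1#; _≟_; semiring; setoid)
  module K = DiscreteField K
  open TrivialPowers semiring using (1^)
  open SemiringExp semiring using (_^_; ^-congˡ; ^-homo-*; ^-assocʳ)
  open RationalSeries
  open ℚ-Mult using () renaming (_×_ to _·_)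

  q e : ℕ
  q = p ℕ.^ m
  e = proj₁ order

  q≡1+e : q ≡ suc e
  q≡1+e = proj₁ (proj₂ order)

  a^e≈1 : a ^ e ≈ 1#
  a^e≈1 = proj₂ (proj₂ order)

  2≤p : 2 ℕ.≤ p
  2≤p = ℕ.nonTrivial⇒n>1 p {{prime⇒nonTrivial p-prime}}

  2≤q : 2 ℕ.≤ q
  2≤q = 2≤p^m p-prime 1≤m

  private instance
    p≢0 : ℕ.NonZero p
    p≢0 = prime⇒nonZero p-prime
    q≢0 : ℕ.NonZero q
    q≢0 = ℕ.m^n≢0 p m

  1≤e : 1 ℕ.≤ e
  1≤e = ℕ.≤-pred (≡.subst (2 ℕ.≤_) q≡1+e 2≤q)

  -- Since e + 1 = q is a multiple of p. This makes p^k the full power of p in e p^k.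
  p∤e : ¬ p ∣ e
  p∤e p∣e = ℕ.>⇒∤ 2≤p (ℕ.∣m+n∣m⇒∣n (≡.subst (p ∣_) (≡.trans q≡1+e (≡.sym (ℕ.+-comm e 1))) (m∣m^n 1≤m)) p∣e)

  a-fixed : a ^ q ≈ a
  a-fixed = K.trans (K.reflexive (≡.cong (a ^_) q≡1+e)) (K.trans (K.*-congˡ a^e≈1) (K.*-identityʳ a))

  open FixedPointCount K p-prime characteristic closed 1≤m a-fixed a≉0 using (f; count-a^n≉1; count-a^n≈1)

  f-degree : HasDegree K q f
  f-degree = ^+linear-degree K 2≤q a

  -- Index n refers to the n-th iterate, undoing the shift in `fixedPointCount`. The value at 0 is
  -- the constant term of t ζ′/ζ and not a number of fixed points.
  count : ℕ → ℕ
  count zero    = 0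
  count (suc n) = fixedPointCount K closed f 2≤q f-degree n

  count≡ : ∀ n → 1 ℕ.≤ n → ¬ a ^ n ≈ 1# → count n ≡ q ℕ.^ n
  count≡ (suc n) _ aⁿ≉1 = count-a^n≉1 n aⁿ≉1 (proj₂ (fixedPoints-finite K closed 2≤q f-degree n))

  count*≡ : ∀ n k n′ → 1 ℕ.≤ n → n ≡ n′ ℕ.* p ℕ.^ k → ¬ p ∣ n′ → a ^ n ≈ 1# → count n ℕ.* q ℕ.^ (p ℕ.^ k) ≡ q ℕ.^ n
  count*≡ (suc n) k n′ _ eq p∤n′ aⁿ≈1 =
    count-a^n≈1 n k n′ eq p∤n′ aⁿ≈1 (proj₂ (fixedPoints-finite K closed 2≤q f-degree n))

  a^[e*n]≈1 : ∀ n → a ^ (e ℕ.* n) ≈ 1#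
  a^[e*n]≈1 n = K.trans (K.sym (^-assocʳ a e n)) (K.trans (^-congˡ n a^e≈1) (1^ n))

  a-periodic : ∀ j k n → a ^ (j ℕ.* (e ℕ.* p ℕ.^ k) ℕ.+ n) ≈ a ^ n
  a-periodic j k n = begin
    a ^ (j ℕ.* (e ℕ.* p ℕ.^ k) ℕ.+ n)          ≈⟨ ^-homo-* a (j ℕ.* (e ℕ.* p ℕ.^ k)) n ⟩
    a ^ (j ℕ.* (e ℕ.* p ℕ.^ k)) * a ^ n
      ≡⟨ ≡.cong (λ i → a ^ i * a ^ n) (≡.trans (ℕ.*-comm j _) (ℕ.*-assoc e (p ℕ.^ k) j)) ⟩
    a ^ (e ℕ.* (p ℕ.^ k ℕ.* j)) * a ^ n        ≈⟨ K.*-congʳ (a^[e*n]≈1 (p ℕ.^ k ℕ.* j)) ⟩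
    1# * a ^ n                                 ≈⟨ K.*-identityˡ _ ⟩
    a ^ n                                      ∎
    where open SetoidReasoning setoid

  -- Adding a multiple of e leaves a^n unchanged. Adding a multiple of p^k leaves the power of p in
  -- n unchanged, because it is smaller than p^k. So the order of vanishing is the same and only the
  -- factor q^n changes.
  count-periodic : ∀ k j n → ¬ p ℕ.^ k ∣ n →
    count (j ℕ.* (e ℕ.* p ℕ.^ k) ℕ.+ n) ≡ q ℕ.^ (j ℕ.* (e ℕ.* p ℕ.^ k)) ℕ.* count n
  count-periodic k j zero      p^k∤n = contradiction ((p ℕ.^ k) ℕ.∣0) p^k∤n
  count-periodic k j n@(suc _) p^k∤n with (a ^ n) ≟ 1#
  ... | no aⁿ≉1 = begin
    count (M ℕ.+ n)         ≡⟨ count≡ (M ℕ.+ n) 1≤M+n (λ eq → aⁿ≉1 (K.trans (K.sym (a-periodic j k n)) eq)) ⟩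
    q ℕ.^ (M ℕ.+ n)         ≡⟨ ℕ.^-distribˡ-+-* q M n ⟩
    q ℕ.^ M ℕ.* q ℕ.^ n     ≡⟨ ≡.cong (q ℕ.^ M ℕ.*_) (count≡ n (s≤s z≤n) aⁿ≉1) ⟨
    q ℕ.^ M ℕ.* count n     ∎
    where
    open ≡-Reasoning
    M = j ℕ.* (e ℕ.* p ℕ.^ k)
    1≤M+n : 1 ℕ.≤ M ℕ.+ n
    1≤M+n = ℕ.≤-trans (s≤s z≤n) (ℕ.m≤n+m n M)
  ... | yes aⁿ≈1 with i , n′ , eq , p∤n′ ← p-part 2≤p n (s≤s z≤n) = ℕ.*-cancelʳ-≡ _ _ Q {{ℕ.m^n≢0 q (p ℕ.^ i)}} (begin
    count (M ℕ.+ n) ℕ.* Q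
      ≡⟨ count*≡ (M ℕ.+ n) i (M′ ℕ.+ n′) 1≤M+n M+n≡ p∤M′+n′ (K.trans (a-periodic j k n) aⁿ≈1) ⟩
    q ℕ.^ (M ℕ.+ n)               ≡⟨ ℕ.^-distribˡ-+-* q M n ⟩
    q ℕ.^ M ℕ.* q ℕ.^ n           ≡⟨ ≡.cong (q ℕ.^ M ℕ.*_) (count*≡ n i n′ (s≤s z≤n) eq p∤n′ aⁿ≈1) ⟨
    q ℕ.^ M ℕ.* (count n ℕ.* Q)   ≡⟨ ℕ.*-assoc (q ℕ.^ M) (count n) Q ⟨
    q ℕ.^ M ℕ.* count n ℕ.* Q     ∎)
    where
    open ≡-Reasoning
    M = j ℕ.* (e ℕ.* p ℕ.^ k)
    M′ = j ℕ.* (e ℕ.* p ℕ.^ (k ∸ i))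
    Q = q ℕ.^ (p ℕ.^ i)
    1≤M+n : 1 ℕ.≤ M ℕ.+ n
    1≤M+n = ℕ.≤-trans (s≤s z≤n) (ℕ.m≤n+m n M)
    i<k : i ℕ.< k
    i<k = ℕ.≰⇒> λ k≤i → p^k∤n (≡.subst (p ℕ.^ k ∣_) (≡.sym eq) (ℕ.∣n⇒∣m*n n′
      (≡.subst (p ℕ.^ k ∣_) (≡.trans (≡.sym (ℕ.^-distribˡ-+-* p k (i ∸ k))) (≡.cong (p ℕ.^_) (ℕ.m+[n∸m]≡n k≤i)))
        (ℕ.m∣m*n (p ℕ.^ (i ∸ k))))))
    M≡ : M ≡ M′ ℕ.* p ℕ.^ i
    M≡ = begin
      j ℕ.* (e ℕ.* p ℕ.^ k)
        ≡⟨ ≡.cong (λ r → j ℕ.* (e ℕ.* r)) (≡.trans (≡.cong (p ℕ.^_) (≡.sym (ℕ.m∸n+n≡m (ℕ.<⇒≤ i<k)))) (ℕ.^-distribˡ-+-* p (k ∸ i) i)) ⟩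
      j ℕ.* (e ℕ.* (p ℕ.^ (k ∸ i) ℕ.* p ℕ.^ i))   ≡⟨ ≡.cong (j ℕ.*_) (ℕ.*-assoc e _ _) ⟨
      j ℕ.* (e ℕ.* p ℕ.^ (k ∸ i) ℕ.* p ℕ.^ i)     ≡⟨ ℕ.*-assoc j _ _ ⟨
      M′ ℕ.* p ℕ.^ i                               ∎
    M+n≡ : M ℕ.+ n ≡ (M′ ℕ.+ n′) ℕ.* p ℕ.^ i
    M+n≡ = ≡.trans (≡.cong₂ ℕ._+_ M≡ eq) (≡.sym (ℕ.*-distribʳ-+ (p ℕ.^ i) M′ n′))
    p∤M′+n′ : ¬ p ∣ M′ ℕ.+ n′
    p∤M′+n′ p∣ = p∤n′ (ℕ.∣m+n∣m⇒∣n p∣ (ℕ.∣n⇒∣m*n j (ℕ.∣n⇒∣m*n e (m∣m^n (ℕ.m<n⇒0<n∸m i<k)))))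

  -- At e p^k the count falls short of q^(e p^k) by the factor q^(p^k), and at e p^(k+1) by the
  -- larger factor q^(p^(k+1)); the equation would make the two factors equal.
  count-aperiodic : ∀ k → ¬ count (e ℕ.* p ℕ.^ suc k) ≡ q ℕ.^ ((p ∸ 1) ℕ.* (e ℕ.* p ℕ.^ k)) ℕ.* count (e ℕ.* p ℕ.^ k)
  count-aperiodic k eq = ℕ.<⇒≢ (ℕ.^-monoʳ-< q 2≤q (ℕ.^-monoʳ-< p 2≤p (ℕ.n<1+n k)))
    (ℕ.*-cancelˡ-≡ Q₁ Q₂ (q ℕ.^ n₂) {{ℕ.m^n≢0 q n₂}} (begin
      q ℕ.^ n₂ ℕ.* Q₁                                  ≡⟨ ≡.cong (ℕ._* Q₁) (count*≡′ (suc k)) ⟨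
      count n₂ ℕ.* Q₂ ℕ.* Q₁                           ≡⟨ ≡.cong (λ c → c ℕ.* Q₂ ℕ.* Q₁) eq ⟩
      R ℕ.* count n₁ ℕ.* Q₂ ℕ.* Q₁
        ≡⟨ solveℕ 4 (λ r c x y → r :*ℕ c :*ℕ x :*ℕ y :=ℕ r :*ℕ (c :*ℕ y) :*ℕ x) ≡.refl R (count n₁) Q₂ Q₁ ⟩
      R ℕ.* (count n₁ ℕ.* Q₁) ℕ.* Q₂                   ≡⟨ ≡.cong (λ c → R ℕ.* c ℕ.* Q₂) (count*≡′ k) ⟩
      R ℕ.* q ℕ.^ n₁ ℕ.* Q₂                            ≡⟨ ≡.cong (ℕ._* Q₂) (ℕ.^-distribˡ-+-* q ((p ∸ 1) ℕ.* n₁) n₁) ⟨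
      q ℕ.^ ((p ∸ 1) ℕ.* n₁ ℕ.+ n₁) ℕ.* Q₂             ≡⟨ ≡.cong (λ n → q ℕ.^ n ℕ.* Q₂) (*-^-suc p e k) ⟨
      q ℕ.^ n₂ ℕ.* Q₂                                  ∎))
    where
    open ≡-Reasoning
    open +-*-Solver using () renaming (solve to solveℕ; _:*_ to _:*ℕ_; _:=_ to _:=ℕ_)
    n₁ = e ℕ.* p ℕ.^ k
    n₂ = e ℕ.* p ℕ.^ suc k
    Q₁ = q ℕ.^ (p ℕ.^ k)
    Q₂ = q ℕ.^ (p ℕ.^ suc k)
    R = q ℕ.^ ((p ∸ 1) ℕ.* n₁)
    count*≡′ : ∀ k → count (e ℕ.* p ℕ.^ k) ℕ.* q ℕ.^ (p ℕ.^ k) ≡ q ℕ.^ (e ℕ.* p ℕ.^ k)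
    count*≡′ k = count*≡ (e ℕ.* p ℕ.^ k) k e (ℕ.*-mono-≤ 1≤e (ℕ.m^n>0 p k)) ≡.refl p∤e (a^[e*n]≈1 (p ℕ.^ k))

  open SemiringExp (CommutativeRing.semiring ℚ-ring) using () renaming (_^_ to _^ℚ_)

  τ : ℚ
  τ = q · 1ℚ

  τ^ : ∀ n → (q ℕ.^ n) · 1ℚ ≡ τ ^ℚ n
  τ^ zero    = ≡.refl
  τ^ (suc n) = ≡.trans (ℚ-Mult.×1-homo-* q (q ℕ.^ n)) (≡.cong (τ ℚ.*_) (τ^ n))

  τ^-* : ∀ n k → (q ℕ.^ n ℕ.* k) · 1ℚ ≡ τ ^ℚ n ℚ.* (k · 1ℚ)
  τ^-* n k = ≡.trans (ℚ-Mult.×1-homo-* (q ℕ.^ n) k) (≡.cong (ℚ._* (k · 1ℚ)) (τ^ n))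

  A : PowerSeries
  A n = count n · 1ℚ

  A-transcendental : ¬ Algebraic (CommutativeRing.rawRing seriesRing) IsPolynomial A
  A-transcendental = Transcendence.transcendental ℚ-discreteDomain 1ˢ ≡.refl (λ _ → ≡.refl)
    p e 2≤p 1≤e τ ℚ-char-0 A ≡.refl
    (λ k j n p^k∤n → ≡.trans (≡.cong (_· 1ℚ) (count-periodic k j n p^k∤n)) (τ^-* (j ℕ.* (e ℕ.* p ℕ.^ k)) (count n)))
    (λ k eq → count-aperiodic k (·1-injective (count (e ℕ.* p ℕ.^ suc k))
      (q ℕ.^ ((p ∸ 1) ℕ.* (e ℕ.* p ℕ.^ k)) ℕ.* count (e ℕ.* p ℕ.^ k))
      (≡.trans eq (≡.sym (τ^-* ((p ∸ 1) ℕ.* (e ℕ.* p ℕ.^ k)) (count (e ℕ.* p ℕ.^ k)))))))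

  L F : PowerSeries
  L = logζ K closed f 2≤q f-degree
  F = ζ K closed f 2≤q f-degree

  open Exponential ℚ-discreteDomain 1ˢ ≡.refl (λ _ → ≡.refl) using (θ-exp; exp₀)

  θL≈A : θ L ≈ˢ A
  θL≈A zero    = ≡.refl
  θL≈A (suc n) = d·[m/d] (count (suc n)) (suc n)

  θF≈AF : θ F ≈ˢ A ⊛ F
  θF≈AF n = ≡.trans (θ-exp inverseFactorial ≡.refl inverseFactorial-suc L ≡.refl n) (⊛-congʳ F θL≈A n)

  F-transcendental : ¬ Algebraic (CommutativeRing.rawRing seriesRing) IsPolynomial F
  F-transcendental = Dependence.LogarithmicDerivative.algebraic⇒algebraic
    seriesRing IsPolynomial polynomial-subring polynomial-zero? ⊛-domain 1ˢ≉0ˢ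
    (λ n {x} nx≈0 i → ℚ-char-0 n (≡.trans (≡.sym (·ˢ-coefficient (suc n) x i)) (nx≈0 i)))
    θ (λ x≈y n → ≡.cong (n ·_) (x≈y n)) (λ x y n → ×-distrib-+ (x n) (y n) n) θ-⊛ θ-closed
    (λ F≈0 → ℚ-1≢0 (≡.trans (≡.sym (exp₀ inverseFactorial ≡.refl inverseFactorial-suc L ≡.refl)) (F≈0 0)))
    θF≈AF A-transcendental
    where
    open CommutativeMult (CommutativeRing.+-commutativeMonoid ℚ-ring) using (×-distrib-+)

  ζ-transcendental : Transcendental ℚ⦅t⦆ ℚ⟨t⟩ (fromPowerSeries F)
  ζ-transcendental F-algebraic = F-transcendental (ClearDenominators.clearDenominators F F-algebraic)

theorem2 : ∀ {c ℓ s} (p m : ℕ) (prime : Prime p) → ¬ (2 ∣ p) → (1≤m : 1 ≤ m) →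
    (K : DiscreteField c ℓ) (K-closure : IsAlgebraicClosureOf𝔽 K p) →
    let open DiscreteField K
        open IsAlgebraicClosureOf𝔽 K-closure
        q = p ^ℕ m
    in
    (F : Pred Carrier s) → IsSubfield K F → HasCardinality setoid F q →
    (a : Carrier) → a ∈ F → ¬ (a ≈ 0#) →
    Transcendental ℚ⦅t⦆ ℚ⟨t⟩
      (fromPowerSeries
        (ζ K algebraicallyClosed (λ x → x ^ q + a * x)
          (2≤p^m prime 1≤m) (^+linear-degree K (2≤p^m prime 1≤m) a)))
theorem2 p m p-prime _ 1≤m K K-closure F F-subfield F-card a a∈F a≉0 =
  ZetaFunction.ζ-transcendental K p-prime 1≤m characteristic algebraicallyClosed a≉0
    (FieldTheory.fermat K F-subfield F-card a∈F a≉0)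
  where open IsAlgebraicClosureOf𝔽 K-closure
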